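{- Let $p$ be a prime and let $S \subseteq \mathbb{N}_0$ be a union of finitely many arithmetic progressions together with finitely many $p$-sets. Then there exist $k \in \mathbb{N}$, an endomorphism $\Phi$ of the split torus $X = \mathbb{G}_m^k$ over $K = \overline{\mathbb{F}_p}(t)$, a point $\alpha \in X(K)$ and a closed subvariety $V \subseteq X$ defined over $K$ such that $\{ n \in \mathbb{N}_0 : \Phi^n(\alpha) \in V(K) \} = S$.
   Context: $\mathbb{N}$ denotes the positive integers and $\mathbb{N}_0 = \mathbb{N} \cup \{0\}$. An arithmetic progression in $\mathbb{N}_0$ is a set $\{a + bt : t \in \mathbb{N}_0\}$ with $a, b \in \mathbb{N}_0$. For $m \in \mathbb{N}$, $c_1,\dots,c_m \in \mathbb{Q}\setminus\{0\}$, $k_1,\dots,k_m \in \mathbb{N}_0$ and a power $q$ of $p$, set $B(q; c_1,\dots,c_m; k_1,\dots,k_m) = \{ \sum_{j=1}^m c_j q^{k_j n_j} : n_j \in \mathbb{N}_0 \text{ for each } j\}$. A $p$-set is a subset of $\mathbb{N}_0$ of the form $B(p; c_1,\dots,c_m; k_1,\dots,k_m)$ for some such $m$, $c_j$, $k_j$. A variety is not assumed irreducible; an endomorphism of $X$ means a morphism $X \to X$ defined over $K$. -}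

module Defs where

open import Algebra.Apartness.Bundles using (HeytingField; HeytingCommutativeRing)
open import Algebra.Bundles using (CommutativeRing)
import Algebra.Definitions
import Algebra.Properties.CommutativeMonoid.Sum
import Algebra.Properties.Monoid.Mult
import Algebra.Properties.Semiring.Exp
open import Data.Fin.Base using (Fin)
open import Data.Integer.Base as ℤ using (ℤ; +_; -[1+_])
open import Data.List.Base using (List; []; _∷_; _++_; foldr)
open import Data.List.Relation.Unary.All using (All)
open import Data.List.Relation.Unary.Any using (Any)
open import Data.Nat.Base as ℕ using (ℕ; suc)
open import Data.Product.Base using (Σ; _×_; _,_; proj₁; ∃; ∃₂; Σ-syntax; ∃-syntax)
open import Data.Rational.Base as ℚ using (ℚ; 0ℚ)
import Data.Rational.Properties as ℚ
open import Data.Vec.Functional using (Vector)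
open import Level using (Level; _⊔_; 0ℓ) renaming (suc to lsuc)
open import Relation.Binary.Definitions using (Decidable)
open import Relation.Binary.PropositionalEquality.Core using (_≡_; _≢_)
open import Relation.Unary using (Pred; _∈_; _≐_)

IsArithmeticProgression : Pred ℕ 0ℓ → Set
IsArithmeticProgression A =
  ∃₂ λ (a b : ℕ) → A ≐ (λ n → ∃[ t ] n ≡ a ℕ.+ b ℕ.* t)

fromℕ : ℕ → ℚ
fromℕ n = + n ℚ./ 1

open Algebra.Properties.CommutativeMonoid.Sum ℚ.+-0-commutativeMonoid
  using () renaming (sum to ∑)

B : (q : ℕ) {m : ℕ} → Vector ℚ m → Vector ℕ m → Pred ℚ 0ℓ
B q {m} c k x =
  Σ[ n ∈ Vector ℕ m ] x ≡ ∑ (λ j → c j ℚ.* fromℕ (q ℕ.^ (k j ℕ.* n j)))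

-- B p c k is a set of rationals. Equating it with the image of A in ℚ
-- includes the requirement that all its elements lie in ℕ.
IsPSet : ℕ → Pred ℕ 0ℓ → Set
IsPSet p A =
  Σ[ m ∈ ℕ ] 1 ℕ.≤ m ×
  Σ[ c ∈ Vector ℚ m ] (∀ j → c j ≢ 0ℚ) ×
  Σ[ k ∈ Vector ℕ m ] (λ x → ∃[ n ] n ∈ A × x ≡ fromℕ n) ≐ B p c k

IsFiniteUnionOfAPsAndPSets : ∀ {ℓ} → ℕ → Pred ℕ ℓ → Set (lsuc 0ℓ ⊔ ℓ)
IsFiniteUnionOfAPsAndPSets p S =
  ∃₂ λ (As Ps : List (Pred ℕ 0ℓ)) →
    All IsArithmeticProgression As × All (IsPSet p) Ps ×
    S ≐ (λ n → Any (n ∈_) (As ++ Ps))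

module _ {c ℓ₁ ℓ₂ : Level} (K : HeytingField c ℓ₁ ℓ₂) where
  open HeytingField K
  private
    module R = CommutativeRing
      (HeytingCommutativeRing.commutativeRing heytingCommutativeRing)
  open Algebra.Properties.Monoid.Mult R.+-monoid
    using () renaming (_×_ to _·_)

  -- A list of coefficients, constant term first, evaluated at a point.
  evalPoly : List Carrier → Carrier → Carrier
  evalPoly f x = foldr (λ a r → a + x * r) 0# f

  -- In characteristic p > 0 the natural multiples of 1 exhaust the prime
  -- field 𝔽ₚ.
  PrimeField : Pred Carrier ℓ₁
  PrimeField x = ∃[ n ] x ≈ n · 1#

  -- The subfield F(t) generated by t over a subfield F.
  Adjoin : ∀ {ℓ} → Pred Carrier ℓ → Carrier → Pred Carrier (c ⊔ ℓ₁ ⊔ ℓ₂ ⊔ ℓ)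
  Adjoin F t x =
    ∃₂ λ f g → All F f × All F g × evalPoly g t # 0# ×
      x * evalPoly g t ≈ evalPoly f t

  AlgebraicOver : ∀ {ℓ} → Pred Carrier ℓ → Pred Carrier (c ⊔ ℓ₁ ⊔ ℓ₂ ⊔ ℓ)
  AlgebraicOver F x =
    ∃[ f ] All F f × Any (_# 0#) f × evalPoly f x ≈ 0#

  TranscendentalOver : ∀ {ℓ} → Pred Carrier ℓ → Pred Carrier (c ⊔ ℓ₁ ⊔ ℓ)
  TranscendentalOver F x =
    ∀ f → All F f → evalPoly f x ≈ 0# → All (_≈ 0#) f

  AlgebraicallyClosed : Set (c ⊔ ℓ₁ ⊔ ℓ₂)
  AlgebraicallyClosed =
    ∀ a f → Any (_# 0#) f → ∃[ x ] evalPoly (a ∷ f) x ≈ 0#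

  HasCharacteristic : ℕ → Set ℓ₁
  HasCharacteristic p = p · 1# ≈ 0#

-- An algebraic closure of the rational function field 𝔽ₚ(t), for p prime.
-- A field is read constructively as a discrete field: the decision
-- procedure _#?_ makes every element either zero or invertible, which
-- holds for every field under excluded middle.
record AlgebraicClosureOf𝔽⟨t⟩ (p : ℕ) (c ℓ₁ ℓ₂ : Level)
       : Set (lsuc (c ⊔ ℓ₁ ⊔ ℓ₂)) where
  field
    heytingField : HeytingField c ℓ₁ ℓ₂

  open HeytingField heytingField using (Carrier; _#_) public

  field
    _#?_                : Decidable _#_
    -- As 1# # 0# in any HeytingField and p is prime, this says exactly
    -- that the characteristic is p.
    characteristic      : HasCharacteristic heytingField p
    t                   : Carrier
    t-transcendental    : TranscendentalOver heytingField (PrimeField heytingField) t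
    algebraic           : ∀ x → AlgebraicOver heytingField
                            (Adjoin heytingField (PrimeField heytingField) t) x
    algebraicallyClosed : AlgebraicallyClosed heytingField

-- K is meant to be algebraically closed, so that varieties and morphisms
-- may be described through K-points.
module SplitTorus {c ℓ₁ ℓ₂ : Level} (K : HeytingField c ℓ₁ ℓ₂) where
  open HeytingField K
  private
    module R = CommutativeRing
      (HeytingCommutativeRing.commutativeRing heytingCommutativeRing)
  open Algebra.Definitions _≈_ using (Invertible)
  open Algebra.Properties.Semiring.Exp R.semiring using (_^_)
  open Algebra.Properties.CommutativeMonoid.Sum R.*-commutativeMonoid
    using () renaming (sum to ∏)

  𝔾ₘ : Set (c ⊔ ℓ₁)
  𝔾ₘ = Σ Carrier (Invertible 1# _*_)

  -- The K-points of 𝔾ₘᵏ.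
  𝔾ₘ^_ : ℕ → Set (c ⊔ ℓ₁)
  𝔾ₘ^ k = Vector 𝔾ₘ k

  zpow : 𝔾ₘ → ℤ → Carrier
  zpow (u , _)       (+ n)    = u ^ n
  zpow (_ , u⁻¹ , _) -[1+ n ] = u⁻¹ ^ suc n

  -- Regular functions on 𝔾ₘᵏ, as formal sums of terms a x₁^e₁ ⋯ xₖ^eₖ.
  -- Repeated exponent vectors and zero coefficients are allowed.
  LaurentPolynomial : ℕ → Set c
  LaurentPolynomial k = List (Carrier × Vector ℤ k)

  eval : ∀ {k} → LaurentPolynomial k → 𝔾ₘ^ k → Carrier
  eval f x = foldr (λ (a , e) s → a * ∏ (λ i → zpow (x i) (e i)) + s) 0# f

  -- A morphism of varieties 𝔾ₘᵏ → 𝔾ₘᵏ: a tuple of regular functions mapping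
  -- the torus into itself. It need not be a group homomorphism.
  record Endomorphism (k : ℕ) : Set (c ⊔ ℓ₁) where
    field
      component  : Fin k → LaurentPolynomial k
      invertible : ∀ x i → Invertible 1# _*_ (eval (component i) x)

    apply : 𝔾ₘ^ k → 𝔾ₘ^ k
    apply x i = eval (component i) x , invertible x i

  open Endomorphism public using (apply)

  -- A closed subvariety, given by finitely many equations.
  ClosedSubvariety : ℕ → Set c
  ClosedSubvariety k = List (LaurentPolynomial k)

  points : ∀ {k} → ClosedSubvariety k → Pred (𝔾ₘ^ k) (c ⊔ ℓ₁)
  points V x = All (λ f → eval f x ≈ 0#) V

{-# OPTIONS --safe #-}

module Submission where

-- A p-set is { n : N n = D + ∑ⱼ Aⱼ p ^ (kⱼ nⱼ) } with Aⱼ > 0, a negative Aⱼ with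
-- kⱼ > 0 being impossible in ℕ. Splitting the exponents modulo a large L writes
-- it as a finite union of sets { n : N n = D + p ^ g M, M ∈ T }, where T consists
-- of the sums M = ∑ⱼ aⱼ q ^ nⱼ with q = p ^ L and 2 ∑ⱼ aⱼ < q. On the torus the
-- functions available are the f(t) ^ M with f over 𝔽_q, as exponentials in n.
--
-- First, M is a sum of at most A = ∑ⱼ aⱼ powers of q iff λ ↦ (1 + λt) ^ M has
-- degree at most A as a function on 𝔽_q; this is linear in the values. Since t is
-- transcendental it says that M C i = 0 in K whenever λ ^ i has larger degree, and
-- by Lucas' theorem it bounds the sum of the base q digits of M.
--
-- Secondly, let M = ∑ᵢ q ^ nᵢ, so that f(t) ^ M = ∏ᵢ f(yᵢ) with yᵢ = t ^ (q ^ nᵢ).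
-- Then M lies in T iff the product of t ^ M − ∏ⱼ y_σ(j) ^ aⱼ over all maps σ from
-- the j to the i vanishes. This product is built from norms ∏ᵢ (∑ₖ hₖ yᵢᵏ), and
-- interpolating in each hₖ over 𝔽_q turns them into combinations of values
-- ∏ᵢ f(yᵢ) = f(t) ^ M.
--
-- Arithmetic progressions are eventually periodic, hence visible in orbits of maps
-- that only move coordinates; unions are products of systems and of equations.

open import Defs
open import Algebra.Apartness.Bundles using (HeytingField; HeytingCommutativeRing)
import Algebra.Apartness.Properties.HeytingCommutativeRing
open import Algebra.Bundles using (CommutativeRing)
import Algebra.Properties.AbelianGroup
import Algebra.Properties.CommutativeMonoid.Sum
import Algebra.Properties.CommutativeSemiring.Exp
import Algebra.Properties.Ring
import Algebra.Properties.Semiring.Mult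
import Algebra.Solver.Ring.NaturalCoefficients.Default
open import Data.Fin.Base as Fin using (Fin; zero; suc; toℕ; fromℕ<; _↑ˡ_; _↑ʳ_; splitAt)
import Data.Fin.Properties as Fin
open import Data.Integer.Base as ℤ using (ℤ)
import Data.Integer.Properties as ℤ
import Data.Integer.Solver as ℤ-Solver
open import Data.List.Base using (List; []; _∷_; _++_; foldr; map; length; lookup; replicate; applyUpTo; cartesianProductWith)
open import Data.List.Membership.Propositional using (find; lose) renaming (_∈_ to _∈ˡ_; _∉_ to _∉ˡ_)
open import Data.List.Membership.Propositional.Properties using (∈-∃++; ∈-++⁺ˡ; ∈-++⁺ʳ)
import Data.List.Properties as List
open import Data.List.Relation.Unary.All as All using (All; []; _∷_)
import Data.List.Relation.Unary.All.Properties as All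
open import Data.List.Relation.Unary.AllPairs using (AllPairs; []; _∷_)
import Data.List.Relation.Unary.AllPairs.Properties as AllPairs
open import Data.List.Relation.Unary.Any as Any using (Any; here; there)
import Data.List.Relation.Unary.Any.Properties as Any
open import Data.Maybe.Base using (Maybe; just; nothing; maybe′)
open import Data.Nat.Base as ℕ using (ℕ; zero; suc; _≤_; _<_; z≤n; s≤s; _!)
open import Data.Nat.Combinatorics using (_C_; nCk≡n!/k![n-k]!; k![n∸k]!∣n!; nCk+nC[k+1]≡[n+1]C[k+1])
open import Data.Nat.Divisibility as ∣ using (_∣_; divides; _∣?_; ∣⇒≤)
open import Data.Nat.DivMod using (_%_; _/_; m≡m%n+[m/n]*n; m%n<n; m<n⇒m%n≡m; [m+kn]%n≡m%n; m/n<m; m/n*n≡m; m*n/n≡m; m<n⇒m/n≡0; +-distrib-/-∣ˡ)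
open import Data.Nat.GeneralisedArithmetic using (fold)
open import Data.Nat.Induction using (<-rec)
open import Data.Nat.ListAction using (sum)
open import Data.Nat.ListAction.Properties using (sum-++)
open import Data.Nat.Primality using (Prime; euclidsLemma; ¬prime[0]; ¬prime[1]; prime⇒nonTrivial)
import Data.Nat.Properties as ℕ
import Data.Nat.Solver as ℕ-Solver
open import Data.Product.Base using (Σ; Σ-syntax; _×_; _,_; proj₁; proj₂; ∃-syntax; ∃₂)
open import Data.Rational.Base as ℚ using (ℚ; ↥_; ↧ₙ_)
open import Data.Rational.Literals using (fromℤ)
import Data.Rational.Properties as ℚ
import Data.Rational.Unnormalised.Base as ℚᵘ
import Data.Rational.Unnormalised.Properties as ℚᵘ
open import Data.Sum.Base using (_⊎_; inj₁; inj₂; [_,_]′)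
open import Data.Vec.Functional as Vector using (Vector)
open import Function.Base using (_∘_; id; const)
open import Level using (Level; _⊔_; 0ℓ)
open import Relation.Binary.Definitions using (Decidable; tri<; tri≈; tri>)
open import Relation.Binary.PropositionalEquality as ≡ using (_≡_; _≢_)
import Relation.Binary.Reasoning.Setoid
open import Relation.Nullary using (¬_; ¬?; yes; no; contradiction)
open import Relation.Nullary.Decidable using (_×-dec_; decidable-stable)
open import Relation.Unary as Unary using (Pred; U; _∈_; _∪_; _∩_; _≐_)

-- Polynomials over a discrete field

-- The exponents nⱼ are not functions of n that an orbit could carry. Apart from periodic data, an
-- orbit supplies geometric sequences in n, and M is affine in n, so every condition on M has to be
-- phrased through powers x ^ M with x fixed. Taking x = f(t) with f over 𝔽_q helps because the q-th
-- power fixes the coefficients: f(t) ^ (q ^ i) = f(t ^ (q ^ i)). The points yᵢ are thus accessible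
-- only symmetrically, which is why the product runs over all σ. Its vanishing selects one σ with t
-- ^ M = t ^ (∑ⱼ aⱼ q ^ n_σ(j)), and t is not a root of unity. The degree condition has to accompany
-- this: interpolation over 𝔽_q recovers a norm only if its degree in each hₖ is below q, that is,
-- if M is a sum of fewer than q powers of q. The bound 2 ∑ⱼ aⱼ < q keeps a partial digit sum plus
-- the next digit from wrapping around modulo q - 1. The factor p ^ g, common to all terms that are
-- not constant, is removed by taking a p ^ g-th root of f(t).

module DiscreteField {c ℓ₁ ℓ₂ : Level} (K : HeytingField c ℓ₁ ℓ₂)
  (_#?_ : Decidable (HeytingField._#_ K)) where

  open HeytingField K using (_#_; heytingCommutativeRing; tight; #⇒invertible; invertible⇒#) public
  commutativeRing : CommutativeRing c ℓ₁
  commutativeRing = HeytingCommutativeRing.commutativeRing heytingCommutativeRing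

  open CommutativeRing commutativeRing public hiding (zero)
  open Algebra.Apartness.Properties.HeytingCommutativeRing heytingCommutativeRing
    using (1#0; x-0≈x; #-congʳ) public
  open Algebra.Properties.Ring ring using (-‿distribˡ-*; -‿distribʳ-*; -1*x≈-x) public
  open Algebra.Properties.AbelianGroup +-abelianGroup public
    using () renaming (x∙y⁻¹≈ε⇒x≈y to x-y≈0⇒x≈y; xyx⁻¹≈y to x+y-x≈y)
  open Algebra.Properties.CommutativeSemiring.Exp commutativeSemiring public
  open Algebra.Properties.Semiring.Mult semiring using (×-homo-+; ×1-homo-*) renaming (_×_ to _·_) public
  open Algebra.Solver.Ring.NaturalCoefficients.Default commutativeSemiring public
    using (solve; _:=_; _:+_; _:*_; con)
  module ≈ = Relation.Binary.Reasoning.Setoid setoid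

  infix 4 _≉0
  _≉0 : Carrier → Set ℓ₁
  x ≉0 = ¬ x ≈ 0#

  1≉0 : 1# ≉0
  1≉0 1≈0 = proj₂ (tight 1# 0#) 1≈0 1#0

  inverse? : ∀ x → x ≈ 0# ⊎ ∃[ y ] x * y ≈ 1#
  inverse? x with x #? 0#
  ... | no ¬x#0 = inj₁ (proj₁ (tight x 0#) ¬x#0)
  ... | yes x#0 with y , _ , xy≈1 ← #⇒invertible x#0 =
    inj₂ (y , trans (*-congʳ (sym (x-0≈x x))) xy≈1)

  -- Made total by the value 0 at 0, so that weights can contain inverses without carrying proofs.
  _⁻¹ : Carrier → Carrier
  x ⁻¹ with inverse? x
  ... | inj₁ _       = 0#
  ... | inj₂ (y , _) = y

  ⁻¹-inverseʳ : ∀ {x} → x ≉0 → x * x ⁻¹ ≈ 1#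
  ⁻¹-inverseʳ {x} x≉0 with inverse? x
  ... | inj₁ x≈0        = contradiction x≈0 x≉0
  ... | inj₂ (_ , xy≈1) = xy≈1

  ≈0? : ∀ x → x ≈ 0# ⊎ x ≉0
  ≈0? x with x #? 0#
  ... | no ¬x#0 = inj₁ (proj₁ (tight x 0#) ¬x#0)
  ... | yes x#0 = inj₂ λ x≈0 → proj₂ (tight x 0#) x≈0 x#0

  *-cancel-≉0 : ∀ {x y} → x ≉0 → x * y ≈ 0# → y ≈ 0#
  *-cancel-≉0 {x} {y} x≉0 xy≈0 = begin
    y              ≈⟨ *-identityˡ y ⟨
    1# * y         ≈⟨ *-congʳ (⁻¹-inverseʳ x≉0) ⟨
    x * x ⁻¹ * y   ≈⟨ solve 3 (λ a b d → a :* b :* d := b :* (a :* d)) refl x (x ⁻¹) y ⟩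
    x ⁻¹ * (x * y) ≈⟨ *-congˡ xy≈0 ⟩
    x ⁻¹ * 0#      ≈⟨ zeroʳ _ ⟩
    0#             ∎
    where open ≈

  *-≈0 : ∀ {x y} → x * y ≈ 0# → x ≈ 0# ⊎ y ≈ 0#
  *-≈0 {x} {y} xy≈0 with ≈0? x
  ... | inj₁ x≈0 = inj₁ x≈0
  ... | inj₂ x≉0 = inj₂ (*-cancel-≉0 x≉0 xy≈0)

  x+[y-x]≈y : ∀ x y → x + (y - x) ≈ y
  x+[y-x]≈y x y = trans (sym (+-assoc x y (- x))) (x+y-x≈y x y)

  x≈y+z⇒x-y≈z : ∀ {x y z} → x ≈ y + z → x - y ≈ z
  x≈y+z⇒x-y≈z {x} {y} {z} e = trans (+-congʳ e) (x+y-x≈y y z)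

  0^suc : ∀ n → 0# ^ suc n ≈ 0#
  0^suc n = zeroˡ _

  1^ : ∀ n → 1# ^ n ≈ 1#
  1^ zero    = refl
  1^ (suc n) = trans (*-identityˡ _) (1^ n)

  ^-≉0 : ∀ {x} n → x ≉0 → x ^ n ≉0
  ^-≉0 zero    x≉0 = 1≉0
  ^-≉0 (suc n) x≉0 e = ^-≉0 n x≉0 (*-cancel-≉0 x≉0 e)

  Poly : Set c
  Poly = List Carrier

  infix 9 _⟨_⟩
  _⟨_⟩ : Poly → Carrier → Carrier
  _⟨_⟩ = evalPoly K

  coeff : Poly → ℕ → Carrier
  coeff []      _       = 0#
  coeff (a ∷ f) zero    = a
  coeff (a ∷ f) (suc r) = coeff f r

  ⟨⟩-congˡ : ∀ f {x y} → x ≈ y → f ⟨ x ⟩ ≈ f ⟨ y ⟩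
  ⟨⟩-congˡ []      x≈y = refl
  ⟨⟩-congˡ (a ∷ f) x≈y = +-congˡ (*-cong x≈y (⟨⟩-congˡ f x≈y))

  coeff-≥length : ∀ f {r} → length f ≤ r → coeff f r ≈ 0#
  coeff-≥length []      _         = refl
  coeff-≥length (a ∷ f) (s≤s l≤r) = coeff-≥length f l≤r

  coeff≈0⇒⟨⟩≈0 : ∀ f → (∀ r → coeff f r ≈ 0#) → ∀ x → f ⟨ x ⟩ ≈ 0#
  coeff≈0⇒⟨⟩≈0 []      _  x = refl
  coeff≈0⇒⟨⟩≈0 (a ∷ f) f≈0 x = begin
    a + x * f ⟨ x ⟩ ≈⟨ +-cong (f≈0 0) (*-congˡ (coeff≈0⇒⟨⟩≈0 f (f≈0 ∘ suc) x)) ⟩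
    0# + x * 0#     ≈⟨ +-identityˡ _ ⟩
    x * 0#          ≈⟨ zeroʳ x ⟩
    0#              ∎
    where open ≈

  infixl 6 _+ₚ_
  _+ₚ_ : Poly → Poly → Poly
  []      +ₚ g       = g
  (a ∷ f) +ₚ []      = a ∷ f
  (a ∷ f) +ₚ (b ∷ g) = a + b ∷ f +ₚ g

  infixr 7 _*ₚ_
  _*ₚ_ : Carrier → Poly → Poly
  a *ₚ f = map (a *_) f

  +ₚ-⟨⟩ : ∀ f g x → (f +ₚ g) ⟨ x ⟩ ≈ f ⟨ x ⟩ + g ⟨ x ⟩
  +ₚ-⟨⟩ []      g       x = sym (+-identityˡ _)
  +ₚ-⟨⟩ (a ∷ f) []      x = sym (+-identityʳ _)
  +ₚ-⟨⟩ (a ∷ f) (b ∷ g) x = begin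
    a + b + x * (f +ₚ g) ⟨ x ⟩         ≈⟨ +-congˡ (*-congˡ (+ₚ-⟨⟩ f g x)) ⟩
    a + b + x * (f ⟨ x ⟩ + g ⟨ x ⟩)
      ≈⟨ solve 5 (λ a b x u v → a :+ b :+ x :* (u :+ v) := a :+ x :* u :+ (b :+ x :* v))
           refl a b x (f ⟨ x ⟩) (g ⟨ x ⟩) ⟩
    a + x * f ⟨ x ⟩ + (b + x * g ⟨ x ⟩) ∎
    where open ≈

  *ₚ-⟨⟩ : ∀ a f x → (a *ₚ f) ⟨ x ⟩ ≈ a * f ⟨ x ⟩
  *ₚ-⟨⟩ a []      x = sym (zeroʳ a)
  *ₚ-⟨⟩ a (b ∷ f) x = begin
    a * b + x * (a *ₚ f) ⟨ x ⟩ ≈⟨ +-congˡ (*-congˡ (*ₚ-⟨⟩ a f x)) ⟩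
    a * b + x * (a * f ⟨ x ⟩)
      ≈⟨ solve 4 (λ a b x u → a :* b :+ x :* (a :* u) := a :* (b :+ x :* u)) refl a b x (f ⟨ x ⟩) ⟩
    a * (b + x * f ⟨ x ⟩)      ∎
    where open ≈

  coeff-+ₚ : ∀ f g r → coeff (f +ₚ g) r ≈ coeff f r + coeff g r
  coeff-+ₚ []      g       r       = sym (+-identityˡ _)
  coeff-+ₚ (a ∷ f) []      r       = sym (+-identityʳ _)
  coeff-+ₚ (a ∷ f) (b ∷ g) zero    = refl
  coeff-+ₚ (a ∷ f) (b ∷ g) (suc r) = coeff-+ₚ f g r

  coeff-*ₚ : ∀ a f r → coeff (a *ₚ f) r ≈ a * coeff f r
  coeff-*ₚ a []      r       = sym (zeroʳ a)
  coeff-*ₚ a (b ∷ f) zero    = refl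
  coeff-*ₚ a (b ∷ f) (suc r) = coeff-*ₚ a f r

  length-+ₚ : ∀ {n} f g → length f ≤ n → length g ≤ n → length (f +ₚ g) ≤ n
  length-+ₚ []      g       _         g≤        = g≤
  length-+ₚ (a ∷ f) []      f≤        _         = f≤
  length-+ₚ (a ∷ f) (b ∷ g) (s≤s f≤) (s≤s g≤) = s≤s (length-+ₚ f g f≤ g≤)

  length-*ₚ : ∀ a f → length (a *ₚ f) ≡ length f
  length-*ₚ a []      = ≡.refl
  length-*ₚ a (_ ∷ f) = ≡.cong suc (length-*ₚ a f)

  -- Synthetic division: the quotient of f - f(l) by X - l, whose coefficients are the values at l
  -- of the tails of f.
  quotient : Carrier → Poly → Poly
  quotient λ′ []              = []
  quotient λ′ (a ∷ [])        = []
  quotient λ′ (a ∷ f@(_ ∷ _)) = f ⟨ λ′ ⟩ ∷ quotient λ′ f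

  length-quotient : ∀ λ′ f → length (quotient λ′ f) ≡ ℕ.pred (length f)
  length-quotient λ′ []              = ≡.refl
  length-quotient λ′ (a ∷ [])        = ≡.refl
  length-quotient λ′ (a ∷ f@(_ ∷ _)) = ≡.cong suc (length-quotient λ′ f)

  -- Writing the point as l + d keeps the identity free of subtraction, hence provable in
  -- commutative semirings.
  division : ∀ l d f → f ⟨ l + d ⟩ ≈ f ⟨ l ⟩ + d * quotient l f ⟨ l + d ⟩
  division l d []       = sym (trans (+-identityˡ _) (zeroʳ d))
  division l d (a ∷ []) = solve 3 (λ l d a → a :+ (l :+ d) :* con 0 := a :+ l :* con 0 :+ d :* con 0) refl l d a
  division l d (a ∷ f@(_ ∷ _)) = begin
    a + (l + d) * f ⟨ l + d ⟩
      ≈⟨ solve 4 (λ a l d u → a :+ (l :+ d) :* u := a :+ (d :* u :+ l :* u)) refl a l d (f ⟨ l + d ⟩) ⟩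
    a + (d * f ⟨ l + d ⟩ + l * f ⟨ l + d ⟩)
      ≈⟨ +-congˡ (+-cong (*-congˡ (division l d f)) (*-congˡ (division l d f))) ⟩
    a + (d * (f ⟨ l ⟩ + d * q) + l * (f ⟨ l ⟩ + d * q))
      ≈⟨ solve 5 (λ a l d v q → a :+ (d :* (v :+ d :* q) :+ l :* (v :+ d :* q)) :=
                                a :+ l :* v :+ d :* (v :+ (l :+ d) :* q)) refl a l d (f ⟨ l ⟩) q ⟩
    a + l * f ⟨ l ⟩ + d * (f ⟨ l ⟩ + (l + d) * q) ∎
    where
    open ≈
    q = quotient l f ⟨ l + d ⟩

  division′ : ∀ l x f → f ⟨ x ⟩ ≈ f ⟨ l ⟩ + (x - l) * quotient l f ⟨ x ⟩
  division′ l x f = begin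
    f ⟨ x ⟩ ≈⟨ ⟨⟩-congˡ f (x+[y-x]≈y l x) ⟨
    f ⟨ l + (x - l) ⟩ ≈⟨ division l (x - l) f ⟩
    f ⟨ l ⟩ + (x - l) * quotient l f ⟨ l + (x - l) ⟩
      ≈⟨ +-congˡ (*-congˡ (⟨⟩-congˡ (quotient l f) (x+[y-x]≈y l x))) ⟩
    f ⟨ l ⟩ + (x - l) * quotient l f ⟨ x ⟩ ∎
    where open ≈

  -- Comparison of coefficients in f = f(l) + (X - l) h. Together with the next lemma it recovers
  -- the coefficients of f from f(l) and those of h.
  coeff-quotient-zero : ∀ l f → f ⟨ l ⟩ ≈ coeff f 0 + l * coeff (quotient l f) 0
  coeff-quotient-zero l []              = sym (trans (+-identityˡ _) (zeroʳ l))
  coeff-quotient-zero l (a ∷ [])        = refl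
  coeff-quotient-zero l (a ∷ f@(_ ∷ _)) = refl

  coeff-quotient-suc : ∀ l f r → coeff (quotient l f) r ≈ coeff f (suc r) + l * coeff (quotient l f) (suc r)
  coeff-quotient-suc l []              r       = sym (trans (+-identityˡ _) (zeroʳ l))
  coeff-quotient-suc l (a ∷ [])        r       = sym (trans (+-identityˡ _) (zeroʳ l))
  coeff-quotient-suc l (a ∷ f@(_ ∷ _)) zero    = coeff-quotient-zero l f
  coeff-quotient-suc l (a ∷ f@(_ ∷ _)) (suc r) = coeff-quotient-suc l f r

  -- Interpolation: coefficients as combinations of values

  Weights : Set c
  Weights = List (Carrier × Carrier)

  weightedSum : Weights → (Carrier → Carrier) → Carrier
  weightedSum W u = foldr (λ (w , x) s → w * u x + s) 0# W

  weightedSum-cong : ∀ {ℓ} {S : Pred Carrier ℓ} W {u v : Carrier → Carrier} → All (S ∘ proj₂) W →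
                     (∀ {x} → S x → u x ≈ v x) → weightedSum W u ≈ weightedSum W v
  weightedSum-cong []            []       u≈v = refl
  weightedSum-cong ((w , x) ∷ W) (Sx ∷ SW) u≈v = +-cong (*-congˡ (u≈v Sx)) (weightedSum-cong W SW u≈v)

  weightedSum-++ : ∀ W W′ u → weightedSum (W ++ W′) u ≈ weightedSum W u + weightedSum W′ u
  weightedSum-++ []            W′ u = sym (+-identityˡ _)
  weightedSum-++ ((w , x) ∷ W) W′ u = trans (+-congˡ (weightedSum-++ W W′ u)) (sym (+-assoc _ _ _))

  weightedSum-+ : ∀ W u v → weightedSum W (λ x → u x + v x) ≈ weightedSum W u + weightedSum W v
  weightedSum-+ []            u v = sym (+-identityˡ _)
  weightedSum-+ ((w , x) ∷ W) u v = trans (+-congˡ (weightedSum-+ W u v))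
    (solve 5 (λ w a b s t → w :* (a :+ b) :+ (s :+ t) := w :* a :+ s :+ (w :* b :+ t)) refl
       w (u x) (v x) (weightedSum W u) (weightedSum W v))

  weightedSum-* : ∀ W a u → weightedSum W (λ x → a * u x) ≈ a * weightedSum W u
  weightedSum-* []            a u = sym (zeroʳ a)
  weightedSum-* ((w , x) ∷ W) a u = trans (+-congˡ (weightedSum-* W a u))
    (solve 4 (λ w a b s → w :* (a :* b) :+ a :* s := a :* (w :* b :+ s)) refl
       w a (u x) (weightedSum W u))

  scale : Carrier → Weights → Weights
  scale a = map (λ (w , x) → a * w , x)

  weightedSum-scale : ∀ a W u → weightedSum (scale a W) u ≈ a * weightedSum W u
  weightedSum-scale a []            u = sym (zeroʳ a)
  weightedSum-scale a ((w , x) ∷ W) u = trans (+-congˡ (weightedSum-scale a W u))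
    (solve 4 (λ w a b s → a :* w :* b :+ a :* s := a :* (w :* b :+ s)) refl
       w a (u x) (weightedSum W u))

  -- Lagrange interpolation in dual form. The weights do not depend on P, so they can later be
  -- applied to values that are known only as expressions.
  Evaluative : ∀ {ℓ} → Pred Carrier ℓ → ℕ → (Poly → Carrier) → Set (c ⊔ ℓ₁ ⊔ ℓ)
  Evaluative S n F =
    ∃[ W ] All (S ∘ proj₂) W × (∀ P → length P ≤ n → weightedSum W (P ⟨_⟩) ≈ F P)

  module _ {ℓ} {S : Pred Carrier ℓ} {n : ℕ} where

    evaluative-cong : ∀ {F G} → (∀ P → F P ≈ G P) → Evaluative S n F → Evaluative S n G
    evaluative-cong F≈G (W , SW , eq) = W , SW , λ P P≤n → trans (eq P P≤n) (F≈G P)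

    evaluative-+ : ∀ {F G} → Evaluative S n F → Evaluative S n G → Evaluative S n (λ P → F P + G P)
    evaluative-+ (W , SW , eq) (W′ , SW′ , eq′) = W ++ W′ , All.++⁺ SW SW′ , λ P P≤n →
      trans (weightedSum-++ W W′ _) (+-cong (eq P P≤n) (eq′ P P≤n))

    evaluative-* : ∀ {F} a → Evaluative S n F → Evaluative S n (λ P → a * F P)
    evaluative-* a (W , SW , eq) = scale a W , All.map⁺ SW , λ P P≤n →
      trans (weightedSum-scale a W _) (*-congˡ (eq P P≤n))

    evaluative-eval : ∀ {x} → S x → Evaluative S n (_⟨ x ⟩)
    evaluative-eval {x} Sx = (1# , x) ∷ [] , Sx ∷ [] , λ P _ → trans (+-identityʳ _) (*-identityˡ _)

  -- The value of `quotient l P` at x is the divided difference (P(x) - P(l)) / (x - l), so a weight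
  -- at x becomes one at x and one at l.
  evaluative-quotient : ∀ {ℓ} {S : Pred Carrier ℓ} {n l F} → S l →
    Evaluative (λ x → S x × ¬ x ≈ l) n F → Evaluative S (suc n) (F ∘ quotient l)
  evaluative-quotient {S = S} {n} {l} {F} Sl (W , SW , eq) =
    diff W , all W SW , λ P P≤ → trans (diff-eq P W SW) (eq (quotient l P)
      (ℕ.≤-trans (ℕ.≤-reflexive (length-quotient l P)) (ℕ.pred-mono-≤ P≤)))
    where
    diff : Weights → Weights
    diff []            = []
    diff ((w , x) ∷ W) = (w * (x - l) ⁻¹ , x) ∷ (- (w * (x - l) ⁻¹) , l) ∷ diff W

    all : ∀ W → All ((λ x → S x × ¬ x ≈ l) ∘ proj₂) W → All (S ∘ proj₂) (diff W)
    all []            []             = []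
    all ((w , x) ∷ W) ((Sx , _) ∷ SW) = Sx ∷ Sl ∷ all W SW

    diff-eq : ∀ P W → All ((λ x → S x × ¬ x ≈ l) ∘ proj₂) W →
              weightedSum (diff W) (P ⟨_⟩) ≈ weightedSum W (quotient l P ⟨_⟩)
    diff-eq P []            []              = refl
    diff-eq P ((w , x) ∷ W) ((_ , x≉l) ∷ SW) = begin
      v * P ⟨ x ⟩ + (- v * P ⟨ l ⟩ + s)
        ≈⟨ +-congʳ (*-congˡ (division′ l x P)) ⟩
      v * (P ⟨ l ⟩ + (x - l) * q) + (- v * P ⟨ l ⟩ + s)
        ≈⟨ solve 7 (λ w i y u d q s → w :* i :* (u :+ d :* q) :+ (y :* u :+ s) :=
                     (w :* i :+ y) :* u :+ w :* (d :* i) :* q :+ s) refl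
             w ((x - l) ⁻¹) (- v) (P ⟨ l ⟩) (x - l) q s ⟩
      (v - v) * P ⟨ l ⟩ + w * ((x - l) * (x - l) ⁻¹) * q + s
        ≈⟨ +-congʳ (+-cong (*-congʳ (-‿inverseʳ v)) (*-congʳ (*-congˡ (⁻¹-inverseʳ x-l≉0)))) ⟩
      0# * P ⟨ l ⟩ + w * 1# * q + s
        ≈⟨ solve 4 (λ u w q s → con 0 :* u :+ w :* con 1 :* q :+ s := w :* q :+ s) refl (P ⟨ l ⟩) w q s ⟩
      w * q + s
        ≈⟨ +-congˡ (diff-eq P W SW) ⟩
      w * q + weightedSum W (quotient l P ⟨_⟩) ∎
      where
      open ≈
      v = w * (x - l) ⁻¹
      q = quotient l P ⟨ x ⟩
      s = weightedSum (diff W) (P ⟨_⟩)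
      x-l≉0 : x - l ≉0
      x-l≉0 e = x≉l (x-y≈0⇒x≈y _ _ e)

  -- Newton interpolation by recursion on the points: the coefficients of P follow from P(l) and
  -- those of the quotient, which has one coefficient fewer and is evaluated at the remaining
  -- points.
  evaluative-coeff : ∀ {ℓ} {S : Pred Carrier ℓ} xs → All S xs → AllPairs (λ x y → ¬ y ≈ x) xs →
                     ∀ r → Evaluative S (length xs) (λ P → coeff P r)
  evaluative-coeff []       []        []             r = [] , [] , λ { [] _ → refl }
  evaluative-coeff {S = S} (l ∷ xs) (Sl ∷ Sxs) (l≉xs ∷ distinct) = λ where
      zero    → evaluative-cong (λ P → x≈y+z⇒ (trans (coeff-quotient-zero l P) (+-comm _ _)))
                  (evaluative-+ (evaluative-eval Sl) (evaluative-* (- l) (q 0)))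
      (suc r) → evaluative-cong (λ P → x≈y+z⇒ (trans (coeff-quotient-suc l P r) (+-comm _ _)))
                  (evaluative-+ (q r) (evaluative-* (- l) (q (suc r))))
    where
    q : ∀ r → Evaluative S (suc (length xs)) (λ P → coeff (quotient l P) r)
    q r = evaluative-quotient Sl
      (evaluative-coeff xs (All.zip (Sxs , l≉xs)) distinct r)
    x≈y+z⇒ : ∀ {x y z} → x ≈ l * y + z → x + - l * y ≈ z
    x≈y+z⇒ e = trans (+-congˡ (sym (-‿distribˡ-* _ _))) (x≈y+z⇒x-y≈z e)

  -- With the set of roots itself as S, every evaluation in the weighted sum is zero.
  manyRoots⇒coeff≈0 : ∀ P xs → AllPairs (λ x y → ¬ y ≈ x) xs → length P ≤ length xs →
                      All (λ x → P ⟨ x ⟩ ≈ 0#) xs → ∀ r → coeff P r ≈ 0#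
  manyRoots⇒coeff≈0 P xs distinct P≤xs roots r with evaluative-coeff xs roots distinct r
  ... | W , roots′ , eq = trans (sym (eq P P≤xs)) (vanish W roots′)
    where
    vanish : ∀ W → All ((λ x → P ⟨ x ⟩ ≈ 0#) ∘ proj₂) W → weightedSum W (P ⟨_⟩) ≈ 0#
    vanish []            []       = refl
    vanish ((w , x) ∷ W) (e ∷ es) = trans (+-cong (trans (*-congˡ e) (zeroʳ w)) (vanish W es)) (+-identityˡ 0#)

-- Polynomial expressions as syntax

infixl 6 _⊕_
infixl 7 _⊗_
-- Syntax rather than functions, because variables are eliminated one at a time (from `Maybe V` to
-- `V`) and the result is finally expanded into a Laurent polynomial.
data Expr {a b} (A : Set a) (V : Set b) : Set (a ⊔ b) where
  scalar  : A → Expr A V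
  var     : V → Expr A V
  _⊕_ _⊗_ : Expr A V → Expr A V → Expr A V

rename : ∀ {a b b′} {A : Set a} {V : Set b} {V′ : Set b′} → (V → V′) → Expr A V → Expr A V′
rename σ (scalar a) = scalar a
rename σ (var v)    = var (σ v)
rename σ (e ⊕ e′)   = rename σ e ⊕ rename σ e′
rename σ (e ⊗ e′)   = rename σ e ⊗ rename σ e′

module Semantics {c ℓ₁ ℓ₂ : Level} (K : HeytingField c ℓ₁ ℓ₂)
  (_#?_ : Decidable (HeytingField._#_ K)) where

  open DiscreteField K _#?_

  ⟦_⟧ : ∀ {b} {V : Set b} → Expr Carrier V → (V → Carrier) → Carrier
  ⟦ scalar a ⟧ ρ = a
  ⟦ var v    ⟧ ρ = ρ v
  ⟦ e ⊕ e′   ⟧ ρ = ⟦ e ⟧ ρ + ⟦ e′ ⟧ ρ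
  ⟦ e ⊗ e′   ⟧ ρ = ⟦ e ⟧ ρ * ⟦ e′ ⟧ ρ

  ⟦⟧-cong : ∀ {b} {V : Set b} (e : Expr Carrier V) {ρ ρ′ : V → Carrier} → (∀ v → ρ v ≈ ρ′ v) → ⟦ e ⟧ ρ ≈ ⟦ e ⟧ ρ′
  ⟦⟧-cong (scalar a) ρ≈ρ′ = refl
  ⟦⟧-cong (var v)    ρ≈ρ′ = ρ≈ρ′ v
  ⟦⟧-cong (e ⊕ e′)   ρ≈ρ′ = +-cong (⟦⟧-cong e ρ≈ρ′) (⟦⟧-cong e′ ρ≈ρ′)
  ⟦⟧-cong (e ⊗ e′)   ρ≈ρ′ = *-cong (⟦⟧-cong e ρ≈ρ′) (⟦⟧-cong e′ ρ≈ρ′)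

  ⟦⟧-rename : ∀ {b b′} {V : Set b} {V′ : Set b′} (σ : V → V′) e ρ → ⟦ rename σ e ⟧ ρ ≡ ⟦ e ⟧ (ρ ∘ σ)
  ⟦⟧-rename σ (scalar a) ρ = ≡.refl
  ⟦⟧-rename σ (var v)    ρ = ≡.refl
  ⟦⟧-rename σ (e ⊕ e′)   ρ = ≡.cong₂ _+_ (⟦⟧-rename σ e ρ) (⟦⟧-rename σ e′ ρ)
  ⟦⟧-rename σ (e ⊗ e′)   ρ = ≡.cong₂ _*_ (⟦⟧-rename σ e ρ) (⟦⟧-rename σ e′ ρ)

-- Characteristic p

prime∣!⇒≤ : ∀ {p} n → Prime p → p ∣ n ! → p ≤ n
prime∣!⇒≤ zero    pp p∣1 = contradiction (≡.subst Prime (∣.∣1⇒≡1 p∣1) pp) ¬prime[1]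
prime∣!⇒≤ (suc n) pp p∣  with euclidsLemma (suc n) (n !) pp p∣
... | inj₁ p∣1+n = ∣⇒≤ p∣1+n
... | inj₂ p∣n!  = ℕ.m≤n⇒m≤1+n (prime∣!⇒≤ n pp p∣n!)

-- p divides p! = (p C k) k! (p - k)!, but neither of the two factorials on the right.
prime∣binomial : ∀ {p k} → Prime p → 0 < k → k < p → p ∣ p C k
prime∣binomial {p@(suc p-1)} {k} pp 0<k k<p
  with euclidsLemma (p C k) (k ! ℕ.* (p ℕ.∸ k) !) pp (≡.subst (p ∣_) p!≡ (∣.m∣m*n (p-1 !)))
  where
  instance _ = k ℕ.!* (p ℕ.∸ k) !≢0
  p!≡ : p ! ≡ (p C k) ℕ.* (k ! ℕ.* (p ℕ.∸ k) !)
  p!≡ = ≡.sym (≡.trans (≡.cong (ℕ._* (k ! ℕ.* (p ℕ.∸ k) !)) (nCk≡n!/k![n-k]! (ℕ.<⇒≤ k<p)))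
                       (m/n*n≡m (k![n∸k]!∣n! (ℕ.<⇒≤ k<p))))
... | inj₁ p∣C = p∣C
... | inj₂ p∣k!r! with euclidsLemma (k !) ((p ℕ.∸ k) !) pp p∣k!r!
...   | inj₁ p∣k! = contradiction (prime∣!⇒≤ k pp p∣k!) (ℕ.<⇒≱ k<p)
...   | inj₂ p∣r! = contradiction (prime∣!⇒≤ (p ℕ.∸ k) pp p∣r!) (ℕ.<⇒≱ (ℕ.∸-monoʳ-< 0<k (ℕ.<⇒≤ k<p)))

module PositiveCharacteristic {c ℓ₁ ℓ₂ : Level} {p : ℕ} (p-prime : Prime p)
  (𝕂 : AlgebraicClosureOf𝔽⟨t⟩ p c ℓ₁ ℓ₂) where

  open AlgebraicClosureOf𝔽⟨t⟩ 𝕂 using (heytingField; _#?_; characteristic; t; t-transcendental; algebraicallyClosed) public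
  open DiscreteField heytingField _#?_ public

  1≤p : 1 ≤ p
  1≤p = ℕ.n≢0⇒n>0 λ { ≡.refl → ¬prime[0] p-prime }

  PF : Pred Carrier ℓ₁
  PF = PrimeField heytingField

  p∣⇒·1≈0 : ∀ {n} → p ∣ n → n · 1# ≈ 0#
  p∣⇒·1≈0 (divides q ≡.refl) = trans (×1-homo-* q p) (trans (*-congˡ characteristic) (zeroʳ _))

  PF-0 : PF 0#
  PF-0 = 0 , refl

  PF-1 : PF 1#
  PF-1 = 1 , sym (+-identityʳ 1#)

  PF-+ₚ : ∀ {f g} → All PF f → All PF g → All PF (f +ₚ g)
  PF-+ₚ []       Pg       = Pg
  PF-+ₚ (a ∷ Pf) []       = a ∷ Pf
  PF-+ₚ ((m , a≈m) ∷ Pf) ((n , b≈n) ∷ Pg) =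
    (m ℕ.+ n , trans (+-cong a≈m b≈n) (sym (×-homo-+ 1# m n))) ∷ PF-+ₚ Pf Pg

  shift : ℕ → Poly → Poly
  shift k f = replicate k 0# ++ f

  shift-⟨⟩ : ∀ k f x → shift k f ⟨ x ⟩ ≈ x ^ k * f ⟨ x ⟩
  shift-⟨⟩ zero    f x = sym (*-identityˡ _)
  shift-⟨⟩ (suc k) f x = trans (+-identityˡ _) (trans (*-congˡ (shift-⟨⟩ k f x)) (sym (*-assoc x _ _)))

  coeff-shift-< : ∀ {k r} f → r < k → coeff (shift k f) r ≈ 0#
  coeff-shift-< {suc k} {zero}  f _         = refl
  coeff-shift-< {suc k} {suc r} f (s≤s r<k) = coeff-shift-< {k} f r<k

  coeff-shift-+ : ∀ k f r → coeff (shift k f) (k ℕ.+ r) ≡ coeff f r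
  coeff-shift-+ zero    f r = ≡.refl
  coeff-shift-+ (suc k) f r = coeff-shift-+ k f r

  monomial : ℕ → Carrier → Poly
  monomial k a = shift k (a ∷ [])

  monomial-⟨⟩ : ∀ k a x → monomial k a ⟨ x ⟩ ≈ x ^ k * a
  monomial-⟨⟩ k a x = trans (shift-⟨⟩ k (a ∷ []) x) (*-congˡ (trans (+-congˡ (zeroʳ x)) (+-identityʳ a)))

  length-monomial : ∀ k a → length (monomial k a) ≡ suc k
  length-monomial zero    a = ≡.refl
  length-monomial (suc k) a = ≡.cong suc (length-monomial k a)

  coeff-monomial : ∀ k a → coeff (monomial k a) k ≈ a
  coeff-monomial k a = reflexive (≡.trans (≡.cong (coeff (monomial k a)) (≡.sym (ℕ.+-identityʳ k))) (coeff-shift-+ k (a ∷ []) 0))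

  coeff-monomial-≢ : ∀ k a {r} → r ≢ k → coeff (monomial k a) r ≈ 0#
  coeff-monomial-≢ k a {r} r≢k with ℕ.<-cmp r k
  ... | tri< r<k _ _ = coeff-shift-< (a ∷ []) r<k
  ... | tri≈ _ r≡k _ = contradiction r≡k r≢k
  ... | tri> _ _ k<r = coeff-≥length (monomial k a) (ℕ.≤-trans (ℕ.≤-reflexive (length-monomial k a)) k<r)

  All-monomial : ∀ {ℓ} {P : Pred Carrier ℓ} {a} k → P 0# → P a → All P (monomial k a)
  All-monomial k P0 Pa = All.++⁺ (All.replicate⁺ k P0) (Pa ∷ [])

  t≉0 : t ≉0
  t≉0 t≈0 with t-transcendental (0# ∷ 1# ∷ []) (PF-0 ∷ PF-1 ∷ [])
    (trans (+-identityˡ _) (trans (*-congʳ t≈0) (zeroˡ _)))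
  ... | _ ∷ 1≈0 ∷ [] = 1≉0 1≈0

  t^suc≉1 : ∀ k → ¬ t ^ suc k ≈ 1#
  t^suc≉1 k t^≈1 = 1≉0 (All.head (All.++⁻ʳ (replicate k 0#) (All.tail
    -- X ^ suc k - 1, with - 1 written as (p - 1) · 1 to lie visibly in the prime field. Its leading
    -- coefficient 1 cannot vanish.
    (t-transcendental (ℕ.pred p · 1# ∷ monomial k 1#) ((ℕ.pred p , refl) ∷ All-monomial k PF-0 PF-1) (begin
      ℕ.pred p · 1# + t * monomial k 1# ⟨ t ⟩ ≈⟨ +-congˡ (*-congˡ (monomial-⟨⟩ k 1# t)) ⟩
      ℕ.pred p · 1# + t * (t ^ k * 1#)        ≈⟨ +-congˡ (trans (*-congˡ (*-identityʳ _)) t^≈1) ⟩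
      ℕ.pred p · 1# + 1#                      ≈⟨ +-comm _ _ ⟩
      suc (ℕ.pred p) · 1#                     ≡⟨ ≡.cong (_· 1#) (ℕ.suc-pred p {{ℕ.>-nonZero 1≤p}}) ⟩
      p · 1#                                  ≈⟨ characteristic ⟩
      0#                                      ∎)))))
    where open ≈

  t^-< : ∀ {i j} → i < j → ¬ t ^ j ≈ t ^ i
  t^-< {i} {j} i<j e = t^suc≉1 k (x-y≈0⇒x≈y _ _ (*-cancel-≉0 (^-≉0 i t≉0) (begin
      t ^ i * (t ^ suc k - 1#)         ≈⟨ distribˡ _ _ _ ⟩
      t ^ i * t ^ suc k + t ^ i * - 1# ≈⟨ +-cong (^-homo-* t i (suc k)) (-‿distribʳ-* _ _) ⟨
      t ^ (i ℕ.+ suc k) - t ^ i * 1#   ≡⟨ ≡.cong (λ n → t ^ n - t ^ i * 1#) (≡.trans (ℕ.+-suc i k) (ℕ.m+[n∸m]≡n i<j)) ⟩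
      t ^ j - t ^ i * 1#               ≈⟨ +-cong e (-‿cong (*-identityʳ _)) ⟩
      t ^ i - t ^ i                    ≈⟨ -‿inverseʳ _ ⟩
      0#                               ∎)))
    where
    open ≈
    k = j ℕ.∸ suc i

  t^-injective : ∀ {i j} → t ^ i ≈ t ^ j → i ≡ j
  t^-injective {i} {j} e with ℕ.<-cmp i j
  ... | tri< i<j _ _ = contradiction (sym e) (t^-< i<j)
  ... | tri≈ _ i≡j _ = i≡j
  ... | tri> _ _ j<i = contradiction e (t^-< j<i)

  -- The powers of t are infinitely many distinct nonzero points of K. Testing at nonzero points
  -- alone lets later arguments cancel a factor x first.
  vanishing⇒coeff≈0 : ∀ f → (∀ x → x ≉0 → f ⟨ x ⟩ ≈ 0#) → ∀ r → coeff f r ≈ 0#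
  vanishing⇒coeff≈0 f f≈0 = manyRoots⇒coeff≈0 f (applyUpTo (t ^_) (length f))
    (AllPairs.applyUpTo⁺₁ (t ^_) (length f) (λ i<j _ → t^-< i<j))
    (ℕ.≤-reflexive (≡.sym (List.length-applyUpTo (t ^_) (length f))))
    (All.applyUpTo⁺₂ (t ^_) (length f) (λ i → f≈0 (t ^ i) (^-≉0 i t≉0)))

  coeff-unique : ∀ f g → (∀ x → f ⟨ x ⟩ ≈ g ⟨ x ⟩) → ∀ r → coeff f r ≈ coeff g r
  coeff-unique f g f≈g r = x-y≈0⇒x≈y _ _ (begin
    coeff f r - coeff g r               ≈⟨ +-congˡ (-1*x≈-x _) ⟨
    coeff f r + - 1# * coeff g r        ≈⟨ +-congˡ (coeff-*ₚ (- 1#) g r) ⟨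
    coeff f r + coeff (- 1# *ₚ g) r     ≈⟨ coeff-+ₚ f (- 1# *ₚ g) r ⟨
    coeff (f +ₚ - 1# *ₚ g) r            ≈⟨ vanishing⇒coeff≈0 (f +ₚ - 1# *ₚ g) (λ x _ → vanishes x) r ⟩
    0#                                  ∎)
    where
    open ≈
    vanishes : ∀ x → (f +ₚ - 1# *ₚ g) ⟨ x ⟩ ≈ 0#
    vanishes x = begin
      (f +ₚ - 1# *ₚ g) ⟨ x ⟩        ≈⟨ +ₚ-⟨⟩ f (- 1# *ₚ g) x ⟩
      f ⟨ x ⟩ + (- 1# *ₚ g) ⟨ x ⟩   ≈⟨ +-cong (f≈g x) (trans (*ₚ-⟨⟩ (- 1#) g x) (-1*x≈-x _)) ⟩
      g ⟨ x ⟩ - g ⟨ x ⟩             ≈⟨ -‿inverseʳ _ ⟩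
      0#                            ∎

  coeff-cong⇒⟨⟩ : ∀ f g → (∀ r → coeff f r ≈ coeff g r) → ∀ x → f ⟨ x ⟩ ≈ g ⟨ x ⟩
  coeff-cong⇒⟨⟩ []      g       e x = sym (coeff≈0⇒⟨⟩≈0 g (sym ∘ e) x)
  coeff-cong⇒⟨⟩ (a ∷ f) []      e x = coeff≈0⇒⟨⟩≈0 (a ∷ f) e x
  coeff-cong⇒⟨⟩ (a ∷ f) (b ∷ g) e x = +-cong (e 0) (*-congˡ (coeff-cong⇒⟨⟩ f g (e ∘ suc) x))

  -- Binomial coefficients in K and additivity of p-power maps

  binomial : ℕ → Poly
  binomial zero    = 1# ∷ []
  binomial (suc M) = binomial M +ₚ (0# ∷ binomial M)

  binomial-⟨⟩ : ∀ M y → binomial M ⟨ y ⟩ ≈ (1# + y) ^ M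
  binomial-⟨⟩ zero    y = trans (+-congˡ (zeroʳ y)) (+-identityʳ 1#)
  binomial-⟨⟩ (suc M) y = begin
    (binomial M +ₚ (0# ∷ binomial M)) ⟨ y ⟩ ≈⟨ +ₚ-⟨⟩ (binomial M) (0# ∷ binomial M) y ⟩
    b + (0# + y * b)                        ≈⟨ solve 2 (λ b y → b :+ (con 0 :+ y :* b) := (con 1 :+ y) :* b) refl b y ⟩
    (1# + y) * b                            ≈⟨ *-congˡ (binomial-⟨⟩ M y) ⟩
    (1# + y) * (1# + y) ^ M                 ∎
    where
    open ≈
    b = binomial M ⟨ y ⟩

  binomial-0 : ∀ M → coeff (binomial M) 0 ≈ 1#
  binomial-0 zero    = refl
  binomial-0 (suc M) = trans (coeff-+ₚ (binomial M) (0# ∷ binomial M) 0) (trans (+-identityʳ _) (binomial-0 M))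

  binomial-suc : ∀ M r → coeff (binomial (suc M)) (suc r) ≈ coeff (binomial M) (suc r) + coeff (binomial M) r
  binomial-suc M r = coeff-+ₚ (binomial M) (0# ∷ binomial M) (suc r)

  length-binomial : ∀ M → length (binomial M) ≤ suc M
  length-binomial zero    = s≤s z≤n
  length-binomial (suc M) = length-+ₚ (binomial M) (0# ∷ binomial M)
    (ℕ.m≤n⇒m≤1+n (length-binomial M)) (s≤s (length-binomial M))

  binomial-> : ∀ {M r} → M < r → coeff (binomial M) r ≈ 0#
  binomial-> {M} M<r = coeff-≥length (binomial M) (ℕ.≤-trans (length-binomial M) M<r)

  binomial-diagonal : ∀ M → coeff (binomial M) M ≈ 1#
  binomial-diagonal zero    = refl
  binomial-diagonal (suc M) = trans (binomial-suc M M)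
    (trans (+-cong (binomial-> (ℕ.n<1+n M)) (binomial-diagonal M)) (+-identityˡ 1#))

  binomial≈C : ∀ M r → coeff (binomial M) r ≈ (M C r) · 1#
  binomial≈C M       zero    = trans (binomial-0 M) (proj₂ PF-1)
  binomial≈C zero    (suc r) = refl
  binomial≈C (suc M) (suc r) = begin
    coeff (binomial (suc M)) (suc r)                  ≈⟨ binomial-suc M r ⟩
    coeff (binomial M) (suc r) + coeff (binomial M) r ≈⟨ +-cong (binomial≈C M (suc r)) (binomial≈C M r) ⟩
    (M C suc r) · 1# + (M C r) · 1#                   ≈⟨ +-comm _ _ ⟩
    (M C r) · 1# + (M C suc r) · 1#                   ≈⟨ ×-homo-+ 1# (M C r) (M C suc r) ⟨
    ((M C r) ℕ.+ (M C suc r)) · 1#                        ≡⟨ ≡.cong (_· 1#) (nCk+nC[k+1]≡[n+1]C[k+1] M r) ⟩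
    (suc M C suc r) · 1#                              ∎
    where open ≈

  PF-binomial : ∀ M → All PF (binomial M)
  PF-binomial zero    = PF-1 ∷ []
  PF-binomial (suc M) = PF-+ₚ (PF-binomial M) (PF-0 ∷ PF-binomial M)

  Additive : ℕ → Set _
  Additive q = ∀ x y → (x + y) ^ q ≈ x ^ q + y ^ q

  coeff-binomial-p : ∀ r → coeff (binomial p) r ≈ coeff (1# ∷ monomial (ℕ.pred p) 1#) r
  coeff-binomial-p zero = binomial-0 p
  coeff-binomial-p (suc r) with ℕ.<-cmp (suc r) p
  ... | tri< r<p _ _ = trans (binomial≈C p (suc r)) (trans
    (p∣⇒·1≈0 (prime∣binomial p-prime (s≤s z≤n) r<p)) (sym (coeff-shift-< (1# ∷ []) (ℕ.<⇒≤pred r<p))))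
  ... | tri≈ _ ≡.refl _ = trans (binomial-diagonal p) (sym (coeff-monomial r 1#))
  ... | tri> _ _ p<r = trans (binomial-> p<r) (sym (coeff-≥length (monomial (ℕ.pred p) 1#)
    (ℕ.≤-trans (ℕ.≤-reflexive (length-monomial (ℕ.pred p) 1#)) (ℕ.≤-trans
      (ℕ.≤-reflexive (ℕ.suc-pred p {{ℕ.>-nonZero 1≤p}})) (ℕ.≤-pred p<r)))))

  [1+x]^p : ∀ y → (1# + y) ^ p ≈ 1# + y ^ p
  [1+x]^p y = begin
    (1# + y) ^ p                          ≈⟨ binomial-⟨⟩ p y ⟨
    binomial p ⟨ y ⟩                      ≈⟨ coeff-cong⇒⟨⟩ (binomial p) (1# ∷ monomial (ℕ.pred p) 1#) coeff-binomial-p y ⟩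
    1# + y * monomial (ℕ.pred p) 1# ⟨ y ⟩ ≈⟨ +-congˡ (*-congˡ (trans (monomial-⟨⟩ (ℕ.pred p) 1# y) (*-identityʳ _))) ⟩
    1# + y ^ suc (ℕ.pred p)               ≡⟨ ≡.cong (λ n → 1# + y ^ n) (ℕ.suc-pred p {{ℕ.>-nonZero 1≤p}}) ⟩
    1# + y ^ p                            ∎
    where open ≈

  0^ : ∀ {n} → 1 ≤ n → 0# ^ n ≈ 0#
  0^ (s≤s _) = zeroˡ _

  -- By homogeneity: for x ≠ 0 the identity is x ^ p times the case of 1 + z with z = y / x.
  additive-p : Additive p
  additive-p x y with ≈0? x
  ... | inj₁ x≈0 = begin
    (x + y) ^ p   ≈⟨ ^-congˡ p (trans (+-congʳ x≈0) (+-identityˡ y)) ⟩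
    y ^ p         ≈⟨ +-identityˡ _ ⟨
    0# + y ^ p    ≈⟨ +-congʳ (trans (^-congˡ p x≈0) (0^ 1≤p)) ⟨
    x ^ p + y ^ p ∎
    where open ≈
  ... | inj₂ x≉0 = begin
    (x + y) ^ p                     ≈⟨ ^-congˡ p (trans (distribˡ _ _ _) (+-cong (*-identityʳ x) xz≈y)) ⟨
    (x * (1# + z)) ^ p              ≈⟨ ^-distrib-* x (1# + z) p ⟩
    x ^ p * (1# + z) ^ p            ≈⟨ *-congˡ ([1+x]^p z) ⟩
    x ^ p * (1# + z ^ p)            ≈⟨ trans (distribˡ _ _ _) (+-cong (*-identityʳ _) (sym (^-distrib-* x z p))) ⟩
    x ^ p + (x * z) ^ p             ≈⟨ +-congˡ (^-congˡ p xz≈y) ⟩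
    x ^ p + y ^ p                   ∎
    where
    open ≈
    z = x ⁻¹ * y
    xz≈y : x * z ≈ y
    xz≈y = trans (sym (*-assoc _ _ _)) (trans (*-congʳ (⁻¹-inverseʳ x≉0)) (*-identityˡ y))

  additive-* : ∀ {q r} → Additive q → Additive r → Additive (q ℕ.* r)
  additive-* {q} {r} add-q add-r x y = begin
    (x + y) ^ (q ℕ.* r)             ≈⟨ ^-assocʳ (x + y) q r ⟨
    ((x + y) ^ q) ^ r               ≈⟨ ^-congˡ r (add-q x y) ⟩
    (x ^ q + y ^ q) ^ r             ≈⟨ add-r _ _ ⟩
    (x ^ q) ^ r + (y ^ q) ^ r       ≈⟨ +-cong (^-assocʳ x q r) (^-assocʳ y q r) ⟩
    x ^ (q ℕ.* r) + y ^ (q ℕ.* r)   ∎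
    where open ≈

  additive-p^ : ∀ k → Additive (p ℕ.^ k)
  additive-p^ zero    x y = trans (*-identityʳ _) (sym (+-cong (*-identityʳ x) (*-identityʳ y)))
  additive-p^ (suc k) = additive-* {p} {p ℕ.^ k} additive-p (additive-p^ k)

-- Finite subfields

module FiniteSubfield {c ℓ₁ ℓ₂ : Level} {p : ℕ} (p-prime : Prime p)
  (𝕂 : AlgebraicClosureOf𝔽⟨t⟩ p c ℓ₁ ℓ₂) where

  open PositiveCharacteristic p-prime 𝕂 public

  -- The bound counts coefficients, so it means degree less than n.
  IsPoly : ℕ → (Carrier → Carrier) → Set _
  IsPoly n F = ∃[ P ] length P ≤ n × (∀ x → P ⟨ x ⟩ ≈ F x)

  isPoly-const : ∀ a → IsPoly 1 (λ _ → a)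
  isPoly-const a = a ∷ [] , s≤s z≤n , λ x → trans (+-congˡ (zeroʳ x)) (+-identityʳ a)

  isPoly-+ : ∀ {n F G} → IsPoly n F → IsPoly n G → IsPoly n (λ x → F x + G x)
  isPoly-+ (P , P≤n , eq) (P′ , P′≤n , eq′) =
    P +ₚ P′ , length-+ₚ P P′ P≤n P′≤n , λ x → trans (+ₚ-⟨⟩ P P′ x) (+-cong (eq x) (eq′ x))

  isPoly-≤ : ∀ {m n F} → m ≤ n → IsPoly m F → IsPoly n F
  isPoly-≤ m≤n (P , P≤m , eq) = P , ℕ.≤-trans P≤m m≤n , eq

  isPoly-affine* : ∀ {n F} a b → IsPoly n F → IsPoly (suc n) (λ x → (a + x * b) * F x)
  isPoly-affine* {n} {F} a b (P , P≤n , eq) =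
    a *ₚ P +ₚ (0# ∷ b *ₚ P) ,
    length-+ₚ (a *ₚ P) (0# ∷ b *ₚ P)
      (ℕ.≤-trans (ℕ.≤-reflexive (length-*ₚ a P)) (ℕ.m≤n⇒m≤1+n P≤n))
      (s≤s (ℕ.≤-trans (ℕ.≤-reflexive (length-*ₚ b P)) P≤n)) ,
    λ x → begin
      (a *ₚ P +ₚ (0# ∷ b *ₚ P)) ⟨ x ⟩       ≈⟨ +ₚ-⟨⟩ (a *ₚ P) (0# ∷ b *ₚ P) x ⟩
      (a *ₚ P) ⟨ x ⟩ + (0# + x * (b *ₚ P) ⟨ x ⟩)
        ≈⟨ +-cong (*ₚ-⟨⟩ a P x) (+-congˡ (*-congˡ (*ₚ-⟨⟩ b P x))) ⟩
      a * P ⟨ x ⟩ + (0# + x * (b * P ⟨ x ⟩))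
        ≈⟨ solve 4 (λ a b x u → a :* u :+ (con 0 :+ x :* (b :* u)) := (a :+ x :* b) :* u) refl a b x (P ⟨ x ⟩) ⟩
      (a + x * b) * P ⟨ x ⟩                 ≈⟨ *-congˡ (eq x) ⟩
      (a + x * b) * F x                     ∎
    where open ≈

  isPoly-cong : ∀ {n F G} → (∀ x → F x ≈ G x) → IsPoly n F → IsPoly n G
  isPoly-cong F≈G (P , P≤n , eq) = P , P≤n , λ x → trans (eq x) (F≈G x)

  isPoly-^ : ∀ n → IsPoly (suc n) (_^ n)
  isPoly-^ zero    = isPoly-const 1#
  isPoly-^ (suc n) = isPoly-cong
    (λ x → *-congʳ (trans (+-identityˡ _) (*-identityʳ x))) (isPoly-affine* 0# 1# (isPoly-^ n))

  isPoly-translate : ∀ {n F} l → (∀ {x y} → x ≈ y → F x ≈ F y) → IsPoly n F → IsPoly n (λ x → F (l + x))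
  isPoly-translate l F-cong (P , P≤n , eq) =
    isPoly-cong (λ x → eq (l + x)) (isPoly-≤ P≤n (translate P))
    where
    translate : ∀ P → IsPoly (length P) (λ x → P ⟨ l + x ⟩)
    translate []      = [] , z≤n , λ _ → refl
    translate (a ∷ P) = isPoly-+ (isPoly-≤ (s≤s z≤n) (isPoly-const a))
      (isPoly-cong (λ x → *-congʳ (+-congˡ (*-identityʳ x))) (isPoly-affine* l 1# (translate P)))

  isPoly-vanishing : ∀ {n F} → IsPoly n F → (∀ x → x ≉0 → F x ≈ 0#) → ∀ x → F x ≈ 0#
  isPoly-vanishing (P , _ , eq) F≈0 x = trans (sym (eq x))
    (coeff≈0⇒⟨⟩≈0 P (vanishing⇒coeff≈0 P λ y y≉0 → trans (eq y) (F≈0 y y≉0)) x)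

  ∏ : ∀ {A : Set c} → (A → Carrier) → List A → Carrier
  ∏ u = foldr (λ y s → u y * s) 1#

  ∏-∷ : ∀ {A : Set c} (u : A → Carrier) (ys : List A) {y} zs → ∏ u (ys ++ y ∷ zs) ≈ u y * ∏ u (ys ++ zs)
  ∏-∷ u []       zs = refl
  ∏-∷ u (x ∷ ys) zs = trans (*-congˡ (∏-∷ u ys zs))
    (solve 3 (λ a b c → a :* (b :* c) := b :* (a :* c)) refl (u x) _ _)

  isPoly-∏ : ∀ {A : Set c} (a b : A → Carrier) ys → IsPoly (suc (length ys)) (λ x → ∏ (λ y → a y + x * b y) ys)
  isPoly-∏ a b []       = isPoly-const 1#
  isPoly-∏ a b (y ∷ ys) = isPoly-affine* (a y) (b y) (isPoly-∏ a b ys)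

  -- The field of q elements as the fixed points of x ↦ x ^ q

  module GaloisField (k : ℕ) where

    q : ℕ
    q = p ℕ.^ suc k

    𝔽 : Pred Carrier ℓ₁
    𝔽 x = x ^ q ≈ x

    2≤q : 2 ≤ q
    2≤q = ℕ.≤-trans (ℕ.≤-reflexive (≡.sym (ℕ.*-identityʳ 2)))
      (ℕ.*-mono-≤ (ℕ.nonTrivial⇒n>1 p {{prime⇒nonTrivial p-prime}}) (ℕ.m^n>0 p {{ℕ.>-nonZero 1≤p}} k))

    q-2 : ℕ
    q-2 = ℕ.pred (ℕ.pred q)

    q≡2+[q-2] : q ≡ suc (suc q-2)
    q≡2+[q-2] = lemma 2≤q
      where
      lemma : ∀ {q} → 2 ≤ q → q ≡ suc (suc (ℕ.pred (ℕ.pred q)))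
      lemma (s≤s (s≤s _)) = ≡.refl

    ^q : ∀ x → x ^ q ≡ x ^ suc (suc q-2)
    ^q x = ≡.cong (x ^_) q≡2+[q-2]

    additive-q : Additive q
    additive-q = additive-p^ (suc k)

    𝔽-0 : 𝔽 0#
    𝔽-0 = 0^ (ℕ.≤-trans (s≤s z≤n) 2≤q)

    𝔽-1 : 𝔽 1#
    𝔽-1 = 1^ q

    𝔽-+ : ∀ {x y} → 𝔽 x → 𝔽 y → 𝔽 (x + y)
    𝔽-+ {x} {y} Fx Fy = trans (additive-q x y) (+-cong Fx Fy)

    -- Since x ↦ x ^ q − x is additive, a double root ν gives a double root 0.
    simpleRoots : ∀ {m} ν F → 𝔽 ν → IsPoly m F → (∀ {x y} → x ≈ y → F x ≈ F y) →
                  ¬ (∀ x → x ^ q - x ≈ (x - ν) * ((x - ν) * F x))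
    simpleRoots {m} ν F Fν F-poly F-cong eq = 1≉0 (begin
        1#                                     ≈⟨ +-identityˡ 1# ⟨
        0# + 1#                                ≈⟨ +-cong (trans (*-congʳ (+-identityˡ _)) (trans (*-congʳ (zeroˡ 1#)) (zeroˡ _)))
                                                   (trans (+-congˡ (trans (*-congʳ (0^suc q-2)) (zeroˡ _))) (+-identityʳ 1#)) ⟨
        E 0#                                   ≈⟨ isPoly-vanishing E-poly E≈0 0# ⟩
        0#                                     ∎)
      where
      open ≈
      -- y E(y) is y² F(ν + y) - (y ^ q - y), which is zero by additivity and the factorisation.
      -- Hence E vanishes off 0 and, being polynomial, also at 0, where its value is 1.
      E : Carrier → Carrier
      E y = (0# + y * 1#) * F (ν + y) + (1# + y ^ suc q-2 * - 1#)
      N = suc m ℕ.+ suc (suc q-2)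
      E-poly : IsPoly N E
      E-poly = isPoly-+ (isPoly-≤ (ℕ.m≤m+n (suc m) _) (isPoly-affine* 0# 1# (isPoly-translate ν F-cong F-poly)))
        (isPoly-≤ (ℕ.m≤n+m _ (suc m)) (isPoly-+ (isPoly-≤ (s≤s z≤n) (isPoly-const 1#))
          (isPoly-cong (λ x → trans (*-congʳ (trans (+-congˡ (zeroʳ x)) (+-identityʳ _))) (*-comm _ _))
            (isPoly-affine*′ (isPoly-^ (suc q-2))))))
        where
        isPoly-affine*′ : ∀ {n F} → IsPoly n F → IsPoly n (λ x → (- 1# + x * 0#) * F x)
        isPoly-affine*′ (P , P≤n , e) = - 1# *ₚ P , ℕ.≤-trans (ℕ.≤-reflexive (length-*ₚ (- 1#) P)) P≤n ,
          λ x → trans (*ₚ-⟨⟩ (- 1#) P x) (*-cong (sym (trans (+-congˡ (zeroʳ x)) (+-identityʳ _))) (e x))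
      E≈0 : ∀ y → y ≉0 → E y ≈ 0#
      E≈0 y y≉0 = *-cancel-≉0 y≉0 (begin
        y * E y
          ≈⟨ solve 4 (λ y f w m → y :* ((con 0 :+ y :* con 1) :* f :+ (con 1 :+ w :* m)) :=
                                  y :* (y :* f) :+ (y :+ y :* w :* m)) refl y (F (ν + y)) (y ^ suc q-2) (- 1#) ⟩
        y * (y * F (ν + y)) + (y + y ^ suc (suc q-2) * - 1#)
          ≈⟨ +-congʳ (*-cong x-ν (*-congʳ x-ν)) ⟨
        (x - ν) * ((x - ν) * F x) + (y + y ^ suc (suc q-2) * - 1#)
          ≈⟨ +-cong (sym (eq x)) (+-congˡ (trans (*-comm _ _) (-1*x≈-x _))) ⟩
        x ^ q - x + (y - y ^ suc (suc q-2))
          ≈⟨ +-cong (+-congʳ (additive-q ν y)) (+-congˡ (-‿cong (reflexive (≡.sym (^q y))))) ⟩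
        ν ^ q + y ^ q - x + (y - y ^ q)
          ≈⟨ +-congʳ (+-congʳ (+-congʳ Fν)) ⟩
        ν + y ^ q - x + (y - y ^ q)
          ≈⟨ solve 5 (λ v w mx y mw → v :+ w :+ mx :+ (y :+ mw) := v :+ y :+ mx :+ (w :+ mw)) refl ν (y ^ q) (- x) y (- y ^ q) ⟩
        x - x + (y ^ q - y ^ q)
          ≈⟨ +-cong (-‿inverseʳ x) (-‿inverseʳ _) ⟩
        0# + 0#
          ≈⟨ +-identityʳ 0# ⟩
        0# ∎)
        where
        x = ν + y
        x-ν : x - ν ≈ y
        x-ν = x+y-x≈y ν y

    Monic : ℕ → Poly → Set _
    Monic d g = length g ≡ suc d × coeff g d ≈ 1#

    monic-quotient : ∀ {d} l g → Monic (suc d) g → Monic d (quotient l g)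
    monic-quotient {d} l g (len , lead) = length-q , (begin
        coeff (quotient l g) d                               ≈⟨ coeff-quotient-suc l g d ⟩
        coeff g (suc d) + l * coeff (quotient l g) (suc d)
          ≈⟨ +-cong lead (*-congˡ (coeff-≥length (quotient l g) (ℕ.≤-reflexive length-q))) ⟩
        1# + l * 0#                                          ≈⟨ trans (+-congˡ (zeroʳ l)) (+-identityʳ 1#) ⟩
        1#                                                   ∎)
      where
      open ≈
      length-q : length (quotient l g) ≡ suc d
      length-q = ≡.trans (length-quotient l g) (≡.cong ℕ.pred len)

    monic-root : ∀ {d} g → Monic (suc d) g → ∃[ μ ] g ⟨ μ ⟩ ≈ 0#
    monic-root {d} (a ∷ f) (_ , lead) = algebraicallyClosed a f (search f d lead)
      where
      search : ∀ f d → coeff f d ≈ 1# → Any (_# 0#) f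
      search []      d       0≈1  = contradiction (sym 0≈1) 1≉0
      search (b ∷ f) zero    b≈1  = here (#-congʳ (sym b≈1) 1#0)
      search (b ∷ f) (suc d) lead = there (search f d lead)

    record Roots (m d : ℕ) : Set (c ⊔ ℓ₁) where
      field
        roots         : List Carrier
        number        : length roots ≡ m
        distinct      : AllPairs (λ x y → ¬ y ≈ x) roots
        fixed         : All 𝔽 roots
        cofactor      : Poly
        monic         : Monic d cofactor
        factorisation : ∀ x → x ^ q - x ≈ ∏ (λ ν → x - ν) roots * cofactor ⟨ x ⟩

    -- The cofactor has a root μ because K is algebraically closed; if μ were among the earlier
    -- roots, X ^ q - X would have a double root.
    nextRoot : ∀ {m d} → Roots m (suc d) → Roots (suc m) d
    nextRoot {m} {d} r = record
      { roots         = μ ∷ roots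
      ; number        = ≡.cong suc number
      ; distinct      = All.tabulate (λ ν∈ ν≈μ → new ν∈ ν≈μ) ∷ distinct
      ; fixed         = x-y≈0⇒x≈y _ _ (trans (factorisation μ) (trans (*-congˡ g[μ]≈0) (zeroʳ _))) ∷ fixed
      ; cofactor      = quotient μ cofactor
      ; monic         = monic-quotient μ cofactor monic
      ; factorisation = λ x → trans (factorisation x) (trans (*-congˡ (g≈ x))
          (solve 3 (λ a b c → a :* (b :* c) := b :* a :* c) refl _ _ _))
      }
      where
      open ≈
      open Roots r
      μ = proj₁ (monic-root cofactor monic)
      g[μ]≈0 = proj₂ (monic-root cofactor monic)
      h = quotient μ cofactor
      g≈ : ∀ x → cofactor ⟨ x ⟩ ≈ (x - μ) * h ⟨ x ⟩
      g≈ x = trans (division′ μ x cofactor) (trans (+-congʳ g[μ]≈0) (+-identityˡ _))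
      new : ∀ {ν} → ν ∈ˡ roots → ¬ ν ≈ μ
      new {ν} ν∈ ν≈μ with ys , zs , eq ← ∈-∃++ ν∈ =
        simpleRoots ν F (All.lookup fixed ν∈) (h *∏ (ys ++ zs)) F-cong λ x → begin
          x ^ q - x                                    ≈⟨ factorisation x ⟩
          ∏ (λ ν → x - ν) roots * cofactor ⟨ x ⟩              ≡⟨ ≡.cong (λ xs → ∏ (λ ν → x - ν) xs * cofactor ⟨ x ⟩) eq ⟩
          ∏ (λ ν → x - ν) (ys ++ ν ∷ zs) * cofactor ⟨ x ⟩     ≈⟨ *-cong (∏-∷ (λ ν → x - ν) ys zs) (g≈ x) ⟩
          (x - ν) * ∏ (λ ν → x - ν) (ys ++ zs) * ((x - μ) * h ⟨ x ⟩)
            ≈⟨ *-congˡ (*-congʳ (+-congˡ (-‿cong (sym ν≈μ)))) ⟩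
          (x - ν) * ∏ (λ ν → x - ν) (ys ++ zs) * ((x - ν) * h ⟨ x ⟩)
            ≈⟨ solve 3 (λ a b c → a :* b :* (a :* c) := a :* (a :* (b :* c))) refl _ _ _ ⟩
          (x - ν) * ((x - ν) * F x)                    ∎
        where
        F : Carrier → Carrier
        F x = ∏ (λ ν → x - ν) (ys ++ zs) * h ⟨ x ⟩
        ∏-cong : ∀ ys {x y} → x ≈ y → ∏ (λ ν → x - ν) ys ≈ ∏ (λ ν → y - ν) ys
        ∏-cong []       e = refl
        ∏-cong (_ ∷ ys) e = *-cong (+-congʳ e) (∏-cong ys e)
        F-cong : ∀ {x y} → x ≈ y → F x ≈ F y
        F-cong e = *-cong (∏-cong (ys ++ zs) e) (⟨⟩-congˡ h e)
        _*∏_ : ∀ h ys → IsPoly (length ys ℕ.+ length h) (λ x → ∏ (λ ν → x - ν) ys * h ⟨ x ⟩)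
        h *∏ []       = h , ℕ.≤-refl , λ x → sym (*-identityˡ _)
        h *∏ (y ∷ ys) = isPoly-cong (λ x → trans (*-congʳ (trans (+-comm _ _) (+-congʳ (*-identityʳ x)))) (sym (*-assoc _ _ _)))
          (isPoly-affine* (- y) 1# (h *∏ ys))

    allRoots : ∀ m d → m ℕ.+ d ≡ q → Roots m d
    allRoots zero d ≡.refl = record
      { roots         = []
      ; number        = ≡.refl
      ; distinct      = []
      ; fixed         = []
      -- X ^ q - X itself: two coefficients precede the monomial of degree q - 2.
      ; cofactor      = 0# ∷ - 1# ∷ monomial q-2 1#
      ; monic         = ≡.trans (≡.cong (2 ℕ.+_) (length-monomial q-2 1#)) (≡.cong suc (≡.sym q≡2+[q-2])) ,
                        ≡.subst (λ d → coeff (0# ∷ - 1# ∷ monomial q-2 1#) d ≈ 1#) (≡.sym q≡2+[q-2]) (coeff-monomial q-2 1#)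
      ; factorisation = λ x → begin
          x ^ q - x                                       ≡⟨ ≡.cong (_- x) (^q x) ⟩
          x * (x * x ^ q-2) - x                             ≈⟨ +-congˡ (-1*x≈-x x) ⟨
          x * (x * x ^ q-2) + - 1# * x
            ≈⟨ solve 3 (λ x w m → x :* (x :* w) :+ m :* x := con 1 :* (con 0 :+ x :* (m :+ x :* (w :* con 1))))
                 refl x (x ^ q-2) (- 1#) ⟩
          1# * (0# + x * (- 1# + x * (x ^ q-2 * 1#)))
            ≈⟨ *-congˡ (+-congˡ (*-congˡ (+-congˡ (*-congˡ (monomial-⟨⟩ q-2 1# x))))) ⟨
          1# * (0# + x * (- 1# + x * monomial q-2 1# ⟨ x ⟩)) ∎
      }
      where
      open ≈
    allRoots (suc m) d eq = nextRoot (allRoots m (suc d) (≡.trans (ℕ.+-suc m d) eq))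

    -- X ^ q - X has q distinct roots in K, which are enough points for all polynomials of degree
    -- less than q.
    interpolation : ∀ r → Evaluative 𝔽 q (λ P → coeff P r)
    interpolation r = ≡.subst (λ l → Evaluative 𝔽 l (λ P → coeff P r)) number
      (evaluative-coeff roots fixed distinct r)
      where open Roots (allRoots q 0 (ℕ.+-identityʳ q))

    frobenius : ∀ {f} → All 𝔽 f → ∀ x → f ⟨ x ⟩ ^ q ≈ f ⟨ x ^ q ⟩
    frobenius []                 x = 𝔽-0
    frobenius {a ∷ f} (Fa ∷ Ff) x = trans (additive-q a (x * f ⟨ x ⟩))
      (+-cong Fa (trans (^-distrib-* x (f ⟨ x ⟩) q) (*-congˡ (frobenius Ff x))))

    -- The reason for taking coefficients in 𝔽: raising f(x) to a power of q only moves the point x.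
    frobenius^ : ∀ {f} → All 𝔽 f → ∀ x m → f ⟨ x ⟩ ^ (q ℕ.^ m) ≈ f ⟨ x ^ (q ℕ.^ m) ⟩
    frobenius^ {f} Ff x zero    = trans (*-identityʳ _) (⟨⟩-congˡ f (sym (*-identityʳ x)))
    frobenius^ {f} Ff x (suc m) = begin
      f ⟨ x ⟩ ^ (q ℕ.* q ℕ.^ m)     ≈⟨ ^-assocʳ (f ⟨ x ⟩) q (q ℕ.^ m) ⟨
      (f ⟨ x ⟩ ^ q) ^ (q ℕ.^ m)     ≈⟨ ^-congˡ (q ℕ.^ m) (frobenius Ff x) ⟩
      f ⟨ x ^ q ⟩ ^ (q ℕ.^ m)       ≈⟨ frobenius^ Ff (x ^ q) m ⟩
      f ⟨ (x ^ q) ^ (q ℕ.^ m) ⟩     ≈⟨ ⟨⟩-congˡ f (^-assocʳ x q (q ℕ.^ m)) ⟩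
      f ⟨ x ^ (q ℕ.* q ℕ.^ m) ⟩     ∎
      where open ≈

-- Sums of powers of q

module DigitSum {c ℓ₁ ℓ₂ : Level} {p : ℕ} (p-prime : Prime p)
  (𝕂 : AlgebraicClosureOf𝔽⟨t⟩ p c ℓ₁ ℓ₂) (k : ℕ) where

  open FiniteSubfield p-prime 𝕂
  open GaloisField k

  instance
    q≢0 : ℕ.NonZero q
    q≢0 = ℕ.>-nonZero (ℕ.≤-trans (s≤s z≤n) 2≤q)

  -- The exponent below q that gives the same function on 𝔽. It is the class modulo q - 1, with 0
  -- kept apart from q - 1 because x ^ 0 and x ^ (q - 1) differ at x = 0.
  reduce : ℕ → ℕ
  reduce zero    = 0
  reduce (suc j) = suc (j % suc q-2)

  reduce-< : ∀ j → reduce j < q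
  reduce-< j = ≡.subst (reduce j <_) (≡.sym q≡2+[q-2]) (lemma j)
    where
    lemma : ∀ j → reduce j < suc (suc q-2)
    lemma zero    = s≤s z≤n
    lemma (suc j) = s≤s (m%n<n j (suc q-2))

  reduce-id : ∀ {j} → j < q → reduce j ≡ j
  reduce-id {zero}  _   = ≡.refl
  reduce-id {suc j} j<q = ≡.cong suc (m<n⇒m%n≡m (ℕ.≤-pred (≡.subst (suc j <_) q≡2+[q-2] j<q)))

  -- The identity x ^ q = x at the level of exponents.
  reduce-q* : ∀ s j → reduce (s ℕ.+ q ℕ.* j) ≡ reduce (s ℕ.+ j)
  reduce-q* s j = ≡.trans (≡.cong (λ q → reduce (s ℕ.+ q ℕ.* j)) q≡2+[q-2]) (lemma s j)
    where
    open ≡.≡-Reasoning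
    lemma : ∀ s j → reduce (s ℕ.+ suc (suc q-2) ℕ.* j) ≡ reduce (s ℕ.+ j)
    lemma (suc s) j = ≡.cong suc (begin
      (s ℕ.+ (j ℕ.+ suc q-2 ℕ.* j)) % suc q-2 ≡⟨ ≡.cong (_% suc q-2) (ℕ.+-assoc s j _) ⟨
      (s ℕ.+ j ℕ.+ suc q-2 ℕ.* j) % suc q-2   ≡⟨ ≡.cong (λ i → (s ℕ.+ j ℕ.+ i) % suc q-2) (ℕ.*-comm (suc q-2) j) ⟩
      (s ℕ.+ j ℕ.+ j ℕ.* suc q-2) % suc q-2   ≡⟨ [m+kn]%n≡m%n (s ℕ.+ j) j (suc q-2) ⟩
      (s ℕ.+ j) % suc q-2                     ∎)
    lemma zero zero    = ≡.cong reduce (ℕ.*-zeroʳ q-2)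
    lemma zero (suc j) = ≡.cong suc (begin
      (j ℕ.+ suc q-2 ℕ.* suc j) % suc q-2 ≡⟨ ≡.cong (λ i → (j ℕ.+ i) % suc q-2) (ℕ.*-comm (suc q-2) (suc j)) ⟩
      (j ℕ.+ suc j ℕ.* suc q-2) % suc q-2 ≡⟨ [m+kn]%n≡m%n j (suc j) (suc q-2) ⟩
      j % suc q-2                         ∎)

  reduce-^ : ∀ {x} → 𝔽 x → ∀ j → x ^ j ≈ x ^ reduce j
  reduce-^ Fx zero = refl
  reduce-^ {x} Fx (suc j) = begin
    x ^ suc j                                                 ≡⟨ ≡.cong (λ j → x ^ suc j) (m≡m%n+[m/n]*n j (suc q-2)) ⟩
    x ^ suc (j % suc q-2 ℕ.+ j / suc q-2 ℕ.* suc q-2)         ≈⟨ lemma (j / suc q-2) ⟩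
    x ^ suc (j % suc q-2)                                     ∎
    where
    open ≈
    r = j % suc q-2
    lemma : ∀ m → x ^ suc (r ℕ.+ m ℕ.* suc q-2) ≈ x ^ suc r
    lemma zero    = reflexive (≡.cong (λ j → x ^ suc j) (ℕ.+-identityʳ r))
    lemma (suc m) = begin
      x ^ suc (r ℕ.+ (suc q-2 ℕ.+ m ℕ.* suc q-2)) ≡⟨ ≡.cong (x ^_) (rearrange (suc q-2) (m ℕ.* suc q-2)) ⟩
      x ^ (suc (suc q-2) ℕ.+ (r ℕ.+ m ℕ.* suc q-2)) ≈⟨ ^-homo-* x (suc (suc q-2)) _ ⟩
      x ^ suc (suc q-2) * x ^ (r ℕ.+ m ℕ.* suc q-2) ≈⟨ *-congʳ (trans (reflexive (≡.sym (^q x))) Fx) ⟩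
      x ^ suc (r ℕ.+ m ℕ.* suc q-2)                 ≈⟨ lemma m ⟩
      x ^ suc r                                     ∎
      where
      rearrange : ∀ a b → suc (r ℕ.+ (a ℕ.+ b)) ≡ suc a ℕ.+ (r ℕ.+ b)
      rearrange a b = ≡.cong suc (≡.trans (≡.sym (ℕ.+-assoc r a b))
        (≡.trans (≡.cong (ℕ._+ b) (ℕ.+-comm r a)) (ℕ.+-assoc a r b)))

  δ : ℕ → ℕ → Carrier
  δ r s with reduce s ℕ.≟ r
  ... | yes _ = 1#
  ... | no  _ = 0#

  PF-δ : ∀ r s → PF (δ r s)
  PF-δ r s with reduce s ℕ.≟ r
  ... | yes _ = PF-1
  ... | no  _ = PF-0

  δ-≡ : ∀ {r s} → reduce s ≡ r → δ r s ≡ 1#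
  δ-≡ {r} {s} e with reduce s ℕ.≟ r
  ... | yes _ = ≡.refl
  ... | no ¬e = contradiction e ¬e

  W : ℕ → Weights
  W r = proj₁ (interpolation r)

  𝔽-W : ∀ r → All (𝔽 ∘ proj₂) (W r)
  𝔽-W r = proj₁ (proj₂ (interpolation r))

  interpolate : ∀ r P → length P ≤ q → weightedSum (W r) (P ⟨_⟩) ≈ coeff P r
  interpolate r = proj₂ (proj₂ (interpolation r))

  weightedSum-^ : ∀ r s → weightedSum (W r) (_^ s) ≈ δ r s
  weightedSum-^ r s = begin
    weightedSum (W r) (_^ s)
      ≈⟨ weightedSum-cong (W r) (𝔽-W r) (λ {x} Fx → trans (reduce-^ Fx s) (sym (trans (monomial-⟨⟩ (reduce s) 1# x) (*-identityʳ _)))) ⟩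
    weightedSum (W r) (monomial (reduce s) 1# ⟨_⟩)
      ≈⟨ interpolate r (monomial (reduce s) 1#) (ℕ.≤-trans (ℕ.≤-reflexive (length-monomial (reduce s) 1#)) (reduce-< s)) ⟩
    coeff (monomial (reduce s) 1#) r ≈⟨ lemma ⟩
    δ r s ∎
    where
    open ≈
    lemma : coeff (monomial (reduce s) 1#) r ≈ δ r s
    lemma with reduce s ℕ.≟ r
    ... | yes ≡.refl = coeff-monomial (reduce s) 1#
    ... | no s≢r     = coeff-monomial-≢ (reduce s) 1# (s≢r ∘ ≡.sym)

  -- As a polynomial in y, the coefficient of x ^ r in the reduced form of x ^ s f(x y): the terms
  -- of f whose degree j satisfies `reduce (s + j) ≡ r`.
  select : ℕ → ℕ → Poly → Poly
  select r s []      = []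
  select r s (a ∷ f) = a * δ r s ∷ select r (suc s) f

  weightedSum-select : ∀ r s f y → weightedSum (W r) (λ x → x ^ s * f ⟨ x * y ⟩) ≈ select r s f ⟨ y ⟩
  weightedSum-select r s [] y = begin
    weightedSum (W r) (λ x → x ^ s * 0#) ≈⟨ weightedSum-cong (W r) (𝔽-W r) (λ _ → *-comm _ _) ⟩
    weightedSum (W r) (λ x → 0# * x ^ s) ≈⟨ weightedSum-* (W r) 0# (_^ s) ⟩
    0# * weightedSum (W r) (_^ s)        ≈⟨ zeroˡ _ ⟩
    0#                                   ∎
    where open ≈
  weightedSum-select r s (a ∷ f) y = begin
    weightedSum (W r) (λ x → x ^ s * (a + x * y * f ⟨ x * y ⟩))
      ≈⟨ weightedSum-cong (W r) (𝔽-W r) (λ {x} _ → solve 5 (λ w a x y u → w :* (a :+ x :* y :* u) := a :* w :+ y :* (x :* w :* u))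
           refl (x ^ s) a x y (f ⟨ x * y ⟩)) ⟩
    weightedSum (W r) (λ x → a * x ^ s + y * (x ^ suc s * f ⟨ x * y ⟩))
      ≈⟨ weightedSum-+ (W r) _ _ ⟩
    weightedSum (W r) (λ x → a * x ^ s) + weightedSum (W r) (λ x → y * (x ^ suc s * f ⟨ x * y ⟩))
      ≈⟨ +-cong (weightedSum-* (W r) a (_^ s)) (weightedSum-* (W r) y _) ⟩
    a * weightedSum (W r) (_^ s) + y * weightedSum (W r) (λ x → x ^ suc s * f ⟨ x * y ⟩)
      ≈⟨ +-cong (*-congˡ (weightedSum-^ r s)) (*-congˡ (weightedSum-select r (suc s) f y)) ⟩
    a * δ r s + y * select r (suc s) f ⟨ y ⟩ ∎
    where open ≈

  PF-* : ∀ {x y} → PF x → PF y → PF (x * y)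
  PF-* (m , x≈) (n , y≈) = m ℕ.* n , trans (*-cong x≈ y≈) (sym (×1-homo-* m n))

  PF-select : ∀ r s {f} → All PF f → All PF (select r s f)
  PF-select r s []       = []
  PF-select r s (a ∷ Pf) = PF-* a (PF-δ r s) ∷ PF-select r (suc s) Pf

  select≈0 : ∀ r s f → All (_≈ 0#) (select r s f) → ∀ j → reduce (s ℕ.+ j) ≡ r → coeff f j ≈ 0#
  select≈0 r s []      _        j       _ = refl
  select≈0 r s (a ∷ f) (e ∷ es) zero    eq = trans (sym (*-identityʳ a)) (trans
    (*-congˡ (reflexive (≡.sym (δ-≡ (≡.trans (≡.cong reduce (≡.sym (ℕ.+-identityʳ s))) eq))))) e)
  select≈0 r s (a ∷ f) (e ∷ es) (suc j) eq = select≈0 r (suc s) f es j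
    (≡.trans (≡.cong reduce (≡.sym (ℕ.+-suc s j))) eq)

  -- The coefficient of λʳ in the reduced form of λ ↦ (1 + λt)ᴹ is the part of
  -- the binomial expansion with exponents reducing to r, and t is transcendental.
  binomial≈0 : ∀ r M → weightedSum (W r) (λ x → (1# + x * t) ^ M) ≈ 0# →
               ∀ j → reduce j ≡ r → coeff (binomial M) j ≈ 0#
  binomial≈0 r M e = select≈0 r 0 (binomial M)
    (t-transcendental (select r 0 (binomial M)) (PF-select r 0 (PF-binomial M)) (begin
      select r 0 (binomial M) ⟨ t ⟩ ≈⟨ weightedSum-select r 0 (binomial M) t ⟨
      weightedSum (W r) (λ x → 1# * binomial M ⟨ x * t ⟩)
        ≈⟨ weightedSum-cong (W r) (𝔽-W r) (λ {x} _ → trans (*-identityˡ _) (binomial-⟨⟩ M (x * t))) ⟩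
      weightedSum (W r) (λ x → (1# + x * t) ^ M) ≈⟨ e ⟩
      0# ∎))
    where open ≈

  -- Since (1 + X) ^ q = 1 + X ^ q, adding q to M adds a copy of the coefficients shifted by q. This
  -- Pascal rule in steps of q drives Lucas' theorem.
  binomial-+q : ∀ M r → coeff (binomial (q ℕ.+ M)) r ≈ coeff (binomial M +ₚ shift q (binomial M)) r
  binomial-+q M = coeff-unique (binomial (q ℕ.+ M)) (binomial M +ₚ shift q (binomial M)) λ x → begin
    binomial (q ℕ.+ M) ⟨ x ⟩                    ≈⟨ binomial-⟨⟩ (q ℕ.+ M) x ⟩
    (1# + x) ^ (q ℕ.+ M)                        ≈⟨ ^-homo-* (1# + x) q M ⟩
    (1# + x) ^ q * (1# + x) ^ M                 ≈⟨ *-congʳ (trans (additive-q 1# x) (+-congʳ 𝔽-1)) ⟩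
    (1# + x ^ q) * (1# + x) ^ M                 ≈⟨ trans (distribʳ _ _ _) (+-congʳ (*-identityˡ _)) ⟩
    (1# + x) ^ M + x ^ q * (1# + x) ^ M         ≈⟨ +-cong (binomial-⟨⟩ M x) (*-congˡ (binomial-⟨⟩ M x)) ⟨
    binomial M ⟨ x ⟩ + x ^ q * binomial M ⟨ x ⟩ ≈⟨ +-congˡ (shift-⟨⟩ q (binomial M) x) ⟨
    binomial M ⟨ x ⟩ + shift q (binomial M) ⟨ x ⟩ ≈⟨ +ₚ-⟨⟩ (binomial M) _ x ⟨
    (binomial M +ₚ shift q (binomial M)) ⟨ x ⟩  ∎
    where open ≈

  binomial-+q-< : ∀ M {r} → r < q → coeff (binomial (q ℕ.+ M)) r ≈ coeff (binomial M) r
  binomial-+q-< M {r} r<q = trans (binomial-+q M r) (trans (coeff-+ₚ (binomial M) _ r)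
    (trans (+-congˡ (coeff-shift-< (binomial M) r<q)) (+-identityʳ _)))

  binomial-+q-+ : ∀ M r → coeff (binomial (q ℕ.+ M)) (q ℕ.+ r) ≈ coeff (binomial M) (q ℕ.+ r) + coeff (binomial M) r
  binomial-+q-+ M r = trans (binomial-+q M (q ℕ.+ r)) (trans (coeff-+ₚ (binomial M) _ (q ℕ.+ r))
    (+-congˡ (reflexive (coeff-shift-+ q (binomial M) r))))

  -- Lowest digit 0 of the upper index: induction on M by the Pascal rule in steps of q. The factor
  -- `coeff (binomial 0) e` is the indicator of e = 0.
  lucas-0 : ∀ M {e} j → e < q → coeff (binomial (q ℕ.* M)) (e ℕ.+ q ℕ.* j) ≈ coeff (binomial 0) e * coeff (binomial M) j
  lucas-0 zero {e} j e<q = trans (reflexive (≡.cong (λ M → coeff (binomial M) (e ℕ.+ q ℕ.* j)) (ℕ.*-zeroʳ q))) (lemma e j)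
    where
    open ≈
    lemma : ∀ e j → coeff (binomial 0) (e ℕ.+ q ℕ.* j) ≈ coeff (binomial 0) e * coeff (binomial 0) j
    lemma (suc e) j       = sym (zeroˡ _)
    lemma zero    zero    = trans (reflexive (≡.cong (coeff (binomial 0)) (ℕ.*-zeroʳ q))) (sym (*-identityˡ 1#))
    lemma zero    (suc j) = trans (reflexive (≡.cong (λ q → coeff (binomial 0) (q ℕ.* suc j)) q≡2+[q-2])) (sym (*-identityˡ 0#))
  lucas-0 (suc M) {e} zero e<q = begin
    coeff (binomial (q ℕ.* suc M)) (e ℕ.+ q ℕ.* 0)
      ≡⟨ ≡.cong₂ (λ M r → coeff (binomial M) r) (ℕ.*-suc q M) (≡.trans (≡.cong (e ℕ.+_) (ℕ.*-zeroʳ q)) (ℕ.+-identityʳ e)) ⟩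
    coeff (binomial (q ℕ.+ q ℕ.* M)) e ≈⟨ binomial-+q-< (q ℕ.* M) e<q ⟩
    coeff (binomial (q ℕ.* M)) e
      ≡⟨ ≡.cong (coeff (binomial (q ℕ.* M))) (≡.trans (≡.cong (e ℕ.+_) (ℕ.*-zeroʳ q)) (ℕ.+-identityʳ e)) ⟨
    coeff (binomial (q ℕ.* M)) (e ℕ.+ q ℕ.* 0) ≈⟨ lucas-0 M 0 e<q ⟩
    coeff (binomial 0) e * coeff (binomial M) 0 ≈⟨ *-congˡ (trans (binomial-0 M) (sym (binomial-0 (suc M)))) ⟩
    coeff (binomial 0) e * coeff (binomial (suc M)) 0 ∎
    where open ≈
  lucas-0 (suc M) {e} (suc j) e<q = begin
    coeff (binomial (q ℕ.* suc M)) (e ℕ.+ q ℕ.* suc j)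
      ≡⟨ ≡.cong₂ (λ M r → coeff (binomial M) r) (ℕ.*-suc q M) (≡.sym index) ⟩
    coeff (binomial (q ℕ.+ q ℕ.* M)) (q ℕ.+ (e ℕ.+ q ℕ.* j)) ≈⟨ binomial-+q-+ (q ℕ.* M) _ ⟩
    coeff (binomial (q ℕ.* M)) (q ℕ.+ (e ℕ.+ q ℕ.* j)) + coeff (binomial (q ℕ.* M)) (e ℕ.+ q ℕ.* j)
      ≈⟨ +-cong (trans (reflexive (≡.cong (coeff (binomial (q ℕ.* M))) index)) (lucas-0 M (suc j) e<q)) (lucas-0 M j e<q) ⟩
    coeff (binomial 0) e * coeff (binomial M) (suc j) + coeff (binomial 0) e * coeff (binomial M) j
      ≈⟨ distribˡ _ _ _ ⟨
    coeff (binomial 0) e * (coeff (binomial M) (suc j) + coeff (binomial M) j) ≈⟨ *-congˡ (binomial-suc M j) ⟨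
    coeff (binomial 0) e * coeff (binomial (suc M)) (suc j) ∎
    where
    open ≈
    index : q ℕ.+ (e ℕ.+ q ℕ.* j) ≡ e ℕ.+ q ℕ.* suc j
    index = ≡.trans (≡.sym (ℕ.+-assoc q e _)) (≡.trans (≡.cong (ℕ._+ q ℕ.* j) (ℕ.+-comm q e))
      (≡.trans (ℕ.+-assoc e q _) (≡.cong (e ℕ.+_) (≡.sym (ℕ.*-suc q j)))))

  lucas : ∀ d {e} M j → d < q → e < q →
          coeff (binomial (d ℕ.+ q ℕ.* M)) (e ℕ.+ q ℕ.* j) ≈ coeff (binomial d) e * coeff (binomial M) j
  lucas zero    M j       d<q e<q = lucas-0 M j e<q
  lucas (suc d) {suc e} M j d<q e<q = begin
    coeff (binomial (suc (d ℕ.+ q ℕ.* M))) (suc (e ℕ.+ q ℕ.* j)) ≈⟨ binomial-suc (d ℕ.+ q ℕ.* M) _ ⟩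
    coeff (binomial (d ℕ.+ q ℕ.* M)) (suc e ℕ.+ q ℕ.* j) + coeff (binomial (d ℕ.+ q ℕ.* M)) (e ℕ.+ q ℕ.* j)
      ≈⟨ +-cong (lucas d M j (ℕ.<⇒≤ d<q) e<q) (lucas d M j (ℕ.<⇒≤ d<q) (ℕ.<⇒≤ e<q)) ⟩
    coeff (binomial d) (suc e) * coeff (binomial M) j + coeff (binomial d) e * coeff (binomial M) j
      ≈⟨ distribʳ _ _ _ ⟨
    (coeff (binomial d) (suc e) + coeff (binomial d) e) * coeff (binomial M) j ≈⟨ *-congʳ (binomial-suc d e) ⟨
    coeff (binomial (suc d)) (suc e) * coeff (binomial M) j ∎
    where open ≈
  lucas (suc d) {zero} M zero d<q e<q = begin
    coeff (binomial (suc (d ℕ.+ q ℕ.* M))) (q ℕ.* 0)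
      ≡⟨ ≡.cong (coeff (binomial (suc (d ℕ.+ q ℕ.* M)))) (ℕ.*-zeroʳ q) ⟩
    coeff (binomial (suc (d ℕ.+ q ℕ.* M))) 0 ≈⟨ binomial-0 (suc (d ℕ.+ q ℕ.* M)) ⟩
    1#                                       ≈⟨ *-identityˡ 1# ⟨
    1# * 1#                                  ≈⟨ *-cong (binomial-0 (suc d)) (binomial-0 M) ⟨
    coeff (binomial (suc d)) 0 * coeff (binomial M) 0 ∎
    where open ≈
  -- Here Pascal's rule borrows: the neighbour q (j + 1) - 1 has lowest digit q - 1, and its term
  -- vanishes because d < q - 1.
  lucas (suc d) {zero} M (suc j) d<q e<q = begin
    coeff (binomial (suc N)) (q ℕ.* suc j)                        ≡⟨ ≡.cong (coeff (binomial (suc N))) index ⟩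
    coeff (binomial (suc N)) (suc (suc q-2 ℕ.+ q ℕ.* j))          ≈⟨ binomial-suc N _ ⟩
    coeff (binomial N) (suc (suc q-2 ℕ.+ q ℕ.* j)) + coeff (binomial N) (suc q-2 ℕ.+ q ℕ.* j)
      ≈⟨ +-cong (trans (reflexive (≡.cong (coeff (binomial N)) (≡.sym index))) (lucas d M (suc j) (ℕ.<⇒≤ d<q) e<q))
                (lucas d M j (ℕ.<⇒≤ d<q) (ℕ.≤-reflexive (≡.sym q≡2+[q-2]))) ⟩
    coeff (binomial d) 0 * coeff (binomial M) (suc j) + coeff (binomial d) (suc q-2) * coeff (binomial M) j
      ≈⟨ +-cong (*-congʳ (trans (binomial-0 d) (sym (binomial-0 (suc d)))))
                (trans (*-congʳ (binomial-> (ℕ.≤-pred (≡.subst (suc d <_) q≡2+[q-2] d<q)))) (zeroˡ _)) ⟩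
    coeff (binomial (suc d)) 0 * coeff (binomial M) (suc j) + 0#  ≈⟨ +-identityʳ _ ⟩
    coeff (binomial (suc d)) 0 * coeff (binomial M) (suc j)       ∎
    where
    open ≈
    N = d ℕ.+ q ℕ.* M
    index : q ℕ.* suc j ≡ suc (suc q-2 ℕ.+ q ℕ.* j)
    index = ≡.trans (ℕ.*-suc q j) (≡.cong (ℕ._+ q ℕ.* j) q≡2+[q-2])

  -- From low degree to small digit sum

  ∑q^ : List ℕ → ℕ
  ∑q^ ns = sum (map (q ℕ.^_) ns)

  ∑q^-digit : ∀ d ns → ∑q^ (replicate d 0 ++ map suc ns) ≡ d ℕ.+ q ℕ.* ∑q^ ns
  ∑q^-digit (suc d) ns       = ≡.cong suc (∑q^-digit d ns)
  ∑q^-digit zero    []       = ≡.sym (ℕ.*-zeroʳ q)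
  ∑q^-digit zero    (n ∷ ns) = ≡.trans (≡.cong (q ℕ.^ suc n ℕ.+_) (∑q^-digit zero ns))
    (≡.sym (ℕ.*-distribˡ-+ q (q ℕ.^ n) (∑q^ ns)))

  module _ (A : ℕ) (2A<q : A ℕ.+ A < q) where

    -- The function λ ↦ λˢ (1 + λt)ᴹ has reduced degree at most A.
    Low : ℕ → ℕ → Set _
    Low s M = ∀ j → A < reduce (s ℕ.+ j) → coeff (binomial M) j ≈ 0#

    -- Restriction to the indices q j: by Lucas the lowest digit contributes C(d, 0) = 1, and the
    -- factor q does not change reduced exponents.
    low-0 : ∀ {d s} M → d < q → Low s (d ℕ.+ q ℕ.* M) → Low s M
    low-0 {d} {s} M d<q low j A< = begin
      coeff (binomial M) j                       ≈⟨ *-identityˡ _ ⟨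
      1# * coeff (binomial M) j                  ≈⟨ *-congʳ (binomial-0 d) ⟨
      coeff (binomial d) 0 * coeff (binomial M) j ≈⟨ lucas d M j d<q (ℕ.≤-trans (s≤s z≤n) 2≤q) ⟨
      coeff (binomial (d ℕ.+ q ℕ.* M)) (q ℕ.* j) ≈⟨ low (q ℕ.* j) (≡.subst (A <_) (≡.sym (reduce-q* s j)) A<) ⟩
      0#                                         ∎
      where open ≈

    -- Restriction to the indices d + q j: by Lucas the lowest digit contributes C(d, d) = 1, and d
    -- moves into the shift.
    low-digit : ∀ {d s} M → d < q → Low s (d ℕ.+ q ℕ.* M) → Low (s ℕ.+ d) M
    low-digit {d} {s} M d<q low j A< = begin
      coeff (binomial M) j                               ≈⟨ *-identityˡ _ ⟨
      1# * coeff (binomial M) j                          ≈⟨ *-congʳ (binomial-diagonal d) ⟨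
      coeff (binomial d) d * coeff (binomial M) j        ≈⟨ lucas d M j d<q d<q ⟨
      coeff (binomial (d ℕ.+ q ℕ.* M)) (d ℕ.+ q ℕ.* j)
        ≈⟨ low (d ℕ.+ q ℕ.* j) (≡.subst (A <_) (≡.trans (≡.sym (reduce-q* (s ℕ.+ d) j)) (≡.cong reduce (ℕ.+-assoc s d _))) A<) ⟩
      0#                                                 ∎
      where open ≈

    M≡ : ∀ M → M ≡ M % q ℕ.+ q ℕ.* (M / q)
    M≡ M = ≡.trans (m≡m%n+[m/n]*n M q) (≡.cong (M % q ℕ.+_) (ℕ.*-comm (M / q) q))

    M/q< : ∀ M .{{_ : ℕ.NonZero M}} → M / q < M
    M/q< M = m/n<m M q 2≤q

    -- Digits are stripped off until M = 0, where the coefficient at j = 0 is 1 and so cannot be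
    -- required to vanish.
    low⇒reduce≤ : ∀ M {s} → Low s M → reduce s ≤ A
    low⇒reduce≤ = <-rec _ λ where
      zero        _   {s} low → ℕ.≮⇒≥ λ A< → 1≉0 (low 0 (≡.subst (λ s → A < reduce s) (≡.sym (ℕ.+-identityʳ s)) A<))
      M@(suc _)   rec {s} low → rec (M/q< M) {s}
        (low-0 {M % q} (M / q) (m%n<n M q) (≡.subst (Low s) (M≡ M) low))

    low⇒≤ : ∀ {s M} → s < q → Low s M → s ≤ A
    low⇒≤ {s} {M} s<q low = ≡.subst (_≤ A) (reduce-id s<q) (low⇒reduce≤ M low)

    -- s is the sum of the digits already read. `Low 0` alone bounds the next digit d by A; then s +
    -- d ≤ 2 A < q is its own reduction, and `Low s` improves the bound to s + d ≤ A.
    digits : ∀ M {s} → s ≤ A → Low 0 M → Low s M → ∃[ ns ] s ℕ.+ length ns ≤ A × M ≡ ∑q^ ns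
    digits = <-rec _ λ where
      zero      _   {s} s≤A low₀ low → [] , ≡.subst (_≤ A) (≡.sym (ℕ.+-identityʳ s)) s≤A , ≡.refl
      M@(suc _) rec {s} s≤A low₀ low →
        let d      = M % q
            M′     = M / q
            d<q    = m%n<n M q
            low₀′  = ≡.subst (Low 0) (M≡ M) low₀
            low′   = ≡.subst (Low s) (M≡ M) low
            d≤A    = low⇒≤ {d} {M′} d<q (low-digit M′ d<q low₀′)
            s+d≤A  = low⇒≤ {s ℕ.+ d} {M′} (ℕ.≤-<-trans (ℕ.+-mono-≤ s≤A d≤A) 2A<q) (low-digit M′ d<q low′)
            ns , bound , M′≡ = rec (M/q< M) {s ℕ.+ d} s+d≤A (low-0 {d} M′ d<q low₀′) (low-digit M′ d<q low′)
        in replicate d 0 ++ map suc ns ,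
           ≡.subst (_≤ A) (≡.sym (≡.trans (≡.cong (s ℕ.+_) (≡.trans (List.length-++ (replicate d 0))
             (≡.cong₂ ℕ._+_ (List.length-replicate d) (List.length-map suc ns)))) (≡.sym (ℕ.+-assoc s d _)))) bound ,
           ≡.trans (M≡ M) (≡.trans (≡.cong (λ M → d ℕ.+ q ℕ.* M) M′≡) (≡.sym (∑q^-digit d ns)))

    lowDegree⇒∑q^ : ∀ M → (∀ r → A < r → r < q → weightedSum (W r) (λ x → (1# + x * t) ^ M) ≈ 0#) →
                    ∃[ ns ] length ns ≤ A × M ≡ ∑q^ ns
    lowDegree⇒∑q^ M vanish = digits M {0} z≤n low low
      where
      low : Low 0 M
      low j A< = binomial≈0 (reduce j) M (vanish (reduce j) A< (reduce-< j)) j ≡.refl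

-- Elimination

-- N = ∑ⱼ aⱼ q ^ nⱼ with all nⱼ in S. Besides `U`, S is the set of entries of a list, since a norm
-- can only choose exponents occurring in M.
Represents : Pred ℕ 0ℓ → ℕ → List ℕ → ℕ → Set
Represents S q []       N = N ≡ 0
Represents S q (a ∷ as) N = ∃[ n ] ∃[ N′ ] S n × N ≡ a ℕ.* q ℕ.^ n ℕ.+ N′ × Represents S q as N′

represents-map : ∀ {S S′ : Pred ℕ 0ℓ} {q} → (∀ {n} → S n → S′ n) →
                 ∀ as {N} → Represents S q as N → Represents S′ q as N
represents-map S⇒S′ []       e                      = e
represents-map S⇒S′ (a ∷ as) (n , N′ , Sn , e , rep) = n , N′ , S⇒S′ Sn , e , represents-map S⇒S′ as rep

module Evaluation {c ℓ₁ ℓ₂ : Level} {p : ℕ} (p-prime : Prime p)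
  (𝕂 : AlgebraicClosureOf𝔽⟨t⟩ p c ℓ₁ ℓ₂) where

  open FiniteSubfield p-prime 𝕂
  open Semantics heytingField _#?_

  power : ∀ {b} {V : Set b} → Expr Carrier V → ℕ → Expr Carrier V
  power e zero    = scalar 1#
  power e (suc n) = e ⊗ power e n

  ⟦power⟧ : ∀ {b} {V : Set b} (e : Expr Carrier V) n ρ → ⟦ power e n ⟧ ρ ≈ ⟦ e ⟧ ρ ^ n
  ⟦power⟧ e zero    ρ = refl
  ⟦power⟧ e (suc n) ρ = *-congˡ (⟦power⟧ e n ρ)

  module _ {b} {V : Set b} where

    horner : List (Expr Carrier V) → (V → Carrier) → Carrier → Carrier
    horner hs ρ x = map (λ h → ⟦ h ⟧ ρ) hs ⟨ x ⟩

    add : List (Expr Carrier V) → List (Expr Carrier V) → List (Expr Carrier V)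
    add []       gs       = gs
    add (f ∷ fs) []       = f ∷ fs
    add (f ∷ fs) (g ∷ gs) = f ⊕ g ∷ add fs gs

    mul : List (Expr Carrier V) → List (Expr Carrier V) → List (Expr Carrier V)
    mul []       gs = []
    mul (f ∷ fs) gs = add (map (f ⊗_) gs) (scalar 0# ∷ mul fs gs)

    -- The expression as a polynomial in `nothing`, the variable that a norm will eliminate.
    coefficients : Expr Carrier (Maybe V) → List (Expr Carrier V)
    coefficients (scalar a)     = scalar a ∷ []
    coefficients (var nothing)  = scalar 0# ∷ scalar 1# ∷ []
    coefficients (var (just v)) = var v ∷ []
    coefficients (e ⊕ e′)       = add (coefficients e) (coefficients e′)
    coefficients (e ⊗ e′)       = mul (coefficients e) (coefficients e′)

    horner-add : ∀ fs gs ρ x → horner (add fs gs) ρ x ≈ horner fs ρ x + horner gs ρ x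
    horner-add []       gs       ρ x = sym (+-identityˡ _)
    horner-add (f ∷ fs) []       ρ x = sym (+-identityʳ _)
    horner-add (f ∷ fs) (g ∷ gs) ρ x = trans (+-congˡ (*-congˡ (horner-add fs gs ρ x)))
      (solve 5 (λ a b x u v → a :+ b :+ x :* (u :+ v) := a :+ x :* u :+ (b :+ x :* v)) refl _ _ x _ _)

    horner-scale : ∀ f gs ρ x → horner (map (f ⊗_) gs) ρ x ≈ ⟦ f ⟧ ρ * horner gs ρ x
    horner-scale f []       ρ x = sym (zeroʳ _)
    horner-scale f (g ∷ gs) ρ x = trans (+-congˡ (*-congˡ (horner-scale f gs ρ x)))
      (solve 4 (λ a b x u → a :* b :+ x :* (a :* u) := a :* (b :+ x :* u)) refl _ _ x _)

    horner-mul : ∀ fs gs ρ x → horner (mul fs gs) ρ x ≈ horner fs ρ x * horner gs ρ x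
    horner-mul []       gs ρ x = sym (zeroˡ _)
    horner-mul (f ∷ fs) gs ρ x = trans (horner-add (map (f ⊗_) gs) _ ρ x)
      (trans (+-cong (horner-scale f gs ρ x) (+-congˡ (*-congˡ (horner-mul fs gs ρ x))))
        (solve 4 (λ a g x u → a :* g :+ (con 0 :+ x :* (u :* g)) := (a :+ x :* u) :* g) refl _ _ x _))

    horner-coefficients : ∀ e ρ x → horner (coefficients e) ρ x ≈ ⟦ e ⟧ (maybe′ ρ x)
    horner-coefficients (scalar a)     ρ x = trans (+-congˡ (zeroʳ x)) (+-identityʳ a)
    horner-coefficients (var nothing)  ρ x = solve 1 (λ x → con 0 :+ x :* (con 1 :+ x :* con 0) := x) refl x
    horner-coefficients (var (just v)) ρ x = trans (+-congˡ (zeroʳ x)) (+-identityʳ _)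
    horner-coefficients (e ⊕ e′)       ρ x = trans (horner-add (coefficients e) (coefficients e′) ρ x)
      (+-cong (horner-coefficients e ρ x) (horner-coefficients e′ ρ x))
    horner-coefficients (e ⊗ e′)       ρ x = trans (horner-mul (coefficients e) (coefficients e′) ρ x)
      (*-cong (horner-coefficients e ρ x) (horner-coefficients e′ ρ x))

  ∏-cong : ∀ {u v : Carrier → Carrier} ys → (∀ y → u y ≈ v y) → ∏ u ys ≈ ∏ v ys
  ∏-cong []       u≈v = refl
  ∏-cong (y ∷ ys) u≈v = *-cong (u≈v y) (∏-cong ys u≈v)

  ∏≈0⇒Any : ∀ (u : Carrier → Carrier) ys → ∏ u ys ≈ 0# → Any (λ y → u y ≈ 0#) ys
  ∏≈0⇒Any u []       e = contradiction e 1≉0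
  ∏≈0⇒Any u (y ∷ ys) e with *-≈0 e
  ... | inj₁ uy≈0 = here uy≈0
  ... | inj₂ ∏≈0  = there (∏≈0⇒Any u ys ∏≈0)

  Any⇒∏≈0 : ∀ (u : Carrier → Carrier) {ys} → Any (λ y → u y ≈ 0#) ys → ∏ u ys ≈ 0#
  Any⇒∏≈0 u (here e)  = trans (*-congʳ e) (zeroˡ _)
  Any⇒∏≈0 u (there a) = trans (*-congˡ (Any⇒∏≈0 u a)) (zeroʳ _)

  module Norm (k : ℕ) where

    open GaloisField k
    open DigitSum p-prime 𝕂 k

    𝔽Poly : Set (c ⊔ ℓ₁)
    𝔽Poly = Σ Poly (All 𝔽)

    𝔽-+ₚ : ∀ {f g} → All 𝔽 f → All 𝔽 g → All 𝔽 (f +ₚ g)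
    𝔽-+ₚ []        Fg        = Fg
    𝔽-+ₚ (Fa ∷ Ff) []        = Fa ∷ Ff
    𝔽-+ₚ (Fa ∷ Ff) (Fb ∷ Fg) = 𝔽-+ Fa Fb ∷ 𝔽-+ₚ Ff Fg

    X : 𝔽Poly
    X = 0# ∷ 1# ∷ [] , 𝔽-0 ∷ 𝔽-1 ∷ []

    X-⟨⟩ : ∀ y → proj₁ X ⟨ y ⟩ ≈ y
    X-⟨⟩ y = solve 1 (λ x → con 0 :+ x :* (con 1 :+ x :* con 0) := x) refl y

    1+_X : ∀ {x} → 𝔽 x → 𝔽Poly
    1+_X {x} Fx = 1# ∷ x ∷ [] , 𝔽-1 ∷ Fx ∷ []

    addMonomial : 𝔽Poly → ℕ → ∀ {x} → 𝔽 x → 𝔽Poly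
    addMonomial (f , Ff) s {x} Fx = f +ₚ monomial s x , 𝔽-+ₚ Ff (All-monomial s 𝔽-0 Fx)

    module _ {b} {V : Set b} where

      -- `weightedSum` as syntax. The summand receives the membership proof because atoms are
      -- polynomials certified to have coefficients in 𝔽.
      weighted : (W : Weights) → All (𝔽 ∘ proj₂) W → (∀ {x} → 𝔽 x → Expr Carrier V) → Expr Carrier V
      weighted []            []        u = scalar 0#
      weighted ((w , x) ∷ W) (Fx ∷ FW) u = scalar w ⊗ u Fx ⊕ weighted W FW u

      ⟦weighted⟧ : ∀ W FW {u : ∀ {x} → 𝔽 x → Expr Carrier V} {ρ} {v : Carrier → Carrier} →
                   (∀ {x} (Fx : 𝔽 x) → ⟦ u Fx ⟧ ρ ≈ v x) → ⟦ weighted W FW u ⟧ ρ ≈ weightedSum W v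
      ⟦weighted⟧ []            []        eq = refl
      ⟦weighted⟧ ((w , x) ∷ W) (Fx ∷ FW) eq = +-cong (*-congˡ (eq Fx)) (⟦weighted⟧ W FW eq)

      upTo : (ℕ → Expr Carrier V) → Expr Carrier V → ℕ → Expr Carrier V
      upTo a h zero    = scalar 0#
      upTo a h (suc n) = a 0 ⊕ h ⊗ upTo (a ∘ suc) h n

      ⟦upTo⟧ : ∀ P {n a h} {ρ : V → Carrier} → length P ≤ n → (∀ r → ⟦ a r ⟧ ρ ≈ coeff P r) →
               ⟦ upTo a h n ⟧ ρ ≈ P ⟨ ⟦ h ⟧ ρ ⟩
      ⟦upTo⟧ []      {zero}  _         a≈ = refl
      ⟦upTo⟧ []      {suc n} {h = h} {ρ} _ a≈ =
        trans (+-cong (a≈ 0) (*-congˡ (⟦upTo⟧ [] {n} {h = h} z≤n (a≈ ∘ suc)))) (trans (+-identityˡ _) (zeroʳ _))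
      ⟦upTo⟧ (_ ∷ P) {suc n} {h = h} (s≤s P≤n) a≈ =
        +-cong (a≈ 0) (*-congˡ (⟦upTo⟧ P {n} {h = h} P≤n (a≈ ∘ suc)))

      -- From expressions for the values on 𝔽 of a polynomial function of degree less than q, an
      -- expression for its value at an arbitrary h. The polynomial itself does not occur in it.
      interpolated : (∀ {x} → 𝔽 x → Expr Carrier V) → Expr Carrier V → Expr Carrier V
      interpolated u h = upTo (λ r → weighted (W r) (𝔽-W r) u) h q

      ⟦interpolated⟧ : ∀ {u : ∀ {x} → 𝔽 x → Expr Carrier V} {h ρ F} → IsPoly q F →
                       (∀ {x} (Fx : 𝔽 x) → ⟦ u Fx ⟧ ρ ≈ F x) → ⟦ interpolated u h ⟧ ρ ≈ F (⟦ h ⟧ ρ)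
      ⟦interpolated⟧ {h = h} {ρ} (P , P≤q , P≈F) eq = trans (⟦upTo⟧ P {h = h} {ρ} P≤q (λ r → trans
        (⟦weighted⟧ (W r) (𝔽-W r) (λ {x} Fx → trans (eq Fx) (sym (P≈F x)))) (interpolate r P P≤q))) (P≈F _)

      module _ (atom : 𝔽Poly → V) where

        -- The product over y in ys of f(y) + yˢ (h₀ + h₁ y + …) is a polynomial of
        -- degree less than q in each hᵢ. Interpolating in the hᵢ one after the other
        -- leaves only products of values of polynomials over 𝔽.
        normPoly : 𝔽Poly → ℕ → List (Expr Carrier V) → Expr Carrier V
        normPoly f s []       = var (atom f)
        normPoly f s (h ∷ hs) = interpolated (λ Fx → normPoly (addMonomial f s Fx) (suc s) hs) h

        norm : Expr Carrier (Maybe V) → Expr Carrier V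
        norm e = normPoly ([] , []) 0 (coefficients e)

        module _ {ρ : V → Carrier} {ys : List Carrier} (ys<q : length ys < q)
          (ρ-atom : ∀ f → ρ (atom f) ≈ ∏ (proj₁ f ⟨_⟩) ys) where

          -- In h alone the product has one affine factor for each y, hence at most `length ys` + 1
          -- ≤ q coefficients, as interpolation over 𝔽 requires.
          ⟦normPoly⟧ : ∀ f s hs → ⟦ normPoly f s hs ⟧ ρ ≈ ∏ (λ y → proj₁ f ⟨ y ⟩ + y ^ s * horner hs ρ y) ys
          ⟦normPoly⟧ f s []       = trans (ρ-atom f)
            (∏-cong ys λ y → sym (trans (+-congˡ (zeroʳ _)) (+-identityʳ _)))
          ⟦normPoly⟧ f s (h ∷ hs) = trans
            (⟦interpolated⟧ {h = h} (isPoly-≤ ys<q (isPoly-∏ (λ y → proj₁ f ⟨ y ⟩ + y ^ suc s * horner hs ρ y) (_^ s) ys))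
              λ {x} Fx → trans (⟦normPoly⟧ (addMonomial f s Fx) (suc s) hs) (∏-cong ys λ y → trans
                (+-congʳ (trans (+ₚ-⟨⟩ (proj₁ f) (monomial s x) y) (+-congˡ (monomial-⟨⟩ s x y))))
                (solve 4 (λ u w x v → u :+ w :* x :+ v := u :+ v :+ x :* w) refl _ _ x _)))
            (∏-cong ys λ y → solve 5 (λ u w h y r → u :+ y :* w :* r :+ h :* w := u :+ w :* (h :+ y :* r)) refl
              (proj₁ f ⟨ y ⟩) (y ^ s) (⟦ h ⟧ ρ) y (horner hs ρ y))

          ⟦norm⟧ : ∀ e → ⟦ norm e ⟧ ρ ≈ ∏ (λ y → ⟦ e ⟧ (maybe′ ρ y)) ys
          ⟦norm⟧ e = trans (⟦normPoly⟧ ([] , []) 0 (coefficients e)) (∏-cong ys λ y →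
            trans (+-identityˡ _) (trans (*-identityˡ _) (horner-coefficients e ρ y)))

    timesLast^ : ∀ {b} {V : Set b} → Expr Carrier V → ℕ → Expr Carrier (Maybe V)
    timesLast^ d a = rename just d ⊗ power (var nothing) a

    -- ∏ (tᴹ − d ∏ⱼ yⱼ ^ aⱼ) over all choices of the yⱼ.
    resolvent : ∀ {b} {V : Set b} → (𝔽Poly → V) → List ℕ → Expr Carrier V → Expr Carrier V
    resolvent atom []       d = var (atom X) ⊕ scalar (- 1#) ⊗ d
    resolvent atom (a ∷ as) d = norm atom (resolvent (just ∘ atom) as (timesLast^ d a))

    frobenii : List ℕ → List Carrier
    frobenii = map (λ n → t ^ (q ℕ.^ n))

    ⟦timesLast^⟧ : ∀ {b} {V : Set b} (ρ : V → Carrier) d {e} a n → ⟦ d ⟧ ρ ≈ t ^ e →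
                   ⟦ timesLast^ d a ⟧ (maybe′ ρ (t ^ (q ℕ.^ n))) ≈ t ^ (e ℕ.+ a ℕ.* q ℕ.^ n)
    ⟦timesLast^⟧ ρ d {e} a n d≈ = begin
      ⟦ rename just d ⟧ ρ′ * ⟦ power (var nothing) a ⟧ ρ′
        ≈⟨ *-cong (trans (reflexive (⟦⟧-rename just d ρ′)) d≈) (⟦power⟧ (var nothing) a ρ′) ⟩
      t ^ e * (t ^ (q ℕ.^ n)) ^ a      ≈⟨ *-congˡ (^-assocʳ t (q ℕ.^ n) a) ⟩
      t ^ e * t ^ (q ℕ.^ n ℕ.* a)      ≡⟨ ≡.cong (λ m → t ^ e * t ^ m) (ℕ.*-comm (q ℕ.^ n) a) ⟩
      t ^ e * t ^ (a ℕ.* q ℕ.^ n)      ≈⟨ ^-homo-* t e _ ⟨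
      t ^ (e ℕ.+ a ℕ.* q ℕ.^ n)        ∎
      where
      open ≈
      ρ′ = maybe′ ρ (t ^ (q ℕ.^ n))

    ∏-frobenii : ∀ ns ((f , _) : 𝔽Poly) → f ⟨ t ⟩ ^ ∑q^ ns ≈ ∏ (f ⟨_⟩) (frobenii ns)
    ∏-frobenii []       f          = refl
    ∏-frobenii (n ∷ ns) F@(f , Ff) = trans (^-homo-* (f ⟨ t ⟩) (q ℕ.^ n) (∑q^ ns))
      (*-cong (frobenius^ Ff t n) (∏-frobenii ns F))

    module _ (ns : List ℕ) (ns<q : length ns < q) where

      frobenii<q : length (frobenii ns) < q
      frobenii<q = ≡.subst (_< q) (≡.sym (List.length-map _ ns)) ns<q

      module _ {b} {V : Set b} (atom : 𝔽Poly → V) (ρ : V → Carrier)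
        (ρ-atom : ∀ f → ρ (atom f) ≈ ∏ (proj₁ f ⟨_⟩) (frobenii ns)) where

        ρ-X : ρ (atom X) ≈ t ^ ∑q^ ns
        ρ-X = trans (ρ-atom X) (trans (sym (∏-frobenii ns X)) (^-congˡ (∑q^ ns) (X-⟨⟩ t)))

        ⟦resolvent-∷⟧ : ∀ a as d → ⟦ resolvent atom (a ∷ as) d ⟧ ρ ≈
          ∏ (λ y → ⟦ resolvent (just ∘ atom) as (timesLast^ d a) ⟧ (maybe′ ρ y)) (frobenii ns)
        ⟦resolvent-∷⟧ a as d =
          ⟦norm⟧ atom {ρ} {frobenii ns} frobenii<q ρ-atom (resolvent (just ∘ atom) as (timesLast^ d a))

      -- A vanishing norm has a vanishing factor, which chooses the exponent n for the current a; e
      -- accumulates the chosen terms. At the end t ^ M = t ^ e, and powers of t are distinct.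
      resolvent-sound : ∀ {b} {V : Set b} (atom : 𝔽Poly → V) (ρ : V → Carrier) →
        (∀ f → ρ (atom f) ≈ ∏ (proj₁ f ⟨_⟩) (frobenii ns)) → ∀ as d {e} → ⟦ d ⟧ ρ ≈ t ^ e →
        ⟦ resolvent atom as d ⟧ ρ ≈ 0# → ∃[ N ] ∑q^ ns ≡ e ℕ.+ N × Represents U q as N
      resolvent-sound atom ρ ρ-atom [] d {e} d≈ H≈0 = 0 ,
        ≡.trans (t^-injective (trans (sym (ρ-X atom ρ ρ-atom))
          (trans (x-y≈0⇒x≈y _ _ (trans (+-congˡ (sym (-1*x≈-x _))) H≈0)) d≈)))
          (≡.sym (ℕ.+-identityʳ e)) , ≡.refl
      resolvent-sound atom ρ ρ-atom (a ∷ as) d {e} d≈ H≈0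
        with n , _ , Hn≈0 ← find (Any.map⁻ {xs = ns} (∏≈0⇒Any
               (λ y → ⟦ resolvent (just ∘ atom) as (timesLast^ d a) ⟧ (maybe′ ρ y)) (frobenii ns)
               (trans (sym (⟦resolvent-∷⟧ atom ρ ρ-atom a as d)) H≈0)))
        with N , eq , rep ← resolvent-sound (just ∘ atom) (maybe′ ρ (t ^ (q ℕ.^ n))) ρ-atom as
               (timesLast^ d a) {e ℕ.+ a ℕ.* q ℕ.^ n} (⟦timesLast^⟧ ρ d {e} a n d≈) Hn≈0
        = a ℕ.* q ℕ.^ n ℕ.+ N , ≡.trans eq (ℕ.+-assoc e _ N) , n , N , _ , ≡.refl , rep

      resolvent-complete : ∀ {b} {V : Set b} (atom : 𝔽Poly → V) (ρ : V → Carrier) →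
        (∀ f → ρ (atom f) ≈ ∏ (proj₁ f ⟨_⟩) (frobenii ns)) → ∀ as d {e N} → ⟦ d ⟧ ρ ≈ t ^ e →
        ∑q^ ns ≡ e ℕ.+ N → Represents (_∈ˡ ns) q as N → ⟦ resolvent atom as d ⟧ ρ ≈ 0#
      resolvent-complete atom ρ ρ-atom [] d {e} d≈ eq ≡.refl = begin
        ρ (atom X) + - 1# * ⟦ d ⟧ ρ ≈⟨ +-cong (ρ-X atom ρ ρ-atom) (-1*x≈-x _) ⟩
        t ^ ∑q^ ns - ⟦ d ⟧ ρ        ≈⟨ +-cong (reflexive (≡.cong (t ^_) (≡.trans eq (ℕ.+-identityʳ e)))) (-‿cong d≈) ⟩
        t ^ e - t ^ e               ≈⟨ -‿inverseʳ _ ⟩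
        0#                          ∎
        where open ≈
      resolvent-complete atom ρ ρ-atom (a ∷ as) d {e} d≈ eq (n , N′ , n∈ns , ≡.refl , rep) = trans
        (⟦resolvent-∷⟧ atom ρ ρ-atom a as d)
        (Any⇒∏≈0 (λ y → ⟦ resolvent (just ∘ atom) as (timesLast^ d a) ⟧ (maybe′ ρ y)) (Any.map⁺ (lose n∈ns
          (resolvent-complete (just ∘ atom) (maybe′ ρ (t ^ (q ℕ.^ n))) ρ-atom as
            (timesLast^ d a) {e ℕ.+ a ℕ.* q ℕ.^ n} (⟦timesLast^⟧ ρ d {e} a n d≈)
            (≡.trans eq (≡.sym (ℕ.+-assoc e _ N′))) rep))))

    ∑q^-replicate : ∀ a n → ∑q^ (replicate a n) ≡ a ℕ.* q ℕ.^ n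
    ∑q^-replicate zero    n = ≡.refl
    ∑q^-replicate (suc a) n = ≡.cong (q ℕ.^ n ℕ.+_) (∑q^-replicate a n)

    ∑q^-++ : ∀ ns ns′ → ∑q^ (ns ++ ns′) ≡ ∑q^ ns ℕ.+ ∑q^ ns′
    ∑q^-++ ns ns′ = ≡.trans (≡.cong sum (List.map-++ (q ℕ.^_) ns ns′)) (sum-++ (map (q ℕ.^_) ns) _)

    -- Each nⱼ is listed aⱼ times; as aⱼ ≥ 1 it really occurs, so the norms can choose it.
    represents⇒∑q^ : ∀ as {N} → All (1 ≤_) as → Represents U q as N →
                     ∃[ ns ] length ns ≡ sum as × N ≡ ∑q^ ns × Represents (_∈ˡ ns) q as N
    represents⇒∑q^ []       []          e                           = [] , ≡.refl , e , e
    represents⇒∑q^ (a ∷ as) (1≤a ∷ 1≤as) (n , N′ , _ , ≡.refl , rep)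
      with ns , len , ≡.refl , rep′ ← represents⇒∑q^ as 1≤as rep =
      replicate a n ++ ns ,
      ≡.trans (List.length-++ (replicate a n)) (≡.cong₂ ℕ._+_ (List.length-replicate a) len) ,
      ≡.sym (≡.trans (∑q^-++ (replicate a n) ns) (≡.cong (ℕ._+ ∑q^ ns) (∑q^-replicate a n))) ,
      n , N′ , ∈-++⁺ˡ (n∈ 1≤a) , ≡.refl , represents-map (∈-++⁺ʳ (replicate a n)) as rep′
      where
      n∈ : ∀ {a} → 1 ≤ a → n ∈ˡ replicate a n
      n∈ (s≤s _) = here ≡.refl

    module _ (as : List ℕ) (2A<q : sum as ℕ.+ sum as < q) where

      A : ℕ
      A = sum as

      degreeEquation : ℕ → Expr Carrier 𝔽Poly
      degreeEquation r = weighted (W r) (𝔽-W r) (λ Fx → var (1+ Fx X))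

      -- The degree equations for A < r < q make M a sum of at most A powers of q, and only then
      -- does the resolvent evaluate to the intended product.
      equations : List (Expr Carrier 𝔽Poly)
      equations = resolvent (λ f → f) as (scalar 1#) ∷ applyUpTo (λ i → degreeEquation (suc A ℕ.+ i)) (q ℕ.∸ suc A)

      Vanishing : (𝔽Poly → Carrier) → Set _
      Vanishing ρ = All (λ e → ⟦ e ⟧ ρ ≈ 0#) equations

      module _ {M : ℕ} {ρ : 𝔽Poly → Carrier} (ρ≈ : ∀ f → ρ f ≈ proj₁ f ⟨ t ⟩ ^ M) where

        ⟦degreeEquation⟧ : ∀ r → ⟦ degreeEquation r ⟧ ρ ≈ weightedSum (W r) (λ x → (1# + x * t) ^ M)
        ⟦degreeEquation⟧ r = ⟦weighted⟧ (W r) (𝔽-W r) λ {x} Fx → trans (ρ≈ (1+ Fx X))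
          (^-congˡ M (solve 2 (λ x t → con 1 :+ t :* (x :+ t :* con 0) := con 1 :+ x :* t) refl x t))

        vanishing⇒represents : Vanishing ρ → Represents U q as M
        vanishing⇒represents (H≈0 ∷ degrees)
          with ns , ns≤A , ≡.refl ← lowDegree⇒∑q^ A 2A<q M (λ r A<r r<q → trans (sym (⟦degreeEquation⟧ r))
                 (≡.subst (λ r → ⟦ degreeEquation r ⟧ ρ ≈ 0#) (ℕ.m+[n∸m]≡n A<r)
                   (All.applyUpTo⁻ _ _ degrees (ℕ.∸-monoˡ-< r<q A<r))))
          with N , eq , rep ← resolvent-sound ns (ℕ.≤-<-trans (ℕ.≤-trans ns≤A (ℕ.m≤m+n A A)) 2A<q)
                 (λ f → f) ρ (λ f → trans (ρ≈ f) (∏-frobenii ns f)) as (scalar 1#) {0} refl H≈0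
          = ≡.subst (Represents U q as) (≡.sym eq) rep

        -- The degree equations hold because (1 + λt) ^ M = ∏ᵢ (1 + λ yᵢ) has A factors, hence
        -- degree at most A in λ.
        represents⇒vanishing : All (1 ≤_) as → Represents U q as M → Vanishing ρ
        represents⇒vanishing 1≤as rep with ns , len , ≡.refl , rep′ ← represents⇒∑q^ as 1≤as rep =
          resolvent-complete ns ns<q (λ f → f) ρ ρ-atom as (scalar 1#) {0} refl ≡.refl rep′ ∷
          All.applyUpTo⁺₁ _ (q ℕ.∸ suc A) λ {i} i< →
            let r = suc A ℕ.+ i in begin
            ⟦ degreeEquation r ⟧ ρ ≈⟨ ⟦weighted⟧ (W r) (𝔽-W r) (λ {x} Fx → trans (ρ-atom (1+ Fx X)) (trans
                 (∏-cong (frobenii ns) λ y → solve 2 (λ x t → con 1 :+ t :* (x :+ t :* con 0) := con 1 :+ x :* t) refl x y)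
                 (sym (P≈ x)))) ⟩
            weightedSum (W r) (P ⟨_⟩) ≈⟨ interpolate r P (ℕ.≤-trans P≤ (ℕ.≤-<-trans (ℕ.m≤m+n A A) 2A<q)) ⟩
            coeff P r                 ≈⟨ coeff-≥length P (ℕ.≤-trans P≤ (ℕ.m≤m+n (suc A) i)) ⟩
            0#                        ∎
          where
          open ≈
          ns<q : length ns < q
          ns<q = ℕ.≤-<-trans (ℕ.≤-trans (ℕ.≤-reflexive len) (ℕ.m≤m+n A A)) 2A<q
          ρ-atom : ∀ f → ρ f ≈ ∏ (proj₁ f ⟨_⟩) (frobenii ns)
          ρ-atom f = trans (ρ≈ f) (∏-frobenii ns f)
          poly = isPoly-∏ (λ _ → 1#) (λ y → y) (frobenii ns)
          P = proj₁ poly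
          P≈ = proj₂ (proj₂ poly)
          P≤ : length P ≤ suc A
          P≤ = ℕ.≤-trans (proj₁ (proj₂ poly)) (s≤s (ℕ.≤-reflexive (≡.trans (List.length-map _ ns) len)))

-- Orbits on tori

module Realization {c ℓ₁ ℓ₂ : Level} (K : HeytingField c ℓ₁ ℓ₂)
  (_#?_ : Decidable (HeytingField._#_ K)) where

  open DiscreteField K _#?_
  open Semantics K _#?_
  open SplitTorus K
  open Algebra.Properties.CommutativeMonoid.Sum *-commutativeMonoid
    using (sum-cong-≋; ∑-distrib-+; sum-replicate-zero) renaming (sum to ∏)

  -- The endomorphism x ↦ (factor i · x (next i))ᵢ, with a starting point.
  record System : Set (c ⊔ ℓ₁) where
    field
      size     : ℕ
      nonEmpty : 1 ≤ size
      next     : Fin size → Fin size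
      factor   : 𝔾ₘ^ size
      start    : 𝔾ₘ^ size

    orbit : ℕ → Fin size → Carrier
    orbit zero    i = proj₁ (start i)
    orbit (suc n) i = proj₁ (factor i) * orbit n (next i)

  open System

  _⊗ₛ_ : System → System → System
  S ⊗ₛ T = record
    { size     = size S ℕ.+ size T
    ; nonEmpty = ℕ.≤-trans (nonEmpty S) (ℕ.m≤m+n (size S) (size T))
    ; next     = [ (_↑ˡ size T) ∘ next S , (size S ↑ʳ_) ∘ next T ]′ ∘ splitAt (size S)
    ; factor   = factor S Vector.++ factor T
    ; start    = start S Vector.++ start T
    }

  orbit-↑ˡ : ∀ S T n i → orbit (S ⊗ₛ T) n (i ↑ˡ size T) ≡ orbit S n i
  orbit-↑ˡ S T zero    i rewrite Fin.splitAt-↑ˡ (size S) i (size T) = ≡.refl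
  orbit-↑ˡ S T (suc n) i rewrite Fin.splitAt-↑ˡ (size S) i (size T) =
    ≡.cong (proj₁ (factor S i) *_) (orbit-↑ˡ S T n (next S i))

  orbit-↑ʳ : ∀ S T n i → orbit (S ⊗ₛ T) n (size S ↑ʳ i) ≡ orbit T n i
  orbit-↑ʳ S T zero    i rewrite Fin.splitAt-↑ʳ (size S) (size T) i = ≡.refl
  orbit-↑ʳ S T (suc n) i rewrite Fin.splitAt-↑ʳ (size S) (size T) i =
    ≡.cong (proj₁ (factor T i) *_) (orbit-↑ʳ S T n (next T i))

  Equation : System → Set c
  Equation S = Expr Carrier (Fin (size S))

  liftˡ : ∀ S T → Equation S → Equation (S ⊗ₛ T)
  liftˡ S T = rename (_↑ˡ size T)

  liftʳ : ∀ S T → Equation T → Equation (S ⊗ₛ T)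
  liftʳ S T = rename (size S ↑ʳ_)

  ⟦liftˡ⟧ : ∀ S T e n → ⟦ liftˡ S T e ⟧ (orbit (S ⊗ₛ T) n) ≈ ⟦ e ⟧ (orbit S n)
  ⟦liftˡ⟧ S T e n = trans (reflexive (⟦⟧-rename (_↑ˡ size T) e _))
    (⟦⟧-cong e (λ i → reflexive (orbit-↑ˡ S T n i)))

  ⟦liftʳ⟧ : ∀ S T e n → ⟦ liftʳ S T e ⟧ (orbit (S ⊗ₛ T) n) ≈ ⟦ e ⟧ (orbit T n)
  ⟦liftʳ⟧ S T e n = trans (reflexive (⟦⟧-rename (size S ↑ʳ_) e _))
    (⟦⟧-cong e (λ i → reflexive (orbit-↑ʳ S T n i)))

  Realizable : ∀ {ℓ} → Pred ℕ ℓ → Set (c ⊔ ℓ₁ ⊔ ℓ)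
  Realizable P = Σ[ S ∈ System ] Σ[ es ∈ List (Equation S) ]
    (λ n → All (λ e → ⟦ e ⟧ (orbit S n) ≈ 0#) es) ≐ P

  RealizableSeq : (ℕ → Carrier) → Set _
  RealizableSeq u = Σ[ S ∈ System ] Σ[ e ∈ Equation S ] (∀ n → ⟦ e ⟧ (orbit S n) ≈ u n)

  realizable-≐ : ∀ {ℓ ℓ′} {P : Pred ℕ ℓ} {Q : Pred ℕ ℓ′} → P ≐ Q → Realizable P → Realizable Q
  realizable-≐ (P⊆Q , Q⊆P) (S , es , Z⊆P , P⊆Z) = S , es , P⊆Q ∘ Z⊆P , P⊆Z ∘ Q⊆P

  realizable-∩ : ∀ {ℓ ℓ′} {P : Pred ℕ ℓ} {Q : Pred ℕ ℓ′} → Realizable P → Realizable Q → Realizable (P ∩ Q)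
  realizable-∩ (S , es , Z⊆P , P⊆Z) (T , fs , Z⊆Q , Q⊆Z) =
    S ⊗ₛ T , map (liftˡ S T) es ++ map (liftʳ S T) fs ,
    (λ {n} zs → let zs₁ , zs₂ = All.++⁻ (map (liftˡ S T) es) zs in
       Z⊆P (All.map (λ {e} → trans (sym (⟦liftˡ⟧ S T e n))) (All.map⁻ zs₁)) ,
       Z⊆Q (All.map (λ {e} → trans (sym (⟦liftʳ⟧ S T e n))) (All.map⁻ zs₂))) ,
    λ {n} (Pn , Qn) → All.++⁺
      (All.map⁺ (All.map (λ {e} → trans (⟦liftˡ⟧ S T e n)) (P⊆Z Pn)))
      (All.map⁺ (All.map (λ {e} → trans (⟦liftʳ⟧ S T e n)) (Q⊆Z Qn)))

  module _ {b} {V : Set b} {ρ : V → Carrier} where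

    private
      Z : Pred (Expr Carrier V) _
      Z e = ⟦ e ⟧ ρ ≈ 0#

    products-zeroˡ : ∀ {es} fs → All Z es → All Z (cartesianProductWith _⊗_ es fs)
    products-zeroˡ fs []       = []
    products-zeroˡ fs (z ∷ zs) = All.++⁺ (All.map⁺ (All.universal (λ f → trans (*-congʳ z) (zeroˡ _)) fs)) (products-zeroˡ fs zs)

    products-zeroʳ : ∀ es {fs} → All Z fs → All Z (cartesianProductWith _⊗_ es fs)
    products-zeroʳ []       zs = []
    products-zeroʳ (e ∷ es) zs = All.++⁺ (All.map⁺ (All.map (λ z → trans (*-congˡ z) (zeroʳ _)) zs)) (products-zeroʳ es zs)

    -- If some e is nonzero, its products with the fs force all of fs to vanish; deciding this for
    -- each e in turn yields the disjunction.
    products-zero⁻ : ∀ es fs → All Z (cartesianProductWith _⊗_ es fs) → All Z es ⊎ All Z fs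
    products-zero⁻ []       fs zs = inj₁ []
    products-zero⁻ (e ∷ es) fs zs with All.++⁻ (map (e ⊗_) fs) zs | ≈0? (⟦ e ⟧ ρ)
    ... | zs₁ , _   | inj₂ e≉0 = inj₂ (All.map (*-cancel-≉0 e≉0) (All.map⁻ zs₁))
    ... | _   , zs₂ | inj₁ e≈0 with products-zero⁻ es fs zs₂
    ...   | inj₁ zs′ = inj₁ (e≈0 ∷ zs′)
    ...   | inj₂ zs′ = inj₂ zs′

  realizable-∪ : ∀ {ℓ ℓ′} {P : Pred ℕ ℓ} {Q : Pred ℕ ℓ′} → Realizable P → Realizable Q → Realizable (P ∪ Q)
  realizable-∪ {P = P} {Q} (S , es , Z⊆P , P⊆Z) (T , fs , Z⊆Q , Q⊆Z) =
    S ⊗ₛ T , cartesianProductWith _⊗_ (map (liftˡ S T) es) (map (liftʳ S T) fs) , to , from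
    where
    Z : ℕ → Pred (Equation (S ⊗ₛ T)) _
    Z n e = ⟦ e ⟧ (orbit (S ⊗ₛ T) n) ≈ 0#
    to : ∀ {n} → All (Z n) _ → (P ∪ Q) n
    to {n} zs with products-zero⁻ (map (liftˡ S T) es) (map (liftʳ S T) fs) zs
    ... | inj₁ zs₁ = inj₁ (Z⊆P (All.map (λ {e} → trans (sym (⟦liftˡ⟧ S T e n))) (All.map⁻ zs₁)))
    ... | inj₂ zs₂ = inj₂ (Z⊆Q (All.map (λ {e} → trans (sym (⟦liftʳ⟧ S T e n))) (All.map⁻ zs₂)))
    from : ∀ {n} → (P ∪ Q) n → All (Z n) _
    from {n} (inj₁ Pn) = products-zeroˡ (map (liftʳ S T) fs) (All.map⁺ (All.map (λ {e} → trans (⟦liftˡ⟧ S T e n)) (P⊆Z Pn)))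
    from {n} (inj₂ Qn) = products-zeroʳ (map (liftˡ S T) es) (All.map⁺ (All.map (λ {e} → trans (⟦liftʳ⟧ S T e n)) (Q⊆Z Qn)))

  -- Sequences carried by orbits

  1ᵤ : 𝔾ₘ
  1ᵤ = 1# , 1# , *-identityˡ 1# , *-identityˡ 1#

  geometric : 𝔾ₘ → System
  geometric w = record { size = 1 ; nonEmpty = s≤s z≤n ; next = id ; factor = λ _ → w ; start = λ _ → 1ᵤ }

  orbit-geometric : ∀ w n i → orbit (geometric w) n i ≈ proj₁ w ^ n
  orbit-geometric w zero    i = refl
  orbit-geometric w (suc n) i = *-congˡ (orbit-geometric w n i)

  realizableSeq-geometric : ∀ a w → RealizableSeq (λ n → a * proj₁ w ^ n)
  realizableSeq-geometric a w = geometric w , scalar a ⊗ var zero , λ n → *-congˡ (orbit-geometric w n zero)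

  -- Every occurrence of a variable brings its own torus factor, so V may be infinite, as the type
  -- of polynomials over 𝔽 is.
  realizableSeq-⟦⟧ : ∀ {b} {V : Set b} {ρ : ℕ → V → Carrier} → (∀ v → RealizableSeq (λ n → ρ n v)) →
                     ∀ e → RealizableSeq (λ n → ⟦ e ⟧ (ρ n))
  realizableSeq-⟦⟧ R (scalar a) = geometric 1ᵤ , scalar a , λ _ → refl
  realizableSeq-⟦⟧ R (var v)    = R v
  realizableSeq-⟦⟧ R (e ⊕ f) with realizableSeq-⟦⟧ R e | realizableSeq-⟦⟧ R f
  ... | S , e′ , eq | T , f′ , eq′ = S ⊗ₛ T , liftˡ S T e′ ⊕ liftʳ S T f′ ,
    λ n → +-cong (trans (⟦liftˡ⟧ S T e′ n) (eq n)) (trans (⟦liftʳ⟧ S T f′ n) (eq′ n))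
  realizableSeq-⟦⟧ R (e ⊗ f) with realizableSeq-⟦⟧ R e | realizableSeq-⟦⟧ R f
  ... | S , e′ , eq | T , f′ , eq′ = S ⊗ₛ T , liftˡ S T e′ ⊗ liftʳ S T f′ ,
    λ n → *-cong (trans (⟦liftˡ⟧ S T e′ n) (eq n)) (trans (⟦liftʳ⟧ S T f′ n) (eq′ n))

  realizable-equation : ∀ {u} → RealizableSeq u → Realizable (λ n → u n ≈ 0#)
  realizable-equation (S , e , eq) = S , e ∷ [] , (λ { (z ∷ []) → trans (sym (eq _)) z }) , λ z → trans (eq _) z ∷ []

  realizable-U : Realizable Unary.U
  realizable-U = geometric 1ᵤ , [] , _ , λ _ → []

  realizable-∅ : Realizable Unary.∅
  realizable-∅ = geometric 1ᵤ , scalar 1# ∷ [] , (λ { (1≈0 ∷ []) → 1≉0 1≈0 }) , λ ()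

  realizable-equations : ∀ {b} {V : Set b} {ρ : ℕ → V → Carrier} → (∀ v → RealizableSeq (λ n → ρ n v)) →
                         ∀ es → Realizable (λ n → All (λ e → ⟦ e ⟧ (ρ n) ≈ 0#) es)
  realizable-equations R []       = realizable-≐ ((λ _ → []) , _) realizable-U
  realizable-equations R (e ∷ es) = realizable-≐ ((λ (z , zs) → z ∷ zs) , λ { (z ∷ zs) → z , zs })
    (realizable-∩ (realizable-equation (realizableSeq-⟦⟧ R e)) (realizable-equations R es))

  realizable-⋃ : ∀ {ℓ} {P : ℕ → Pred ℕ ℓ} N → (∀ i → i < N → Realizable (P i)) →
                 Realizable (λ n → ∃[ i ] i < N × P i n)
  realizable-⋃ zero    R = realizable-≐ ((λ ()) , λ ()) realizable-∅
  realizable-⋃ (suc N) R = realizable-≐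
    ( (λ { (inj₁ PN) → N , ℕ.n<1+n N , PN ; (inj₂ (i , i<N , Pi)) → i , ℕ.m<n⇒m<1+n i<N , Pi })
    , λ (i , i<1+N , Pi) → [ (λ i<N → inj₂ (i , i<N , Pi)) , (λ { ≡.refl → inj₁ Pi }) ]′ (ℕ.m≤n⇒m<n∨m≡n (ℕ.≤-pred i<1+N)) )
    (realizable-∪ (R N (ℕ.n<1+n N)) (realizable-⋃ N (λ i i<N → R i (ℕ.m<n⇒m<1+n i<N))))

  -- After n steps coordinate i carries the label of n + i, where the coordinates
  -- 0, …, a + b are traversed in order and the last one is followed by a.
  module _ {ℓ} {P : Pred ℕ ℓ} (P? : Unary.Decidable P) (a b : ℕ)
    (periodic : ∀ n → a ≤ n → P n → P (n ℕ.+ suc b)) (periodic⁻ : ∀ n → a ≤ n → P (n ℕ.+ suc b) → P n)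
    (u : 𝔾ₘ) (u≉1 : ¬ proj₁ u ≈ 1#) where

    private
      N : ℕ
      N = suc (a ℕ.+ b)

      successor : Fin N → Fin N
      successor i with suc (toℕ i) ℕ.<? N
      ... | yes i+1<N = fromℕ< i+1<N
      ... | no _      = fromℕ< (s≤s (ℕ.m≤m+n a b))

      label : Fin N → 𝔾ₘ
      label i with P? (toℕ i)
      ... | yes _ = 1ᵤ
      ... | no _  = u

      automaton : System
      automaton = record { size = N ; nonEmpty = s≤s z≤n ; next = successor ; factor = λ _ → 1ᵤ ; start = label }

      P⇒P-successor : ∀ n i → P (suc n ℕ.+ toℕ i) → P (n ℕ.+ toℕ (successor i))
      P-successor⇒P : ∀ n i → P (n ℕ.+ toℕ (successor i)) → P (suc n ℕ.+ toℕ i)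

      last : ∀ (i : Fin N) → ¬ suc (toℕ i) < N → ∀ n → n ℕ.+ a ℕ.+ suc b ≡ suc n ℕ.+ toℕ i
      last i i+1≮N n = ≡.trans (ℕ.+-assoc n a (suc b)) (≡.trans (≡.cong (n ℕ.+_) (≡.trans (ℕ.+-suc a b)
        (ℕ.≤-antisym (ℕ.≮⇒≥ i+1≮N) (Fin.toℕ<n i)))) (ℕ.+-suc n (toℕ i)))

      P⇒P-successor n i Pn with suc (toℕ i) ℕ.<? N
      ... | yes i+1<N = ≡.subst P (≡.sym (≡.trans (≡.cong (n ℕ.+_) (Fin.toℕ-fromℕ< i+1<N)) (ℕ.+-suc n (toℕ i)))) Pn
      ... | no i+1≮N  = ≡.subst P (≡.cong (n ℕ.+_) (≡.sym (Fin.toℕ-fromℕ< _)))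
        (periodic⁻ (n ℕ.+ a) (ℕ.m≤n+m a n) (≡.subst P (≡.sym (last i i+1≮N n)) Pn))
      P-successor⇒P n i Pn with suc (toℕ i) ℕ.<? N
      ... | yes i+1<N = ≡.subst P (≡.trans (≡.cong (n ℕ.+_) (Fin.toℕ-fromℕ< i+1<N)) (ℕ.+-suc n (toℕ i))) Pn
      ... | no i+1≮N  = ≡.subst P (last i i+1≮N n)
        (periodic (n ℕ.+ a) (ℕ.m≤n+m a n) (≡.subst P (≡.cong (n ℕ.+_) (Fin.toℕ-fromℕ< _)) Pn))

      orbit≈1⇒P : ∀ n i → orbit automaton n i ≈ 1# → P (n ℕ.+ toℕ i)
      orbit≈1⇒P zero i e with P? (toℕ i)
      ... | yes Pi = Pi
      ... | no _   = contradiction e u≉1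
      orbit≈1⇒P (suc n) i e = P-successor⇒P n i (orbit≈1⇒P n (successor i) (trans (sym (*-identityˡ _)) e))

      P⇒orbit≈1 : ∀ n i → P (n ℕ.+ toℕ i) → orbit automaton n i ≈ 1#
      P⇒orbit≈1 zero i Pi with P? (toℕ i)
      ... | yes _ = refl
      ... | no ¬P = contradiction Pi ¬P
      P⇒orbit≈1 (suc n) i Pn = trans (*-identityˡ _) (P⇒orbit≈1 n (successor i) (P⇒P-successor n i Pn))

    realizable-eventuallyPeriodic : Realizable P
    realizable-eventuallyPeriodic = automaton , var zero ⊕ scalar (- 1#) ∷ [] ,
      (λ { {n} (z ∷ []) → ≡.subst P (ℕ.+-identityʳ n) (orbit≈1⇒P n zero (x-y≈0⇒x≈y _ _ z)) }) ,
      λ {n} Pn → trans (+-congʳ (P⇒orbit≈1 n zero (≡.subst P (≡.sym (ℕ.+-identityʳ n)) Pn))) (-‿inverseʳ 1#) ∷ []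

  -- Expansion into Laurent polynomials

  Terms : ℕ → Set c
  Terms k = List (Carrier × Vector ℕ k)

  laurent : ∀ {k} → Terms k → LaurentPolynomial k
  laurent = map (λ (a , e) → a , ℤ.+_ ∘ e)

  unit : ∀ {k} → Fin k → Vector ℕ k
  unit zero    zero    = 1
  unit zero    (suc j) = 0
  unit (suc i) zero    = 0
  unit (suc i) (suc j) = unit i j

  ∏-1 : ∀ k → ∏ {k} (λ _ → 1#) ≈ 1#
  ∏-1 = sum-replicate-zero

  ∏-unit : ∀ {k} (x : Vector Carrier k) i → ∏ (λ j → x j ^ unit i j) ≈ x i
  ∏-unit {suc k} x zero    = trans (*-cong (*-identityʳ _) (∏-1 k)) (*-identityʳ _)
  ∏-unit {suc k} x (suc i) = trans (*-identityˡ _) (∏-unit (x ∘ suc) i)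

  terms : ∀ {k} → Expr Carrier (Fin k) → Terms k
  terms (scalar a) = (a , λ _ → 0) ∷ []
  terms (var i)    = (1# , unit i) ∷ []
  terms (e ⊕ f)    = terms e ++ terms f
  terms (e ⊗ f)    = cartesianProductWith (λ (a , d) (b , d′) → a * b , λ i → d i ℕ.+ d′ i) (terms e) (terms f)

  evalTerms : ∀ {k} → Terms k → Vector Carrier k → Carrier
  evalTerms f x = foldr (λ (a , e) s → a * ∏ (λ i → x i ^ e i) + s) 0# f

  evalTerms-++ : ∀ {k} f g (x : Vector Carrier k) → evalTerms (f ++ g) x ≈ evalTerms f x + evalTerms g x
  evalTerms-++ []      g x = sym (+-identityˡ _)
  evalTerms-++ (_ ∷ f) g x = trans (+-congˡ (evalTerms-++ f g x)) (sym (+-assoc _ _ _))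

  evalTerms-⊗ : ∀ {k} f g (x : Vector Carrier k) →
    evalTerms (cartesianProductWith (λ (a , d) (b , d′) → a * b , λ i → d i ℕ.+ d′ i) f g) x ≈ evalTerms f x * evalTerms g x
  evalTerms-⊗ []            g x = sym (zeroˡ _)
  evalTerms-⊗ ((a , d) ∷ f) g x = trans (evalTerms-++ (map _ g) _ x)
    (trans (+-cong (scaled g) (evalTerms-⊗ f g x)) (sym (distribʳ _ _ _)))
    where
    scaled : ∀ g → evalTerms (map (λ (b , d′) → a * b , λ i → d i ℕ.+ d′ i) g) x ≈ a * ∏ (λ i → x i ^ d i) * evalTerms g x
    scaled []             = sym (zeroʳ _)
    scaled ((b , d′) ∷ g) = trans (+-cong
      (*-congˡ (trans (sum-cong-≋ (λ i → ^-homo-* (x i) (d i) (d′ i))) (∑-distrib-+ (λ i → x i ^ d i) (λ i → x i ^ d′ i))))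
      (scaled g))
      (solve 5 (λ a b u v s → a :* b :* (u :* v) :+ a :* u :* s := a :* u :* (b :* v :+ s)) refl a b _ _ _)

  evalTerms-terms : ∀ {k} e (x : Vector Carrier k) → evalTerms (terms e) x ≈ ⟦ e ⟧ x
  evalTerms-terms {k} (scalar a) x = trans (+-identityʳ _) (trans (*-congˡ (∏-1 k)) (*-identityʳ a))
  evalTerms-terms (var i)    x = trans (+-identityʳ _) (trans (*-identityˡ _) (∏-unit x i))
  evalTerms-terms (e ⊕ f)    x = trans (evalTerms-++ (terms e) (terms f) x) (+-cong (evalTerms-terms e x) (evalTerms-terms f x))
  evalTerms-terms (e ⊗ f)    x = trans (evalTerms-⊗ (terms e) (terms f) x) (*-cong (evalTerms-terms e x) (evalTerms-terms f x))

  eval-laurent : ∀ {k} (f : Terms k) (x : 𝔾ₘ^ k) → eval (laurent f) x ≡ evalTerms f (proj₁ ∘ x)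
  eval-laurent []            x = ≡.refl
  eval-laurent ((a , e) ∷ f) x = ≡.cong (λ s → a * ∏ (λ i → proj₁ (x i) ^ e i) + s) (eval-laurent f x)

  module _ (S : System) where

    private
      step : ∀ (x : 𝔾ₘ^ size S) i → eval (laurent (terms (scalar (proj₁ (factor S i)) ⊗ var (next S i)))) x ≈
             proj₁ (factor S i) * proj₁ (x (next S i))
      step x i = trans (reflexive (eval-laurent (terms e) x)) (evalTerms-terms e (proj₁ ∘ x))
        where e = scalar (proj₁ (factor S i)) ⊗ var (next S i)

    endomorphism : Endomorphism (size S)
    endomorphism = record
      { component  = λ i → laurent (terms (scalar (proj₁ (factor S i)) ⊗ var (next S i)))
      ; invertible = λ x i →
          let u , u⁻¹ , u⁻¹u≈1 , _ = factor S i
              v , v⁻¹ , v⁻¹v≈1 , _ = x (next S i)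
              uv⁻¹≈1 : u⁻¹ * v⁻¹ * (u * v) ≈ 1#
              uv⁻¹≈1 = trans (solve 4 (λ a b d e → a :* b :* (d :* e) := a :* d :* (b :* e)) refl u⁻¹ v⁻¹ u v)
                (trans (*-cong u⁻¹u≈1 v⁻¹v≈1) (*-identityˡ 1#))
              inverse = trans (*-congˡ (step x i)) uv⁻¹≈1
          in u⁻¹ * v⁻¹ , inverse , trans (*-comm _ _) inverse
      }

    fold≈orbit : ∀ n i → proj₁ (fold (start S) (apply endomorphism) n i) ≈ orbit S n i
    fold≈orbit zero    i = refl
    fold≈orbit (suc n) i = trans (step (fold (start S) (apply endomorphism) n) i) (*-congˡ (fold≈orbit n (next S i)))

  realizable⇒orbitIntersection : ∀ {ℓ} {P : Pred ℕ ℓ} → Realizable P →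
    Σ[ k ∈ ℕ ] 1 ≤ k ×
    Σ[ Φ ∈ Endomorphism k ] Σ[ α ∈ 𝔾ₘ^ k ] Σ[ V ∈ ClosedSubvariety k ]
      (λ n → points V (fold α (apply Φ) n)) ≐ P
  realizable⇒orbitIntersection (S , es , Z⊆P , P⊆Z) =
    size S , nonEmpty S , endomorphism S , start S , map (laurent ∘ terms) es ,
    (λ {n} zs → Z⊆P (All.map (λ {e} → trans (sym (value n e))) (All.map⁻ zs))) ,
    (λ {n} Pn → All.map⁺ (All.map (λ {e} → trans (value n e)) (P⊆Z Pn)))
    where
    value : ∀ n e → eval (laurent (terms e)) (fold (start S) (apply (endomorphism S)) n) ≈ ⟦ e ⟧ (orbit S n)
    value n e = trans (reflexive (eval-laurent (terms e) _)) (trans (evalTerms-terms e _) (⟦⟧-cong e (fold≈orbit S n)))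

-- Exponential sequences

-- N clears denominators, E collects the negative constants, D the positive ones and the terms with
-- fixed exponent; r is the power of p common to the remaining terms.
PowerSums : (q N E D r : ℕ) → List ℕ → Pred ℕ 0ℓ
PowerSums q N E D r as n = ∃[ M ] N ℕ.* n ℕ.+ E ≡ D ℕ.+ r ℕ.* M × Represents U q as M

represents>0 : ∀ {q a as M} .{{_ : ℕ.NonZero q}} → 1 ≤ a → Represents U q (a ∷ as) M → 1 ≤ M
represents>0 {q} {a} 1≤a (n , N′ , _ , ≡.refl , _) =
  ℕ.≤-trans (ℕ.*-mono-≤ 1≤a (ℕ.m^n>0 q n)) (ℕ.m≤m+n (a ℕ.* q ℕ.^ n) N′)

module _ (N E D : ℕ) (1≤N : 1 ≤ N) where

  exceeds : ∀ {n} → suc D ≤ n → D < N ℕ.* n ℕ.+ E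
  exceeds {n} D<n = ℕ.≤-trans (ℕ.≤-trans (ℕ.≤-trans D<n (ℕ.≤-reflexive (≡.sym (ℕ.*-identityˡ n))))
    (ℕ.*-monoˡ-≤ n 1≤N)) (ℕ.m≤m+n (N ℕ.* n) E)

  -- The congruence hidden in `PowerSums`: an M ≥ 1 with N n + E = D + r M exists. From n = D + 1 on
  -- the inequality is automatic, leaving a condition of period r.
  Admissible : ℕ → Pred ℕ 0ℓ
  Admissible r n = D < N ℕ.* n ℕ.+ E × r ∣ N ℕ.* n ℕ.+ E ℕ.∸ D

  admissible? : ∀ r → Unary.Decidable (Admissible r)
  admissible? r n = (D ℕ.<? N ℕ.* n ℕ.+ E) ×-dec (r ∣? N ℕ.* n ℕ.+ E ℕ.∸ D)

  admissible-intro : ∀ {r n M} → 1 ≤ r → 1 ≤ M → N ℕ.* n ℕ.+ E ≡ D ℕ.+ r ℕ.* M → Admissible r n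
  admissible-intro {r} {n} {M} 1≤r 1≤M eq =
    ≡.subst (D <_) (≡.sym eq) (ℕ.m<m+n D (ℕ.*-mono-≤ 1≤r 1≤M)) ,
    divides M (≡.trans (≡.cong (ℕ._∸ D) eq) (≡.trans (ℕ.m+n∸m≡n D (r ℕ.* M)) (ℕ.*-comm r M)))

  admissible-elim : ∀ {r n} → Admissible r n → ∃[ M ] 1 ≤ M × N ℕ.* n ℕ.+ E ≡ D ℕ.+ r ℕ.* M
  admissible-elim {r} {n} (D< , divides M eq) = M ,
    ℕ.n≢0⇒n>0 (λ { ≡.refl → contradiction (ℕ.m∸n≡0⇒m≤n eq) (ℕ.<⇒≱ D<) }) ,
    ≡.trans (≡.sym (ℕ.m+[n∸m]≡n (ℕ.<⇒≤ D<))) (≡.cong (D ℕ.+_) (≡.trans eq (ℕ.*-comm M r)))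

  private
    translate : ∀ r n → N ℕ.* (n ℕ.+ r) ℕ.+ E ≡ N ℕ.* n ℕ.+ E ℕ.+ N ℕ.* r
    translate r n = ≡.trans (≡.cong (ℕ._+ E) (ℕ.*-distribˡ-+ N n r)) (≡.trans (ℕ.+-assoc (N ℕ.* n) _ E)
      (≡.trans (≡.cong (N ℕ.* n ℕ.+_) (ℕ.+-comm _ E)) (≡.sym (ℕ.+-assoc (N ℕ.* n) E _))))

    translate∸ : ∀ r {n} → suc D ≤ n → N ℕ.* (n ℕ.+ r) ℕ.+ E ℕ.∸ D ≡ N ℕ.* r ℕ.+ (N ℕ.* n ℕ.+ E ℕ.∸ D)
    translate∸ r {n} D<n = ≡.trans (≡.cong (ℕ._∸ D) (≡.trans (translate r n) (ℕ.+-comm _ (N ℕ.* r))))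
      (ℕ.+-∸-assoc (N ℕ.* r) (ℕ.<⇒≤ (exceeds D<n)))

  admissible-periodic : ∀ r n → suc D ≤ n → Admissible r n → Admissible r (n ℕ.+ r)
  admissible-periodic r n D<n (_ , r∣) = exceeds (ℕ.≤-trans D<n (ℕ.m≤m+n n r)) ,
    ≡.subst (r ∣_) (≡.sym (translate∸ r D<n)) (∣.∣m∣n⇒∣m+n (∣.n∣m*n N) r∣)

  admissible-periodic⁻ : ∀ r n → suc D ≤ n → Admissible r (n ℕ.+ r) → Admissible r n
  admissible-periodic⁻ r n D<n (_ , r∣) = exceeds D<n ,
    ∣.∣m+n∣m⇒∣n (≡.subst (r ∣_) (translate∸ r D<n) r∣) (∣.n∣m*n N)

module PowerSumsRealizable {c ℓ₁ ℓ₂ : Level} {p : ℕ} (p-prime : Prime p)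
  (𝕂 : AlgebraicClosureOf𝔽⟨t⟩ p c ℓ₁ ℓ₂) where

  open FiniteSubfield p-prime 𝕂
  open SplitTorus heytingField using (𝔾ₘ)
  open Realization heytingField _#?_
  open Semantics heytingField _#?_
  open Evaluation p-prime 𝕂

  𝕦 : ∀ {x} → x ≉0 → 𝔾ₘ
  𝕦 {x} x≉0 = x , x ⁻¹ , trans (*-comm _ _) (⁻¹-inverseʳ x≉0) , ⁻¹-inverseʳ x≉0

  realizable-periodic : ∀ {ℓ} {P : Pred ℕ ℓ} → Unary.Decidable P → ∀ a b → 1 ≤ b →
    (∀ n → a ≤ n → P n → P (n ℕ.+ b)) → (∀ n → a ≤ n → P (n ℕ.+ b) → P n) → Realizable P
  realizable-periodic P? a (suc b) _ periodic periodic⁻ =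
    -- t labels the nonmembers, being a unit different from 1.
    realizable-eventuallyPeriodic P? a b periodic periodic⁻ (𝕦 t≉0) λ t≈1 → t^suc≉1 0 (trans (*-identityʳ t) t≈1)

  module _ (k : ℕ) where

    open GaloisField k
    open DigitSum p-prime 𝕂 k using (q≢0)
    open Norm k

    root : ∀ r → 1 ≤ r → ∀ x → ∃[ w ] w ^ r ≈ x
    root (suc r) _ x with monic-root (- x ∷ monomial r 1#) (≡.cong suc (length-monomial r 1#) , coeff-monomial r 1#)
    ... | w , e = w , x-y≈0⇒x≈y _ _ (begin
      w ^ suc r - x                   ≈⟨ +-comm _ _ ⟩
      - x + w * w ^ r                 ≈⟨ +-congˡ (*-congˡ (trans (monomial-⟨⟩ r 1# w) (*-identityʳ _))) ⟨
      - x + w * monomial r 1# ⟨ w ⟩   ≈⟨ e ⟩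
      0#                              ∎)
      where open ≈

    module _ (N E D g : ℕ) (1≤N : 1 ≤ N) where

      private
        r : ℕ
        r = p ℕ.^ g

        1≤r : 1 ≤ r
        1≤r = ℕ.m^n>0 p {{ℕ.>-nonZero 1≤p}} g

      -- With w an r-th root of x, x ^ M is w ^ (N n + E − D). The case x = 0 is why M ≥ 1.
      power-realizable : ∀ x → Σ (ℕ → Carrier) λ u → RealizableSeq u ×
        (∀ {n M} → 1 ≤ M → N ℕ.* n ℕ.+ E ≡ D ℕ.+ r ℕ.* M → u n ≈ x ^ M)
      power-realizable x with ≈0? x
      ... | inj₁ x≈0 = _ , realizableSeq-geometric 0# 1ᵤ ,
        λ { {M = suc M} (s≤s _) _ → trans (zeroˡ _) (sym (trans (*-congʳ x≈0) (zeroˡ _))) }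
      ... | inj₂ x≉0 with w , w^r≈x ← root r 1≤r x =
        _ , realizableSeq-geometric (w ^ E * (w ^ D) ⁻¹) (𝕦 (^-≉0 N w≉0)) , λ {n} {M} _ eq → begin
          w ^ E * (w ^ D) ⁻¹ * (w ^ N) ^ n       ≈⟨ *-congˡ (^-assocʳ w N n) ⟩
          w ^ E * (w ^ D) ⁻¹ * w ^ (N ℕ.* n)     ≈⟨ solve 3 (λ a b d → a :* b :* d := b :* (d :* a)) refl _ _ _ ⟩
          (w ^ D) ⁻¹ * (w ^ (N ℕ.* n) * w ^ E)   ≈⟨ *-congˡ (^-homo-* w (N ℕ.* n) E) ⟨
          (w ^ D) ⁻¹ * w ^ (N ℕ.* n ℕ.+ E)       ≡⟨ ≡.cong (λ e → (w ^ D) ⁻¹ * w ^ e) eq ⟩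
          (w ^ D) ⁻¹ * w ^ (D ℕ.+ r ℕ.* M)       ≈⟨ *-congˡ (^-homo-* w D (r ℕ.* M)) ⟩
          (w ^ D) ⁻¹ * (w ^ D * w ^ (r ℕ.* M))   ≈⟨ solve 3 (λ a b d → a :* (b :* d) := b :* a :* d) refl _ _ _ ⟩
          w ^ D * (w ^ D) ⁻¹ * w ^ (r ℕ.* M)     ≈⟨ *-congʳ (⁻¹-inverseʳ (^-≉0 D w≉0)) ⟩
          1# * w ^ (r ℕ.* M)                     ≈⟨ *-identityˡ _ ⟩
          w ^ (r ℕ.* M)                          ≈⟨ ^-assocʳ w r M ⟨
          (w ^ r) ^ M                            ≈⟨ ^-congˡ M w^r≈x ⟩
          x ^ M                                  ∎
        where
        open ≈
        w≉0 : w ≉0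
        w≉0 w≈0 = x≉0 (trans (sym w^r≈x) (trans (^-congˡ r w≈0) (0^ 1≤r)))

      realizable-powerSums : ∀ as → All (1 ≤_) as → sum as ℕ.+ sum as < q → Realizable (PowerSums q N E D r as)
      -- The empty list forces M = 0, outside the range M ≥ 1 of `power-realizable`. The set
      -- contains no n > D, so it is eventually periodic.
      realizable-powerSums [] _ _ = realizable-≐
        ( (λ eq → 0 , ≡.trans eq (≡.sym (≡.trans (≡.cong (D ℕ.+_) (ℕ.*-zeroʳ r)) (ℕ.+-identityʳ D))) , ≡.refl)
        , λ { (_ , eq , ≡.refl) → ≡.trans eq (≡.trans (≡.cong (D ℕ.+_) (ℕ.*-zeroʳ r)) (ℕ.+-identityʳ D)) } )
        (realizable-periodic (λ n → N ℕ.* n ℕ.+ E ℕ.≟ D) (suc D) 1 (s≤s z≤n)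
          (λ n D<n eq → contradiction (≡.sym eq) (ℕ.<⇒≢ (exceeds N E D 1≤N D<n)))
          (λ n D<n eq → contradiction (≡.sym eq) (ℕ.<⇒≢ (exceeds N E D 1≤N (ℕ.≤-trans D<n (ℕ.m≤m+n n 1))))))
      realizable-powerSums as@(_ ∷ _) 1≤as@(1≤a ∷ _) 2A<q = realizable-≐
        ( (λ {n} (adm , vanish) → let M , 1≤M , eq = admissible-elim N E D 1≤N adm in
             M , eq , vanishing⇒represents as 2A<q {M} {ρ n} (λ f → proj₂ (proj₂ (power-realizable (proj₁ f ⟨ t ⟩))) 1≤M eq) vanish)
        , λ {n} (M , eq , rep) → let 1≤M = represents>0 1≤a rep in
             admissible-intro N E D 1≤N 1≤r 1≤M eq ,
             represents⇒vanishing as 2A<q {M} {ρ n} (λ f → proj₂ (proj₂ (power-realizable (proj₁ f ⟨ t ⟩))) 1≤M eq) 1≤as rep )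
        (realizable-∩
          (realizable-periodic (admissible? N E D 1≤N r) (suc D) r 1≤r (admissible-periodic N E D 1≤N r) (admissible-periodic⁻ N E D 1≤N r))
          (realizable-equations (λ f → proj₁ (proj₂ (power-realizable (proj₁ f ⟨ t ⟩)))) (equations as 2A<q)))
        where
        ρ : ℕ → 𝔽Poly → Carrier
        ρ n f = proj₁ (power-realizable (proj₁ f ⟨ t ⟩)) n

-- Reduction to large q

module PrimePowerSums where

  open import Data.Nat.Base using (_+_; _*_; _^_; _∸_; NonZero)
  open import Relation.Binary.PropositionalEquality using (refl; sym; trans; cong; cong₂; subst; module ≡-Reasoning)
  open ℕ-Solver.+-*-Solver using (solve; _:=_; _:+_; _:*_)


  missing : (xs : List ℕ) → ∃[ w ] w < suc (length xs) × w ∉ˡ xs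
  missing xs with Fin.any? (λ (i : Fin (suc (length xs))) → ¬? (Any.any? (toℕ i ℕ.≟_) xs))
  ... | yes (i , i∉xs) = toℕ i , Fin.toℕ<n i , i∉xs
  ... | no none = contradiction (Fin.toℕ-injective toℕi≡toℕj) (Fin.<⇒≢ i<j)
    where
    all∈ : ∀ i → toℕ i ∈ˡ xs
    all∈ i = decidable-stable (Any.any? (toℕ i ℕ.≟_) xs) (λ i∉xs → none (i , i∉xs))
    collision = Fin.pigeonhole (ℕ.n<1+n (length xs)) (λ i → Any.index (all∈ i))
    i = proj₁ collision
    j = proj₁ (proj₂ collision)
    i<j = proj₁ (proj₂ (proj₂ collision))
    toℕi≡toℕj : toℕ i ≡ toℕ j
    toℕi≡toℕj = trans (Any.lookup-index (all∈ i)) (trans (cong (lookup xs) (proj₂ (proj₂ (proj₂ collision)))) (sym (Any.lookup-index (all∈ j))))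

  n<b^n : ∀ {b} → 2 ≤ b → ∀ n → n < b ^ n
  n<b^n 2≤b zero    = s≤s z≤n
  n<b^n {b} 2≤b (suc n) = ℕ.≤-trans (s≤s (n<b^n 2≤b n)) (ℕ.≤-trans
    (ℕ.+-monoˡ-≤ (b ^ n) (ℕ.≤-trans (s≤s z≤n) (n<b^n 2≤b n)))
    (ℕ.≤-trans (ℕ.≤-reflexive (cong (b ^ n +_) (sym (ℕ.+-identityʳ (b ^ n))))) (ℕ.*-monoˡ-≤ (b ^ n) 2≤b)))

  PrimePowerSum : ℕ → List (ℕ × ℕ) → Pred ℕ 0ℓ
  PrimePowerSum p []             S = S ≡ 0
  PrimePowerSum p ((A , κ) ∷ ts) S = ∃₂ λ e S′ → S ≡ A * p ^ (κ * e) + S′ × PrimePowerSum p ts S′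

  exponents : ∀ {p} ts {S} → PrimePowerSum p ts S → List ℕ
  exponents []             _                = []
  exponents ((A , κ) ∷ ts) (e , _ , _ , pps) = κ * e ∷ exponents ts pps

  length-exponents : ∀ {p} ts {S} (pps : PrimePowerSum p ts S) → length (exponents ts pps) ≡ length ts
  length-exponents []       _                 = refl
  length-exponents (_ ∷ ts) (_ , _ , _ , pps) = cong suc (length-exponents ts pps)

  Proper : Pred (ℕ × ℕ) 0ℓ
  Proper (A , κ) = 1 ≤ A × 1 ≤ κ

  -- Writing the exponents as e = g + ρ + L n with 0 ≤ ρ < L − G makes all
  -- coefficients p ^ ρ small compared to q = p ^ L. An exponent e ≥ L is of
  -- this form unless e mod L lies in the window [g − G, g); among more than
  -- m disjoint windows of length G, one is avoided by any m given exponents.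
  module Boxes {c ℓ₁ ℓ₂ : Level} {p : ℕ} (p-prime : Prime p)
    (𝕂 : AlgebraicClosureOf𝔽⟨t⟩ p c ℓ₁ ℓ₂) (N E : ℕ) (1≤N : 1 ≤ N) where

    open FiniteSubfield p-prime 𝕂 using (module GaloisField; 1≤p; heytingField; _#?_)
    open Realization heytingField _#?_
    open PowerSumsRealizable p-prime 𝕂

    2≤p : 2 ≤ p
    2≤p = ℕ.nonTrivial⇒n>1 p {{prime⇒nonTrivial p-prime}}

    module _ (k G : ℕ) {{_ : NonZero G}} (w : ℕ) where

      open GaloisField k using (q)

      L g : ℕ
      L = suc k
      g = suc w * G

      -- Each term is either frozen, with one of finitely many e < L absorbed into D, or free, with
      -- exponent g + ρ + L m and value p ^ g · (A p ^ ρ) q ^ m. When κ divides L, such an exponent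
      -- is a multiple of κ iff κ divides g + ρ.
      Box : List (ℕ × ℕ) → ℕ → List ℕ → Pred ℕ 0ℓ
      Box []             D as   = PowerSums q N E D (p ^ g) as
      Box ((A , κ) ∷ ts) D as n =
        (∃[ e ] e < L × Box ts (D + A * p ^ (κ * e)) as n) ⊎
        (∃[ ρ ] ρ < L ∸ G × κ ∣ g + ρ × Box ts D (A * p ^ ρ ∷ as) n)

      bound : ℕ
      bound = p ^ (L ∸ G)

      weight : List (ℕ × ℕ) → ℕ
      weight ts = sum (map proj₁ ts)

      -- Invariant of the recursion: a term not yet placed is charged A p ^ (L - G), at least the
      -- coefficient A p ^ ρ it may receive. With no terms left it reads 2 ∑ⱼ aⱼ < q.
      Small : List (ℕ × ℕ) → List ℕ → Set
      Small ts as = let s = sum as + weight ts * bound in s + s < q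

      small-drop : ∀ {A κ} ts as → Small ((A , κ) ∷ ts) as → Small ts as
      small-drop {A} ts as = ℕ.≤-<-trans (ℕ.+-mono-≤ le le)
        where
        le : sum as + weight ts * bound ≤ sum as + (A + weight ts) * bound
        le = ℕ.+-monoʳ-≤ (sum as) (ℕ.*-monoˡ-≤ bound (ℕ.m≤n+m (weight ts) A))

      small-move : ∀ {A κ ρ} ts as → ρ < L ∸ G → Small ((A , κ) ∷ ts) as → Small ts (A * p ^ ρ ∷ as)
      small-move {A} {ρ = ρ} ts as ρ< = ℕ.≤-<-trans (ℕ.+-mono-≤ le le)
        where
        le : A * p ^ ρ + sum as + weight ts * bound ≤ sum as + (A + weight ts) * bound
        le = ℕ.≤-trans
          (ℕ.+-monoˡ-≤ (weight ts * bound) (ℕ.+-monoˡ-≤ (sum as)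
            (ℕ.*-monoʳ-≤ A (ℕ.^-monoʳ-≤ p {{ℕ.>-nonZero 1≤p}} (ℕ.<⇒≤ ρ<)))))
          (ℕ.≤-reflexive (solve 4 (λ a s w P → a :* P :+ s :+ w :* P := s :+ (a :+ w) :* P) refl A (sum as) (weight ts) bound))

      realizable-box : ∀ ts D as → All Proper ts → All (1 ≤_) as → Small ts as → Realizable (Box ts D as)
      realizable-box [] D as _ 1≤as small = realizable-powerSums k N E D g 1≤N as 1≤as
        (subst (λ s → s + s < q) (ℕ.+-identityʳ (sum as)) small)
      realizable-box ((A , κ) ∷ ts) D as ((1≤A , _) ∷ proper) 1≤as small = realizable-∪
        (realizable-⋃ L λ e _ → realizable-box ts (D + A * p ^ (κ * e)) as proper 1≤as (small-drop {A} {κ} ts as small))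
        (realizable-⋃ (L ∸ G) variable-part)
        where
        variable-part : ∀ ρ → ρ < L ∸ G → Realizable (λ n → κ ∣ g + ρ × Box ts D (A * p ^ ρ ∷ as) n)
        variable-part ρ ρ< with κ ∣? g + ρ
        ... | no ∤  = realizable-≐ ((λ ()) , λ (d , _) → ∤ d) realizable-∅
        ... | yes d = realizable-≐ ((d ,_) , proj₂) (realizable-box ts D (A * p ^ ρ ∷ as) proper
          (ℕ.*-mono-≤ 1≤A (ℕ.m^n>0 p {{ℕ.>-nonZero 1≤p}} ρ) ∷ 1≤as) (small-move {A} {κ} ts as ρ< small))

      box-sound : ∀ ts D as {n} → All (λ (_ , κ) → κ ∣ L) ts → Box ts D as n →
        ∃₂ λ S M → PrimePowerSum p ts S × Represents U q as M × N * n + E ≡ D + S + p ^ g * M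
      box-sound [] D as _ (M , eq , rep) = 0 , M , refl , rep , trans eq (cong (_+ p ^ g * M) (sym (ℕ.+-identityʳ D)))
      box-sound ((A , κ) ∷ ts) D as (_ ∷ κ∣L) (inj₁ (e , _ , box)) with box-sound ts _ as κ∣L box
      ... | S , M , pps , rep , eq = A * p ^ (κ * e) + S , M , (e , S , refl , pps) , rep ,
        trans eq (cong (_+ p ^ g * M) (ℕ.+-assoc D _ S))
      box-sound ((A , κ) ∷ ts) D as (divides l L≡ ∷ κ∣L) (inj₂ (ρ , _ , divides d g+ρ≡ , box)) with box-sound ts D _ κ∣L box
      ... | S , _ , pps , (m , M , _ , refl , rep) , eq =
        A * p ^ (κ * e) + S , M , (e , S , refl , pps) , rep , trans eq (trans
          (cong (D + S +_) (trans
            (solve 5 (λ x a y z m → x :* (a :* y :* z :+ m) := a :* (x :* (y :* z)) :+ x :* m) refl (p ^ g) A (p ^ ρ) (q ^ m) M)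
            (cong (λ y → A * y + p ^ g * M) power)))
          (solve 4 (λ d s y x → d :+ s :+ (y :+ x) := d :+ (y :+ s) :+ x) refl D S (A * p ^ (κ * e)) (p ^ g * M)))
        where
        open ≡-Reasoning
        -- From g + ρ = d κ and L = l κ one gets κ e = g + ρ + L m.
        e = d + m * l
        power : p ^ g * (p ^ ρ * q ^ m) ≡ p ^ (κ * e)
        power = begin
          p ^ g * (p ^ ρ * q ^ m)       ≡⟨ ℕ.*-assoc (p ^ g) (p ^ ρ) (q ^ m) ⟨
          p ^ g * p ^ ρ * (p ^ L) ^ m   ≡⟨ cong₂ _*_ (sym (ℕ.^-distribˡ-+-* p g ρ)) (ℕ.^-*-assoc p L m) ⟩
          p ^ (g + ρ) * p ^ (L * m)     ≡⟨ ℕ.^-distribˡ-+-* p (g + ρ) (L * m) ⟨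
          p ^ (g + ρ + L * m)           ≡⟨ cong (p ^_) (cong₂ (λ x y → x + y * m) g+ρ≡ L≡) ⟩
          p ^ (d * κ + l * κ * m)       ≡⟨ cong (p ^_) (solve 4 (λ d κ l m → d :* κ :+ l :* κ :* m := κ :* (d :+ m :* l)) refl d κ l m) ⟩
          p ^ (κ * e)                   ∎

      outsideWindow : G ≤ L → g ≤ L → ∀ x → L ≤ x → x % L / G ≢ w → ∃₂ λ ρ m → ρ < L ∸ G × x ≡ g + ρ + L * m
      outsideWindow G≤L window x L≤x ∉window = ρ , m , ρ< , x≡
        where
        y ρ m : ℕ
        y = x ∸ g
        ρ = y % L
        m = y / L
        x≡ : x ≡ g + ρ + L * m
        x≡ = trans (sym (ℕ.m+[n∸m]≡n (ℕ.≤-trans window L≤x))) (trans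
          (cong (g +_) (trans (m≡m%n+[m/n]*n y L) (cong (ρ +_) (ℕ.*-comm m L)))) (sym (ℕ.+-assoc g ρ _)))
        ρ< : ρ < L ∸ G
        -- If ρ = L - G + s, then x = g + ρ + L m is w G + s modulo L with s < G, so x mod L lies in
        -- the window with index w.
        ρ< = ℕ.≰⇒> λ L∸G≤ρ →
          let s   = ρ ∸ (L ∸ G)
              ρ≡  = sym (ℕ.m+[n∸m]≡n L∸G≤ρ)
              s<G = ℕ.+-cancelˡ-< (L ∸ G) s G (ℕ.≤-trans (s≤s (ℕ.≤-reflexive (sym ρ≡)))
                      (ℕ.≤-trans (m%n<n y L) (ℕ.≤-reflexive (sym (ℕ.m∸n+n≡m G≤L)))))
              r<L = ℕ.<-≤-trans (ℕ.+-monoʳ-< (w * G) s<G) (ℕ.≤-trans (ℕ.≤-reflexive (ℕ.+-comm (w * G) G)) window)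
              x≡′ : x ≡ w * G + s + suc m * L
              x≡′ = trans x≡ (trans (cong (λ ρ → g + ρ + L * m) ρ≡) (trans
                (solve 5 (λ G wG H s Lm → G :+ wG :+ (H :+ s) :+ Lm := wG :+ s :+ (H :+ G :+ Lm)) refl G (w * G) (L ∸ G) s (L * m))
                (cong₂ (λ a b → w * G + s + (a + b)) (ℕ.m∸n+n≡m G≤L) (ℕ.*-comm L m))))
          in ∉window (begin
            x % L / G                          ≡⟨ cong (λ x → x % L / G) x≡′ ⟩
            (w * G + s + suc m * L) % L / G    ≡⟨ cong (_/ G) (trans ([m+kn]%n≡m%n (w * G + s) (suc m) L) (m<n⇒m%n≡m r<L)) ⟩
            (w * G + s) / G                    ≡⟨ +-distrib-/-∣ˡ s (∣.n∣m*n w) ⟩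
            w * G / G + s / G                  ≡⟨ cong₂ _+_ (m*n/n≡m w G) (m<n⇒m/n≡0 s<G) ⟩
            w + 0                              ≡⟨ ℕ.+-identityʳ w ⟩
            w                                  ∎)
          where open ≡-Reasoning

      -- A single w must avoid the window indices of all exponents, because the factor p ^ g is
      -- common to all free terms.
      box-complete : G ≤ L → g ≤ L → ∀ ts D as {n S M} → All Proper ts → All (λ (_ , κ) → κ ∣ L) ts →
        (pps : PrimePowerSum p ts S) → w ∉ˡ map (λ x → x % L / G) (exponents ts pps) →
        Represents U q as M → N * n + E ≡ D + S + p ^ g * M → Box ts D as n
      box-complete _ _ [] D as {M = M} _ _ refl _ rep eq = M , trans eq (cong (_+ p ^ g * M) (ℕ.+-identityʳ D)) , rep
      box-complete G≤L window ((A , κ) ∷ ts) D as {n} {M = M} ((_ , 1≤κ) ∷ proper) (κ∣ ∷ κ∣L) (e , S , refl , pps) w∉ rep eq with e ℕ.<? L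
      ... | yes e<L = inj₁ (e , e<L , box-complete G≤L window ts _ as proper κ∣L pps (w∉ ∘ there) rep
              (trans eq (cong (_+ p ^ g * M) (sym (ℕ.+-assoc D _ S)))))
      ... | no e≮L with outsideWindow G≤L window (κ * e)
                          (ℕ.≤-trans (ℕ.≮⇒≥ e≮L) (ℕ.≤-trans (ℕ.≤-reflexive (sym (ℕ.*-identityˡ e))) (ℕ.*-monoˡ-≤ e 1≤κ)))
                          (λ window≡ → w∉ (here (sym window≡)))
      ...   | ρ , m , ρ< , x≡ = inj₂ (ρ , ρ< ,
        ∣.∣m+n∣m⇒∣n {m = L * m} (subst (κ ∣_) (trans x≡ (ℕ.+-comm (g + ρ) _)) (∣.m∣m*n e)) (∣.∣m⇒∣m*n m κ∣) ,
        box-complete G≤L window ts D (A * p ^ ρ ∷ as) proper κ∣L pps (w∉ ∘ there) (m , M , _ , refl , rep) (begin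
          N * n + E                                             ≡⟨ eq ⟩
          D + (A * p ^ (κ * e) + S) + p ^ g * M                 ≡⟨ cong (λ y → D + (A * y + S) + p ^ g * M) power ⟩
          D + (A * (p ^ g * p ^ ρ * q ^ m) + S) + p ^ g * M
            ≡⟨ solve 7 (λ d a x y z s M → d :+ (a :* (x :* y :* z) :+ s) :+ x :* M := d :+ s :+ x :* (a :* y :* z :+ M))
                 refl D A (p ^ g) (p ^ ρ) (q ^ m) S M ⟩
          D + S + p ^ g * (A * p ^ ρ * q ^ m + M)               ∎))
        where
        open ≡-Reasoning
        power : p ^ (κ * e) ≡ p ^ g * p ^ ρ * q ^ m
        power = trans (cong (p ^_) x≡) (trans (ℕ.^-distribˡ-+-* p (g + ρ) (L * m))
          (cong₂ _*_ (ℕ.^-distribˡ-+-* p g ρ) (sym (ℕ.^-*-assoc p L m))))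

    commonMultiple : ∀ ts → All Proper ts → ∃[ κ ] 1 ≤ κ × All (λ (_ , κⱼ) → κⱼ ∣ κ) ts
    commonMultiple []             []                  = 1 , s≤s z≤n , []
    commonMultiple ((_ , κ) ∷ ts) ((_ , 1≤κ) ∷ proper) with commonMultiple ts proper
    ... | κ′ , 1≤κ′ , κ∣κ′ = κ * κ′ , ℕ.*-mono-≤ 1≤κ 1≤κ′ , ∣.m∣m*n κ′ ∷ All.map (∣.∣n⇒∣m*n κ) κ∣κ′

    realizable-primePowerSums : ∀ ts D → All Proper ts →
      Realizable (λ n → ∃[ S ] N * n + E ≡ D + S × PrimePowerSum p ts S)
    realizable-primePowerSums ts D proper with κ , 1≤κ , κⱼ∣κ ← commonMultiple ts proper =
      realizable-≐
        ( (λ (w , w<m , box) → let S , M , pps , M≡0 , eq = box-sound k G w ts D [] κ∣L box in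
             S , trans eq (trans (cong (λ M → D + S + p ^ (suc w * G) * M) M≡0)
               (trans (cong (D + S +_) (ℕ.*-zeroʳ (p ^ (suc w * G)))) (ℕ.+-identityʳ _))) , pps)
        , λ (S , eq , pps) → let w , w<1+len , w∉ = missing (map (λ x → x % suc k / G) (exponents ts pps))
                                 w<m = subst (w <_) (cong suc (trans (List.length-map (λ x → x % suc k / G) (exponents ts pps)) (length-exponents ts pps))) w<1+len in
             w , w<m , box-complete k G w G≤L (window w<m) ts D [] proper κ∣L pps w∉ refl
               (trans eq (sym (trans (cong (D + S +_) (ℕ.*-zeroʳ (p ^ (suc w * G)))) (ℕ.+-identityʳ _)))) )
        (realizable-⋃ m λ w _ → realizable-box k G w ts D [] proper [] (small w))
      where
      m A G k : ℕ
      -- One window more than there are exponents. G is a multiple of every κⱼ, hence so is L = m G,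
      -- and G > 2 A gives 2 A p ^ (L - G) < p ^ G p ^ (L - G) = q.
      m = suc (length ts)
      A = sum (map proj₁ ts)
      G = suc (A + A) * κ
      k = ℕ.pred (m * G)
      1≤G : 1 ≤ G
      1≤G = ℕ.*-mono-≤ {1} {suc (A + A)} (s≤s z≤n) 1≤κ
      instance
        G≢0 : NonZero G
        G≢0 = ℕ.>-nonZero {G} 1≤G
      L≡ : suc k ≡ m * G
      L≡ = ℕ.suc-pred (m * G) {{ℕ.>-nonZero (ℕ.*-mono-≤ {1} {m} (s≤s z≤n) 1≤G)}}
      window : ∀ {w} → w < m → suc w * G ≤ suc k
      window {w} w<m = subst (suc w * G ≤_) (sym L≡) (ℕ.*-monoˡ-≤ G w<m)
      G≤L : G ≤ suc k
      G≤L = subst (G ≤_) (sym L≡) (ℕ.m≤n*m G m)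
      κ∣L : All (λ (_ , κⱼ) → κⱼ ∣ suc k) ts
      κ∣L = All.map (λ {t} κⱼ∣κ → subst (proj₂ t ∣_) (sym L≡) (∣.∣n⇒∣m*n m (∣.∣n⇒∣m*n (suc (A + A)) κⱼ∣κ))) κⱼ∣κ
      small : ∀ w → Small k G w ts []
      small _ = begin-strict
        A * P + A * P              ≡⟨ ℕ.*-distribʳ-+ P A A ⟨
        (A + A) * P                <⟨ ℕ.*-monoˡ-< P {{ℕ.>-nonZero (ℕ.m^n>0 p {{ℕ.>-nonZero 1≤p}} (suc k ∸ G))}} 2A<p^G ⟩
        p ^ G * p ^ (suc k ∸ G)    ≡⟨ ℕ.^-distribˡ-+-* p G (suc k ∸ G) ⟨
        p ^ (G + (suc k ∸ G))      ≡⟨ cong (p ^_) (ℕ.m+[n∸m]≡n G≤L) ⟩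
        p ^ suc k                  ∎
        where
        open ℕ.≤-Reasoning
        P = p ^ (suc k ∸ G)
        2A<p^G : A + A < p ^ G
        2A<p^G = ℕ.≤-<-trans (ℕ.≤-trans (ℕ.n≤1+n (A + A)) (ℕ.≤-trans (ℕ.≤-reflexive (sym (ℕ.*-identityʳ _)))
          (ℕ.*-monoʳ-≤ (suc (A + A)) 1≤κ))) (n<b^n 2≤p G)

-- Integrality

module ClearingDenominators where

  open PrimePowerSums using (n<b^n; PrimePowerSum; Proper)
  open import Data.Nat.Base using (_+_; _*_; _^_)
  open import Data.Integer.Base using (+_; -[1+_]; ∣_∣; +≤+)
  open import Relation.Binary.PropositionalEquality using (refl; sym; trans; cong; cong₂; subst; module ≡-Reasoning)
  open Algebra.Properties.CommutativeMonoid.Sum ℚ.+-0-commutativeMonoid using () renaming (sum to ∑)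
  open Algebra.Properties.CommutativeMonoid.Sum ℤ.+-0-commutativeMonoid using () renaming (sum to ∑ℤ)


  fromℕ≡fromℤ : ∀ n → fromℕ n ≡ fromℤ (+ n)
  fromℕ≡fromℤ n = ℚ.↥p/↧p≡p (fromℤ (+ n))

  fromℤ-+ : ∀ i j → fromℤ i ℚ.+ fromℤ j ≡ fromℤ (i ℤ.+ j)
  fromℤ-+ i j = trans (cong (ℚ._/ 1) (cong₂ ℤ._+_ (ℤ.*-identityʳ i) (ℤ.*-identityʳ j))) (ℚ.↥p/↧p≡p (fromℤ (i ℤ.+ j)))

  fromℤ-* : ∀ i j → fromℤ i ℚ.* fromℤ j ≡ fromℤ (i ℤ.* j)
  fromℤ-* i j = ℚ.↥p/↧p≡p (fromℤ (i ℤ.* j))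

  fromℤ-injective : ∀ {i j} → fromℤ i ≡ fromℤ j → i ≡ j
  fromℤ-injective = cong ↥_

  denominator-* : ∀ x → fromℤ (+ ↧ₙ x) ℚ.* x ≡ fromℤ (↥ x)
  denominator-* x@record{} = ℚ.toℚᵘ-injective (ℚᵘ.≃-trans (ℚ.toℚᵘ-homo-* (fromℤ (+ ↧ₙ x)) x)
    (ℚᵘ.*≡* (trans (ℤ.*-identityʳ _) (trans (ℤ.*-comm (+ ↧ₙ x) (↥ x)) (cong (λ d → ↥ x ℤ.* + d) (sym (ℕ.+-identityʳ (↧ₙ x))))))))

  clear : ∀ {m} (c : Vector ℚ m) → ∃₂ λ N (a : Vector ℤ m) → 1 ≤ N × (∀ j → fromℤ (+ N) ℚ.* c j ≡ fromℤ (a j))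
  clear {zero}  c = 1 , (λ ()) , s≤s z≤n , λ ()
  clear {suc m} c with clear (c ∘ suc)
  ... | N , a , 1≤N , eq = d * N , a′ , ℕ.*-mono-≤ {1} {d} (s≤s z≤n) 1≤N , eq′
    where
    open ≡-Reasoning
    d = ↧ₙ (c zero)
    a′ : Vector ℤ (suc m)
    a′ zero    = + N ℤ.* ↥ (c zero)
    a′ (suc j) = + d ℤ.* a j
    dN : fromℤ (+ (d * N)) ≡ fromℤ (+ d) ℚ.* fromℤ (+ N)
    dN = sym (trans (fromℤ-* (+ d) (+ N)) (cong fromℤ (sym (ℤ.pos-* d N))))
    eq′ : ∀ j → fromℤ (+ (d * N)) ℚ.* c j ≡ fromℤ (a′ j)
    eq′ zero = begin
      fromℤ (+ (d * N)) ℚ.* c zero                  ≡⟨ cong (ℚ._* c zero) (trans dN (ℚ.*-comm (fromℤ (+ d)) (fromℤ (+ N)))) ⟩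
      fromℤ (+ N) ℚ.* fromℤ (+ d) ℚ.* c zero        ≡⟨ ℚ.*-assoc (fromℤ (+ N)) (fromℤ (+ d)) (c zero) ⟩
      fromℤ (+ N) ℚ.* (fromℤ (+ d) ℚ.* c zero)      ≡⟨ cong (fromℤ (+ N) ℚ.*_) (denominator-* (c zero)) ⟩
      fromℤ (+ N) ℚ.* fromℤ (↥ c zero)              ≡⟨ fromℤ-* (+ N) (↥ c zero) ⟩
      fromℤ (a′ zero)                               ∎
    eq′ (suc j) = begin
      fromℤ (+ (d * N)) ℚ.* c (suc j)               ≡⟨ cong (ℚ._* c (suc j)) dN ⟩
      fromℤ (+ d) ℚ.* fromℤ (+ N) ℚ.* c (suc j)     ≡⟨ ℚ.*-assoc (fromℤ (+ d)) (fromℤ (+ N)) (c (suc j)) ⟩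
      fromℤ (+ d) ℚ.* (fromℤ (+ N) ℚ.* c (suc j))   ≡⟨ cong (fromℤ (+ d) ℚ.*_) (eq j) ⟩
      fromℤ (+ d) ℚ.* fromℤ (a j)                   ≡⟨ fromℤ-* (+ d) (a j) ⟩
      fromℤ (a′ (suc j))                            ∎

  clear-∑ : ∀ {m} N (c : Vector ℚ m) (a : Vector ℤ m) (P : Vector ℕ m) → (∀ j → fromℤ (+ N) ℚ.* c j ≡ fromℤ (a j)) →
            fromℤ (+ N) ℚ.* ∑ (λ j → c j ℚ.* fromℕ (P j)) ≡ fromℤ (∑ℤ (λ j → a j ℤ.* + P j))
  clear-∑ {zero}  N c a P eq = ℚ.*-zeroʳ (fromℤ (+ N))
  clear-∑ {suc m} N c a P eq = begin
    fromℤ (+ N) ℚ.* (c zero ℚ.* fromℕ (P zero) ℚ.+ s)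
      ≡⟨ ℚ.*-distribˡ-+ (fromℤ (+ N)) (c zero ℚ.* fromℕ (P zero)) s ⟩
    fromℤ (+ N) ℚ.* (c zero ℚ.* fromℕ (P zero)) ℚ.+ fromℤ (+ N) ℚ.* s
      ≡⟨ cong₂ ℚ._+_ (trans (sym (ℚ.*-assoc (fromℤ (+ N)) (c zero) (fromℕ (P zero)))) (cong₂ ℚ._*_ (eq zero) (fromℕ≡fromℤ (P zero))))
           (clear-∑ N (c ∘ suc) (a ∘ suc) (P ∘ suc) (eq ∘ suc)) ⟩
    fromℤ (a zero) ℚ.* fromℤ (+ P zero) ℚ.+ fromℤ (∑ℤ (λ j → a (suc j) ℤ.* + P (suc j)))
      ≡⟨ trans (cong (ℚ._+ fromℤ (∑ℤ (λ j → a (suc j) ℤ.* + P (suc j)))) (fromℤ-* (a zero) (+ P zero))) (fromℤ-+ (a zero ℤ.* + P zero) _) ⟩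
    fromℤ (a zero ℤ.* + P zero ℤ.+ ∑ℤ (λ j → a (suc j) ℤ.* + P (suc j))) ∎
    where
    open ≡-Reasoning
    s = ∑ (λ j → c (suc j) ℚ.* fromℕ (P (suc j)))

  module _ (p : ℕ) (2≤p : 2 ≤ p) where

    value : ∀ {m} → Vector ℤ m → Vector ℕ m → Vector ℕ m → ℤ
    value a κ e = ∑ℤ (λ j → a j ℤ.* + (p ^ (κ j * e j)))

    -- A lower bound for the values. `base` absorbs the first term at exponent 0, so that the
    -- property passes to the tail.
    NonNegative : ∀ {m} → Vector ℤ m → Vector ℕ m → Set
    NonNegative {m} a κ = ∃[ base ] (∀ (e : Vector ℕ m) → ℤ.0ℤ ℤ.≤ base ℤ.+ value a κ e)

    consᵥ : ∀ {m} → ℕ → Vector ℕ m → Vector ℕ (suc m)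
    consᵥ e es zero    = e
    consᵥ e es (suc j) = es j

    nonNegative-tail : ∀ {m} (a : Vector ℤ (suc m)) κ → NonNegative a κ → NonNegative (a ∘ suc) (κ ∘ suc)
    nonNegative-tail a κ (base , 0≤) = base ℤ.+ a zero ℤ.* + (p ^ (κ zero * 0)) , λ e →
      subst (ℤ.0ℤ ℤ.≤_) (sym (ℤ.+-assoc base _ _)) (0≤ (consᵥ 0 e))

    -- A negative coefficient would make the value negative for a large
    -- exponent.
    nonNegative-head : ∀ {m} (a : Vector ℤ (suc m)) κ b → NonNegative a κ → 1 ≤ κ zero → a zero ≢ -[1+ b ]
    nonNegative-head {m} a κ b (base , 0≤) 1≤κ a₀≡ = ℕ.<⇒≱ (n<b^n 2≤p ∣ T ∣)
      (ℕ.≤-trans (ℕ.^-monoʳ-≤ p {{ℕ.>-nonZero (ℕ.≤-trans (s≤s z≤n) 2≤p)}}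
        (ℕ.≤-trans (ℕ.≤-reflexive (sym (ℕ.*-identityˡ ∣ T ∣))) (ℕ.*-monoˡ-≤ ∣ T ∣ 1≤κ)))
        (ℕ.≤-trans (ℕ.m≤n*m P (suc b)) (ℤ.drop‿+≤+ (ℤ.≤-trans bound (i≤∣i∣ T)))))
      where
      i≤∣i∣ : ∀ i → i ℤ.≤ + ∣ i ∣
      i≤∣i∣ (+ n)    = ℤ.≤-refl
      i≤∣i∣ -[1+ n ] = ℤ.-≤+
      -- T is the total of the other terms at exponents 0. With ∣ T ∣ as the exponent of the first
      -- term, nonnegativity would give p ^ ∣ T ∣ ≤ T ≤ ∣ T ∣.
      R T : ℤ
      R = value (a ∘ suc) (κ ∘ suc) (const 0)
      T = base ℤ.+ R
      P = p ^ (κ zero * ∣ T ∣)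
      bound : + (suc b * P) ℤ.≤ T
      bound = ℤ.0≤i-j⇒j≤i (subst (ℤ.0ℤ ℤ.≤_) (begin
        base ℤ.+ (a zero ℤ.* + P ℤ.+ R)               ≡⟨ cong (λ a₀ → base ℤ.+ (a₀ ℤ.* + P ℤ.+ R)) a₀≡ ⟩
        base ℤ.+ (-[1+ b ] ℤ.* + P ℤ.+ R)             ≡⟨ cong (λ x → base ℤ.+ (x ℤ.+ R)) (ℤ.neg-distribˡ-* (+ suc b) (+ P)) ⟨
        base ℤ.+ (ℤ.- (+ suc b ℤ.* + P) ℤ.+ R)        ≡⟨ cong (λ x → base ℤ.+ (ℤ.- x ℤ.+ R)) (ℤ.pos-* (suc b) P) ⟨
        base ℤ.+ (ℤ.- + (suc b * P) ℤ.+ R)            ≡⟨ solve 3 (λ base x R → base :+ (:- x :+ R) := base :+ R :- x) refl base (+ (suc b * P)) R ⟩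
        T ℤ.- + (suc b * P)                        ∎) (0≤ (consᵥ ∣ T ∣ (const 0))))
        where
        open ≡-Reasoning
        open ℤ-Solver.+-*-Solver

    -- Terms with κⱼ = 0 are constant; the positive ones go into D and the negative ones, with
    -- opposite sign, into E, so that both sides stay in ℕ.
    Representation : ∀ {m} → Vector ℤ m → Vector ℕ m → Set
    Representation {m} a κ = ∃[ ts ] ∃[ D ] ∃[ E ] All Proper ts ×
      (∀ e → ∃[ S ] PrimePowerSum p ts S × value a κ e ℤ.+ + E ≡ + (D + S)) ×
      (∀ {S} → PrimePowerSum p ts S → ∃[ e ] value a κ e ℤ.+ + E ≡ + (D + S))

    represent : ∀ {m} (a : Vector ℤ m) κ → NonNegative a κ → Representation a κ
    represent {zero}  a κ _ = [] , 0 , 0 , [] , (λ _ → 0 , refl , refl) , λ { refl → (λ ()) , refl }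
    represent {suc m} a κ nonneg with represent (a ∘ suc) (κ ∘ suc) (nonNegative-tail a κ nonneg)
    ... | ts , D , E , proper , to , from = head (κ zero) (a zero) refl refl
      where
      open ℤ-Solver.+-*-Solver
      v : Vector ℕ m → ℤ
      v = value (a ∘ suc) (κ ∘ suc)
      x : ℕ → ℤ
      x e = a zero ℤ.* + (p ^ (κ zero * e))
      head : ∀ κ₀ a₀ → κ zero ≡ κ₀ → a zero ≡ a₀ → Representation a κ
      head zero (+ A) κ₀≡ a₀≡ = ts , A + D , E , proper ,
        (λ e → let S , pps , eq = to (e ∘ suc) in S , pps , shift (e zero) (e ∘ suc) eq) ,
        λ pps → let e , eq = from pps in consᵥ 0 e , shift 0 e eq
        where
        shift : ∀ e₀ e {S} → v e ℤ.+ + E ≡ + (D + S) → x e₀ ℤ.+ v e ℤ.+ + E ≡ + (A + D + S)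
        shift e₀ e {S} eq = trans (ℤ.+-assoc (x e₀) (v e) (+ E)) (trans
          (cong₂ ℤ._+_ (trans (cong₂ (λ a k → a ℤ.* + (p ^ (k * e₀))) a₀≡ κ₀≡) (ℤ.*-identityʳ (+ A))) eq)
          (cong +_ (sym (ℕ.+-assoc A D S))))
      head zero -[1+ A ] κ₀≡ a₀≡ = ts , D , suc A + E , proper ,
        (λ e → let S , pps , eq = to (e ∘ suc) in S , pps , trans (shift (e zero) (e ∘ suc)) eq) ,
        λ pps → let e , eq = from pps in consᵥ 0 e , trans (shift 0 e) eq
        where
        shift : ∀ e₀ e → x e₀ ℤ.+ v e ℤ.+ + (suc A + E) ≡ v e ℤ.+ + E
        shift e₀ e = trans
          (cong (λ x → x ℤ.+ v e ℤ.+ + (suc A + E)) (trans (cong₂ (λ a k → a ℤ.* + (p ^ (k * e₀))) a₀≡ κ₀≡) (ℤ.*-identityʳ -[1+ A ])))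
          (solve 3 (λ A v E → :- A :+ v :+ (A :+ E) := v :+ E) refl (+ suc A) (v e) (+ E))
      head (suc k) (+ zero) κ₀≡ a₀≡ = ts , D , E , proper ,
        (λ e → let S , pps , eq = to (e ∘ suc) in S , pps , trans (shift (e zero) (e ∘ suc)) eq) ,
        λ pps → let e , eq = from pps in consᵥ 0 e , trans (shift 0 e) eq
        where
        shift : ∀ e₀ e → x e₀ ℤ.+ v e ℤ.+ + E ≡ v e ℤ.+ + E
        shift e₀ e = cong (ℤ._+ + E) (trans (cong (λ a → a ℤ.* + (p ^ (κ zero * e₀)) ℤ.+ v e) a₀≡) (ℤ.+-identityˡ (v e)))
      head (suc k) -[1+ b ] κ₀≡ a₀≡ =
        contradiction a₀≡ (nonNegative-head a κ b nonneg (subst (1 ≤_) (sym κ₀≡) (s≤s z≤n)))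
      head (suc k) (+ suc A) κ₀≡ a₀≡ = (suc A , suc k) ∷ ts , D , E , (s≤s z≤n , s≤s z≤n) ∷ proper ,
        (λ e → let S , pps , eq = to (e ∘ suc) in
           suc A * p ^ (suc k * e zero) + S , (e zero , S , refl , pps) , shift (e zero) (e ∘ suc) eq) ,
        λ { (e₀ , S , refl , pps) → let e , eq = from pps in consᵥ e₀ e , shift e₀ e eq }
        where
        shift : ∀ e₀ e {S} → v e ℤ.+ + E ≡ + (D + S) → x e₀ ℤ.+ v e ℤ.+ + E ≡ + (D + (suc A * p ^ (suc k * e₀) + S))
        shift e₀ e {S} eq = trans (ℤ.+-assoc (x e₀) (v e) (+ E)) (trans
          (cong₂ ℤ._+_ (trans (cong₂ (λ a k → a ℤ.* + (p ^ (k * e₀))) a₀≡ κ₀≡) (sym (ℤ.pos-* (suc A) (p ^ (suc k * e₀))))) eq)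
          (cong +_ (trans (sym (ℕ.+-assoc y D S)) (trans (cong (_+ S) (ℕ.+-comm y D)) (ℕ.+-assoc D y S)))))
          where y = suc A * p ^ (suc k * e₀)

    PrimePowerSums : Pred ℕ 0ℓ → Set
    PrimePowerSums A = ∃[ N ] ∃[ ts ] ∃[ D ] ∃[ E ] 1 ≤ N × All Proper ts ×
      ((λ n → ∃[ S ] N * n + E ≡ D + S × PrimePowerSum p ts S) ≐ A)

    module _ {A : Pred ℕ 0ℓ} {m} (c : Vector ℚ m) (κ : Vector ℕ m)
      (A≐B : (λ x → ∃[ n ] A n × x ≡ fromℕ n) ≐ B p c κ)
      (N : ℕ) (a : Vector ℤ m) (1≤N : 1 ≤ N) (cleared : ∀ j → fromℤ (+ N) ℚ.* c j ≡ fromℤ (a j)) where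

      value≡ : ∀ e {x n} → x ≡ ∑ (λ j → c j ℚ.* fromℕ (p ^ (κ j * e j))) → x ≡ fromℕ n → value a κ e ≡ + (N * n)
      value≡ e {x} {n} x≡∑ x≡n = fromℤ-injective (begin
        fromℤ (value a κ e)                                              ≡⟨ clear-∑ N c a (λ j → p ^ (κ j * e j)) cleared ⟨
        fromℤ (+ N) ℚ.* ∑ (λ j → c j ℚ.* fromℕ (p ^ (κ j * e j)))        ≡⟨ cong (fromℤ (+ N) ℚ.*_) x≡∑ ⟨
        fromℤ (+ N) ℚ.* x                                                ≡⟨ cong (fromℤ (+ N) ℚ.*_) (trans x≡n (fromℕ≡fromℤ n)) ⟩
        fromℤ (+ N) ℚ.* fromℤ (+ n)                                      ≡⟨ fromℤ-* (+ N) (+ n) ⟩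
        fromℤ (+ N ℤ.* + n)                                              ≡⟨ cong fromℤ (ℤ.pos-* N n) ⟨
        fromℤ (+ (N * n))                                                ∎)
        where open ≡-Reasoning

      -- Here the inclusion of the p-set in ℕ enters: every choice of exponents gives an element of
      -- A, so its cleared value is a nonnegative multiple of N.
      integral : ∀ e → ∃[ n ] A n × value a κ e ≡ + (N * n)
      integral e = let n , An , x≡n = proj₂ A≐B (e , refl) in n , An , value≡ e refl x≡n

      nonNegative : NonNegative a κ
      nonNegative = ℤ.0ℤ , λ e → let n , _ , eq = integral e in
        subst (ℤ.0ℤ ℤ.≤_) (sym (trans (ℤ.+-identityˡ (value a κ e)) eq)) (+≤+ z≤n)

      cleared⇒primePowerSums : Representation a κ → PrimePowerSums A
      cleared⇒primePowerSums (ts , D , E , proper , to , from) = N , ts , D , E , 1≤N , proper , ⊆A , A⊆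
        where
        ⊆A : ∀ {n} → (∃[ S ] N * n + E ≡ D + S × PrimePowerSum p ts S) → A n
        ⊆A {n} (S , eq , pps) =
          let e , e≡ = from pps
              n′ , An′ , n′≡ = integral e
          in subst A (ℕ.*-cancelˡ-≡ n′ n N {{ℕ.>-nonZero 1≤N}} (ℕ.+-cancelʳ-≡ E (N * n′) (N * n)
               (ℤ.+-injective (trans (trans (cong (ℤ._+ + E) (sym n′≡)) e≡) (cong +_ (sym eq)))))) An′
        A⊆ : ∀ {n} → A n → ∃[ S ] N * n + E ≡ D + S × PrimePowerSum p ts S
        A⊆ {n} An =
          let e , x≡∑ = proj₁ A≐B (n , An , refl)
              S , pps , e≡ = to e
          in S , ℤ.+-injective (trans (cong (ℤ._+ + E) (sym (value≡ e x≡∑ refl))) e≡) , pps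

    pSet⇒primePowerSums : ∀ {A} → IsPSet p A → PrimePowerSums A
    pSet⇒primePowerSums (m , _ , c , _ , κ , A≐B) =
      let N , a , 1≤N , cleared = clear c
      in cleared⇒primePowerSums c κ A≐B N a 1≤N cleared (represent a κ (nonNegative c κ A≐B N a 1≤N cleared))

-- Conclusion

module _ {c ℓ₁ ℓ₂ : Level} {p : ℕ} (p-prime : Prime p) (𝕂 : AlgebraicClosureOf𝔽⟨t⟩ p c ℓ₁ ℓ₂) where

  open AlgebraicClosureOf𝔽⟨t⟩ 𝕂 using (heytingField; _#?_)
  open Realization heytingField _#?_
  open PowerSumsRealizable p-prime 𝕂
  open PrimePowerSums using (module Boxes)
  open ClearingDenominators using (pSet⇒primePowerSums)

  realizable-progression : ∀ {A} → IsArithmeticProgression A → Realizable A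
  -- With common difference 0 the progression is a single point, eventually periodic with empty
  -- tail.
  realizable-progression (a , zero , A⊆ , ⊆A) = realizable-≐
    ((λ { ≡.refl → ⊆A (0 , ≡.sym (ℕ.+-identityʳ a)) }) , λ An → let t , eq = A⊆ An in ≡.trans eq (ℕ.+-identityʳ a))
    (realizable-periodic (ℕ._≟ a) (suc a) 1 (s≤s z≤n)
      (λ n a<n eq → contradiction (≡.sym eq) (ℕ.<⇒≢ a<n))
      (λ n a<n eq → contradiction (≡.sym eq) (ℕ.<⇒≢ (ℕ.≤-trans a<n (ℕ.m≤m+n n 1)))))
  realizable-progression (a , b@(suc _) , A⊆ , ⊆A) = realizable-≐
    ( (λ { {n} (a≤n , divides t eq) → ⊆A (t , ≡.trans (≡.sym (ℕ.m+[n∸m]≡n a≤n)) (≡.cong (a ℕ.+_) (≡.trans eq (ℕ.*-comm t b)))) })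
    , λ An → let t , eq = A⊆ An in ≡.subst (a ≤_) (≡.sym eq) (ℕ.m≤m+n a _) ,
        divides t (≡.trans (≡.cong (ℕ._∸ a) eq) (≡.trans (ℕ.m+n∸m≡n a _) (ℕ.*-comm b t))) )
    (realizable-periodic (λ n → (a ℕ.≤? n) ×-dec (b ∣? n ℕ.∸ a)) a b (s≤s z≤n)
      (λ n a≤n (_ , b∣) → ℕ.≤-trans a≤n (ℕ.m≤m+n n b) , ≡.subst (b ∣_) (≡.sym (shift n a≤n)) (∣.∣m∣n⇒∣m+n ∣.∣-refl b∣))
      (λ n a≤n (_ , b∣) → a≤n , ∣.∣m+n∣m⇒∣n (≡.subst (b ∣_) (shift n a≤n) b∣) ∣.∣-refl))
    where
    shift : ∀ n → a ≤ n → n ℕ.+ b ℕ.∸ a ≡ b ℕ.+ (n ℕ.∸ a)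
    shift n a≤n = ≡.trans (≡.cong (ℕ._∸ a) (ℕ.+-comm n b)) (ℕ.+-∸-assoc b a≤n)

  realizable-pSet : ∀ {A} → IsPSet p A → Realizable A
  realizable-pSet A-pSet =
    let N , ts , D , E , 1≤N , proper , eq = pSet⇒primePowerSums p (ℕ.nonTrivial⇒n>1 p {{prime⇒nonTrivial p-prime}}) A-pSet
    in realizable-≐ eq (Boxes.realizable-primePowerSums p-prime 𝕂 N E 1≤N ts D proper)

  realizable-Any : ∀ {ℓ} {As : List (Pred ℕ ℓ)} → All Realizable As → Realizable (λ n → Any (n ∈_) As)
  realizable-Any []       = realizable-≐ ((λ ()) , λ ()) realizable-∅
  realizable-Any (R ∷ Rs) = realizable-≐
    ((λ { (inj₁ An) → here An ; (inj₂ any) → there any }) , λ { (here An) → inj₁ An ; (there any) → inj₂ any })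
    (realizable-∪ R (realizable-Any Rs))

theorem1p6 : ∀ {c ℓ₁ ℓ₂ ℓ} (p : ℕ) → Prime p →
    (S : Pred ℕ ℓ) → IsFiniteUnionOfAPsAndPSets p S →
    (K : AlgebraicClosureOf𝔽⟨t⟩ p c ℓ₁ ℓ₂) →
    let open SplitTorus (AlgebraicClosureOf𝔽⟨t⟩.heytingField K) in
    Σ[ k ∈ ℕ ] 1 ≤ k ×
    Σ[ Φ ∈ Endomorphism k ] Σ[ α ∈ 𝔾ₘ^ k ] Σ[ V ∈ ClosedSubvariety k ]
    (λ n → fold α (apply Φ) n ∈ points V) ≐ S
theorem1p6 p p-prime S (As , Ps , progressions , pSets , S⊆ , ⊆S) K =
  realizable⇒orbitIntersection (realizable-≐ (⊆S , S⊆) (realizable-Any p-prime K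
    (All.++⁺ (All.map (realizable-progression p-prime K) progressions) (All.map (realizable-pSet p-prime K) pSets))))
  where
  open AlgebraicClosureOf𝔽⟨t⟩ K using (heytingField; _#?_)
  open Realization heytingField _#?_
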